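{- There is an algorithm that, given a bicolored tree $T$ on $n$ vertices, solves the Balanced Connected Subgraph problem (BCS) on $T$ in $O(n^2)$ time.
   Context: All graphs are finite, simple and undirected. A graph is bicolored if every vertex is colored blue or red (adjacent vertices may have the same color); $B$ and $R$ denote the sets of blue and red vertices. The Balanced Connected Subgraph problem (BCS): the input is a bicolored graph $G=(B\cup R,E)$; the output is a connected induced subgraph $H$ of $G$ with $|V(H)\cap B|=|V(H)\cap R|$ having the maximum number of vertices. The empty subgraph (of size $0$) counts as feasible, so an optimum always exists. Running times are in the standard unit-cost RAM model. -}

module Defs where

open import Data.Bool.Base using (if_then_else_; true; false)
open import Data.Fin.Base using (Fin; zero; suc; toℕ; fromℕ; inject₁)
open import Data.Fin.Subset using (Subset; Side; _∈_; _∩_; ∣_∣)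
open import Data.List.Base using (List; []; _∷_; _++_; _∷ʳ_; concatMap; drop; head; length)
open import Data.List.Membership.Propositional renaming (_∈_ to _∈ₗ_) using ()
open import Data.List.Relation.Unary.All using (All)
open import Data.List.Relation.Unary.AllPairs using (AllPairs)
open import Data.Maybe.Base using (Maybe; just; nothing)
open import Data.Nat.Base using (ℕ; zero; suc; _+_; _*_; _∸_; _≤_; NonZero)
import Data.Nat.Properties as ℕ
open import Data.Product.Base using (∃-syntax; _×_; _,_; swap; uncurry)
open import Data.Sum.Base using (_⊎_)
open import Data.Vec.Base using (tabulate; toList)
import Data.Vec.Base as Vec
open import Function.Definitions using (Injective)
open import Level using (0ℓ)
open import Relation.Binary.Construct.Closure.ReflexiveTransitive using (Star)
open import Relation.Binary.Core using (Rel)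
open import Relation.Binary.Definitions using (Decidable; DecidableEquality; Symmetric)
open import Relation.Binary.PropositionalEquality.Core using (_≡_; _≢_; refl)
open import Relation.Nullary using (¬_; does; yes; no)

record Graph (n : ℕ) : Set₁ where
  field
    _~_    : Rel (Fin n) 0ℓ
    _~?_   : Decidable _~_
    ~-sym  : Symmetric _~_
    ~-irr  : ∀ {v} → ¬ (v ~ v)

module _ {n : ℕ} (G : Graph n) where
  open Graph G

  Connected : Set
  Connected = ∀ u v → Star _~_ u v

  record Cycle : Set where
    field
      k         : ℕ
      vertex    : Fin (3 + k) → Fin n
      injective : Injective _≡_ _≡_ vertex
      step      : ∀ (i : Fin (2 + k)) → vertex (inject₁ i) ~ vertex (suc i)
      close     : vertex (fromℕ (2 + k)) ~ vertex zero

  record IsTree : Set where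
    field
      nonempty  : NonZero n
      connected : Connected
      acyclic   : ¬ Cycle

  InducedAdj : Subset n → Rel (Fin n) 0ℓ
  InducedAdj S u v = u ∈ S × v ∈ S × u ~ v

  -- Holds vacuously for the empty set.
  InducesConnected : Subset n → Set
  InducesConnected S = ∀ {u v} → u ∈ S → v ∈ S → Star (InducedAdj S) u v

data Colour : Set where
  blue red : Colour

_≟_ : DecidableEquality Colour
blue ≟ blue = yes refl
blue ≟ red  = no λ ()
red  ≟ blue = no λ ()
red  ≟ red  = yes refl

Colouring : ℕ → Set
Colouring n = Fin n → Colour

colourClass : ∀ {n} → Colouring n → Colour → Subset n
colourClass χ c = tabulate λ v → does (χ v ≟ c)

module _ {n : ℕ} (G : Graph n) (χ : Colouring n) where

  Balanced : Subset n → Set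
  Balanced S = ∣ S ∩ colourClass χ blue ∣ ≡ ∣ S ∩ colourClass χ red ∣

  -- An induced subgraph is identified with its vertex set.
  Feasible : Subset n → Set
  Feasible S = InducesConnected G S × Balanced S

  IsBCS : Subset n → Set
  IsBCS S = Feasible S × (∀ S′ → Feasible S′ → ∣ S′ ∣ ≤ ∣ S ∣)

-- Random access machines with the instruction set of Cook and Reckhow
-- (1973), over ℕ with truncated subtraction, and with uniform cost:
-- every executed instruction takes one unit of time.

data Instr : Set where
  const : (i c : ℕ) → Instr
  add   : (i j k : ℕ) → Instr
  sub   : (i j k : ℕ) → Instr
  load  : (i j : ℕ) → Instr
  store : (i j : ℕ) → Instr
  jpos  : (j l : ℕ) → Instr
  read  : (i : ℕ) → Instr
  print : (i : ℕ) → Instr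

Program : Set
Program = List Instr

Memory : Set
Memory = ℕ → ℕ

_[_↦_] : Memory → ℕ → ℕ → Memory
(X [ i ↦ x ]) j = if does (i ℕ.≟ j) then x else X j

record Config : Set where
  constructor config
  field
    pc     : ℕ
    mem    : Memory
    input  : List ℕ
    output : List ℕ

exec : Instr → Config → Config
exec (const i c) (config pc X is os) = config (suc pc) (X [ i ↦ c ]) is os
exec (add i j k) (config pc X is os) = config (suc pc) (X [ i ↦ X j + X k ]) is os
exec (sub i j k) (config pc X is os) = config (suc pc) (X [ i ↦ X j ∸ X k ]) is os
exec (load i j)  (config pc X is os) = config (suc pc) (X [ i ↦ X (X j) ]) is os
exec (store i j) (config pc X is os) = config (suc pc) (X [ X i ↦ X j ]) is os
exec (jpos j l)  (config pc X is os) with X j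
... | zero  = config (suc pc) X is os
... | suc _ = config l X is os
-- Reading past the end of the input yields 0.
exec (read i) (config pc X []       os) = config (suc pc) (X [ i ↦ 0 ]) [] os
exec (read i) (config pc X (x ∷ is) os) = config (suc pc) (X [ i ↦ x ]) is os
exec (print i) (config pc X is os) = config (suc pc) X is (os ∷ʳ X i)

fetch : Program → ℕ → Maybe Instr
fetch P pc = head (drop pc P)

-- t is the exact number of executed instructions.  A program halts when
-- its program counter leaves it; there is no separate halt instruction.
data _⊢_⇓[_]_ (P : Program) (c : Config) : ℕ → List ℕ → Set where
  halt : fetch P (Config.pc c) ≡ nothing →
         P ⊢ c ⇓[ 0 ] Config.output c
  step : ∀ {ins t os} → fetch P (Config.pc c) ≡ just ins →
         P ⊢ exec ins c ⇓[ t ] os → P ⊢ c ⇓[ suc t ] os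

initial : List ℕ → Config
initial is = config 0 (λ _ → 0) is []

_on_outputs_within_ : Program → List ℕ → List ℕ → ℕ → Set
P on is outputs os within b = ∃[ t ] t ≤ b × P ⊢ initial is ⇓[ t ] os

_∈O_ : (ℕ → ℕ) → (ℕ → ℕ) → Set
f ∈O g = ∃[ C ] ∃[ n₀ ] (∀ n → n₀ ≤ n → f n ≤ C * g n)

-- Every edge occurs once, in only one of its two orientations; the order
-- and the orientations are arbitrary.
record IsEdgeList {n : ℕ} (G : Graph n) (es : List (Fin n × Fin n)) : Set where
  open Graph G
  field
    sound    : All (uncurry _~_) es
    complete : ∀ {u v} → u ~ v → (u , v) ∈ₗ es ⊎ (v , u) ∈ₗ es
    distinct : AllPairs (λ e f → e ≢ f × e ≢ swap f) es

colourCode : Colour → ℕ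
colourCode blue = 0
colourCode red  = 1

encodeInput : ∀ {n} → Colouring n → List (Fin n × Fin n) → List ℕ
encodeInput {n} χ es =
  n ∷ toList (tabulate λ v → colourCode (χ v)) ++
  length es ∷ concatMap (λ (u , v) → toℕ u ∷ toℕ v ∷ []) es

sideCode : Side → ℕ
sideCode false = 0
sideCode true  = 1

encodeSubset : ∀ {n} → Subset n → List ℕ
encodeSubset S = toList (Vec.map sideCode S)

{-# OPTIONS --safe #-}

-- Grow a spanning tree from vertex 0 by n passes over the edges, attaching a vertex whenever an
-- edge has exactly one end in the tree, and contract it again in the reverse order.  The part D
-- of the tree that has been merged into v carries a table: for the connected sets S with
-- v ∈ S ⊆ D, the best S for every value of ∣D∣ + (blue vertices of S) − (red vertices of S).
-- Merging a child into its parent is a max-plus convolution, because S splits into its parts on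
-- both sides of the edge; its cost is proportional to the product of the sizes of the two parts,
-- and these products add up to at most n².  The solution is the largest entry at index ∣D∣.
--
-- Registers hold arbitrary naturals, so a set S is stored as the number Σ_{v ∈ S} (2ⁿ + 2ⁿ⁻¹⁻ᵛ):
-- it adds up over disjoint sets, orders sets by cardinality first, and determines S, so no
-- back-tracking through the tables is needed.

module Submission where

open import Data.Bool.Base using (Bool; true; false; if_then_else_; _∧_; _∨_)
open import Data.Empty using (⊥-elim)
open import Data.Fin using () renaming (#_ to class)
open import Data.Fin.Base using (Fin; zero; suc; toℕ; fromℕ; fromℕ<; inject₁)
import Data.Fin.Properties as Fin
open import Data.Fin.Subset using (Subset; _∈_; _∉_; _⊆_; _∩_; _∪_; ⁅_⁆; ∣_∣) renaming (⊥ to ∅)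
import Data.Fin.Subset.Properties as Sub
open import Data.List.Base as L using (List; []; _∷_; _++_; _∷ʳ_; concatMap; drop; foldl; head; length)
import Data.List.Membership.DecPropositional as DecMembership
open import Data.List.Membership.Propositional renaming (_∈_ to _∈ₗ_; _∉_ to _∉ₗ_) using ()
open import Data.List.Membership.Propositional.Properties using (∈-lookup)
import Data.List.Properties as List
open import Data.List.Relation.Unary.All as All using (All; []; _∷_)
import Data.List.Relation.Unary.All.Properties as All
open import Data.List.Relation.Unary.AllPairs using (AllPairs; []; _∷_)
open import Data.List.Relation.Unary.Any using (here; there)
open import Data.List.Relation.Unary.Unique.Propositional using (Unique)
open import Data.Maybe.Base using (just; nothing)
open import Data.Nat.Base using (ℕ; zero; suc; _+_; _*_; _∸_; _^_; _%_; _≤_; _<_; z≤n; s≤s; NonZero)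
import Data.Nat.DivMod as ℕ
import Data.Nat.Properties as ℕ
open import Data.Nat.Solver using (module +-*-Solver)
open import Data.Product.Base using (Σ-syntax; ∃-syntax; _×_; _,_; proj₁; proj₂; swap; uncurry)
open import Data.Sum.Base using (_⊎_; inj₁; inj₂)
open import Data.Unit.Base using (⊤; tt)
open import Data.Vec.Base using ([]; _∷_; here; there; tabulate; toList)
import Data.Vec.Properties as Vec
open import Function.Base using (_∘_)
open import Relation.Binary.Construct.Closure.ReflexiveTransitive as Star using (Star; ε; _◅_; _◅◅_)
open import Relation.Binary.PropositionalEquality
open import Relation.Nullary using (¬_; ¬?; Dec; does; yes; no; contradiction; decidable-stable)
open import Relation.Nullary.Decidable using (dec-true; dec-false)
open import Algebra.Properties.CommutativeSemigroup ℕ.+-commutativeSemigroup using (interchange; x∙yz≈y∙xz)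
open import Defs

-- A table only covers sets that contain its vertex, so the optimum has to be caught at its topmost
-- vertex `t`: once a vertex is merged into its parent its own part is frozen, and the optimum lies
-- inside the part of `t`. Hence the final maximum ranges over all vertices, not just the root. The
-- bound on the products is amortised: the sum of the squared sizes of the unmerged parts rises by
-- at least the product at each merge and ends at n² at most. Growing is quadratic too: a pass over
-- a tree that does not yet span attaches some vertex, and acyclicity limits a pass to n edges, so
-- no adjacency lists are needed. Truncated subtraction forces the index shift by ∣D∣. The entry 0
-- means both "no set", harmless since nonempty sets have positive codes, and the empty set, which a
-- child may contribute. As multiplication is missing, powers of two are tabulated and addresses
-- formed by doubling. Time means executed instructions, so the algorithm is written in a structured
-- language with a verified compiler, whose cost function is the exact instruction count.

-- A structured language over thirty unbounded arrays; a scalar is an array used at index 0 only.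

Class : Set
Class = Fin 30

Store : Set
Store = Class → ℕ → ℕ

infixl 6 _⊕_ _⊖_
infix  8 _‹_›
infix  4 _‹_›≔_
infixr 3 when_then_ repeat_times_
infixr 2 _⨾_

data Exp : Set where
  #_      : ℕ → Exp
  _⊕_ _⊖_ : Exp → Exp → Exp
  _‹_›    : Class → Exp → Exp

-- The number of iterations of a repeat loop is fixed on entry.
data Cmd : Set where
  _‹_›≔_        : Class → Exp → Exp → Cmd
  read          : Class → Exp → Cmd
  print         : Exp → Cmd
  _⨾_           : Cmd → Cmd → Cmd
  when_then_    : Exp → Cmd → Cmd
  repeat_times_ : Exp → Cmd → Cmd

record State : Set where
  constructor state
  field
    mem : Store
    inp : List ℕ
    out : List ℕ

open State public

⟦_⟧ : Exp → Store → ℕ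
⟦ # c ⟧ m = c
⟦ e ⊕ e′ ⟧ m = ⟦ e ⟧ m + ⟦ e′ ⟧ m
⟦ e ⊖ e′ ⟧ m = ⟦ e ⟧ m ∸ ⟦ e′ ⟧ m
⟦ a ‹ e › ⟧ m = m a (⟦ e ⟧ m)

put : Store → Class → ℕ → ℕ → Store
put m a i x b = if does (a Fin.≟ b) then m b [ i ↦ x ] else m b

hd : List ℕ → ℕ
hd []      = 0
hd (x ∷ _) = x

tl : List ℕ → List ℕ
tl []       = []
tl (_ ∷ xs) = xs

iter : ∀ {A : Set} → ℕ → (A → A) → A → A
iter zero    f x = x
iter (suc k) f x = iter k f (f x)

pick : ∀ {A : Set} → ℕ → A → A → A
pick zero    x y = x
pick (suc _) x y = y

run : Cmd → State → State
run (a ‹ e ›≔ e′) (state m is os) = state (put m a (⟦ e ⟧ m) (⟦ e′ ⟧ m)) is os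
run (read a e) (state m is os) = state (put m a (⟦ e ⟧ m) (hd is)) (tl is) os
run (print e) (state m is os) = state m is (os ∷ʳ ⟦ e ⟧ m)
run (C ⨾ D) σ = run D (run C σ)
run (when e then C) σ = pick (⟦ e ⟧ (mem σ)) σ (run C σ)
run (repeat e times C) σ = iter (⟦ e ⟧ (mem σ)) (run C) σ

-- These are exact instruction counts. The `7` is the length of `locate`; the last `1` is the
-- arithmetic instruction or the load.
costᴱ : Exp → ℕ
costᴱ (# c)     = 1
costᴱ (e ⊕ e′)  = costᴱ e + (costᴱ e′ + 1)
costᴱ (e ⊖ e′)  = costᴱ e + (costᴱ e′ + 1)
costᴱ (a ‹ e ›) = costᴱ e + 7 + 1

iterCost : ℕ → (State → State) → (State → ℕ) → State → ℕ
iterCost zero    f c σ = 0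
iterCost (suc k) f c σ = c σ + (3 + iterCost k f c (f σ))

-- The constants mirror the emitted code: 3 instructions test the condition of a `when`, 5 are those
-- of `enter`, and the 3 per iteration in `iterCost` are those of `again`.
cost : Cmd → State → ℕ
cost (a ‹ e ›≔ e′) σ = costᴱ e + 7 + (costᴱ e′ + 1)
cost (read a e) σ = costᴱ e + 7 + 2
cost (print e) σ = costᴱ e + 1
cost (C ⨾ D) σ = cost C σ + cost D (run C σ)
cost (when e then C) σ = costᴱ e + (3 + pick (⟦ e ⟧ (mem σ)) 0 (cost C σ))
cost (repeat e times C) σ =
  costᴱ e + (5 + iterCost (⟦ e ⟧ (mem σ)) (run C) (cost C) σ)

-- Compilation to the random access machine

-- Address 32 i + j is the i-th cell of the j-th region.  Region 0 holds
-- temporaries, region 1 the loop counters (one for each nesting depth), and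
-- region 2 + a the array a.

double : ℕ → ℕ
double x = x + x

-- Multiplication by 32 in the form in which the machine performs it, namely by five additions of a
-- register to itself.
shift : ℕ → ℕ
shift i = double (double (double (double (double i))))

opaque
  cell : ℕ → ℕ → ℕ
  cell j i = shift i + j

  cell-def : ∀ j i → cell j i ≡ shift i + j
  cell-def j i = refl

temp counter : ℕ → ℕ
temp    = cell 0
counter = cell 1

loc : Class → ℕ → ℕ
loc a = cell (2 + toℕ a)

locate : ℕ → Class → List Instr
locate k a =
  add (temp k) (temp k) (temp k) ∷ add (temp k) (temp k) (temp k) ∷
  add (temp k) (temp k) (temp k) ∷ add (temp k) (temp k) (temp k) ∷
  add (temp k) (temp k) (temp k) ∷ const (temp (suc k)) (2 + toℕ a) ∷
  add (temp k) (temp k) (temp (suc k)) ∷ []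

-- The temporaries form a stack of height `k`: the code touches none below `temp k`, so the left
-- operand survives while the right one is computed one level higher.
compileᴱ : ℕ → Exp → List Instr
compileᴱ k (# c)     = const (temp k) c ∷ []
compileᴱ k (e ⊕ e′)  =
  compileᴱ k e ++ compileᴱ (suc k) e′ ++ add (temp k) (temp k) (temp (suc k)) ∷ []
compileᴱ k (e ⊖ e′)  =
  compileᴱ k e ++ compileᴱ (suc k) e′ ++ sub (temp k) (temp k) (temp (suc k)) ∷ []
compileᴱ k (a ‹ e ›) = compileᴱ k e ++ locate k a ++ load (temp k) (temp k) ∷ []

-- The only conditional jump fires on a positive register. Subtracting from 1 turns a count of zero
-- into a positive value, so an empty loop is skipped; a `when` inverts its condition in the same
-- way.
enter : ℕ → ℕ → List Instr
enter d end =
  const (temp 1) 0 ∷ add (counter d) (temp 0) (temp 1) ∷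
  const (temp 1) 1 ∷ sub (temp 1) (temp 1) (temp 0) ∷ jpos (temp 1) end ∷ []

again : ℕ → ℕ → List Instr
again d start =
  const (temp 0) 1 ∷ sub (counter d) (counter d) (temp 0) ∷ jpos (counter d) start ∷ []

-- Jumps are absolute: o is the position at which the code is placed.
compile : ℕ → ℕ → Cmd → List Instr
compile d o (a ‹ e ›≔ e′) =
  compileᴱ 0 e ++ locate 0 a ++ compileᴱ 1 e′ ++ store (temp 0) (temp 1) ∷ []
compile d o (read a e) =
  compileᴱ 0 e ++ locate 0 a ++ read (temp 1) ∷ store (temp 0) (temp 1) ∷ []
compile d o (print e) = compileᴱ 0 e ++ print (temp 0) ∷ []
compile d o (C ⨾ D) =
  let c = compile d o C in c ++ compile d (o + length c) D
compile d o (when e then C) =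
  let b = compileᴱ 0 e
      c = compile d (o + length b + 3) C
  in b ++ (const (temp 1) 1 ∷ sub (temp 0) (temp 1) (temp 0) ∷
           jpos (temp 0) (o + length b + 3 + length c) ∷ []) ++ c
compile d o (repeat e times C) =
  let b = compileᴱ 0 e
      s = o + length b + 5
      c = compile (suc d) s C
  in b ++ enter d (s + length c + 3) ++ c ++ again d s

-- Correctness of the compiler

upd-same : ∀ (X : Memory) i x → (X [ i ↦ x ]) i ≡ x
upd-same X i x rewrite dec-true (i ℕ.≟ i) refl = refl

upd-other : ∀ (X : Memory) {i} x {j} → i ≢ j → (X [ i ↦ x ]) j ≡ X j
upd-other X {i} x {j} i≢j rewrite dec-false (i ℕ.≟ j) i≢j = refl

cell≡ : ∀ j i → cell j i ≡ j + i * 32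
cell≡ j i = begin
  cell j i    ≡⟨ cell-def j i ⟩
  shift i + j ≡⟨ ℕ.+-comm (shift i) j ⟩
  j + shift i ≡⟨ cong (j +_) (shift≡ i) ⟩
  j + i * 32  ∎
  where
  open ≡-Reasoning
  twice : ∀ i k → double (i * k) ≡ i * (k + k)
  twice i k = sym (ℕ.*-distribˡ-+ i k k)
  shift≡ : ∀ i → shift i ≡ i * 32
  shift≡ i = begin
    shift i                                 ≡⟨ cong shift (ℕ.*-identityʳ i) ⟨
    double (double (double (double (double (i * 1)))))
      ≡⟨ cong (λ x → double (double (double (double x)))) (twice i 1) ⟩
    double (double (double (double (i * 2)))) ≡⟨ cong (λ x → double (double (double x))) (twice i 2) ⟩
    double (double (double (i * 4)))        ≡⟨ cong (λ x → double (double x)) (twice i 4) ⟩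
    double (double (i * 8))                 ≡⟨ cong double (twice i 8) ⟩
    double (i * 16)                         ≡⟨ twice i 16 ⟩
    i * 32                                  ∎

cell-region : ∀ {j j′ i i′} → j < 32 → j′ < 32 → cell j i ≡ cell j′ i′ → j ≡ j′
cell-region {j} {j′} {i} {i′} j< j′< eq = begin
  j                   ≡⟨ ℕ.m<n⇒m%n≡m j< ⟨
  j % 32              ≡⟨ ℕ.[m+kn]%n≡m%n j i 32 ⟨
  (j + i * 32) % 32   ≡⟨ cong (_% 32) (trans (sym (cell≡ j i)) (trans eq (cell≡ j′ i′))) ⟩
  (j′ + i′ * 32) % 32 ≡⟨ ℕ.[m+kn]%n≡m%n j′ i′ 32 ⟩
  j′ % 32             ≡⟨ ℕ.m<n⇒m%n≡m j′< ⟩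
  j′                  ∎
  where open ≡-Reasoning

cell-index : ∀ {j i i′} → cell j i ≡ cell j i′ → i ≡ i′
cell-index {j} {i} {i′} eq = ℕ.*-cancelʳ-≡ i i′ 32
  (ℕ.+-cancelˡ-≡ j _ _ (trans (sym (cell≡ j i)) (trans eq (cell≡ j i′))))

-- The two reserved regions and the thirty classes exactly exhaust the residues modulo 32, which is
-- where the number thirty comes from.
loc< : ∀ (a : Class) → 2 + toℕ a < 32
loc< a = s≤s (s≤s (Fin.toℕ<n a))

temp≢loc : ∀ {k a i} → temp k ≢ loc a i
temp≢loc {k} {a} {i} eq =
  ℕ.0≢1+n (cell-region {0} {2 + toℕ a} {k} {i} (s≤s z≤n) (loc< a) eq)

counter≢loc : ∀ {d a i} → counter d ≢ loc a i
counter≢loc {d} {a} {i} eq =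
  ℕ.0≢1+n (ℕ.suc-injective (cell-region {1} {2 + toℕ a} {d} {i} (s≤s (s≤s z≤n)) (loc< a) eq))

temp≢counter : ∀ {k d} → temp k ≢ counter d
temp≢counter {k} {d} eq =
  ℕ.0≢1+n (cell-region {0} {1} {k} {d} (s≤s z≤n) (s≤s (s≤s z≤n)) eq)

-- Locating code by the suffix of the program at `o` makes fetching an instruction and splitting a
-- concatenation consequences of one equation.
record CodeAt (P : Program) (o : ℕ) (is : List Instr) : Set where
  constructor _,_
  field
    rest    : List Instr
    located : drop o P ≡ is ++ rest

module _ {P : Program} where

  codeˡ : ∀ {o} xs {ys} → CodeAt P o (xs ++ ys) → CodeAt P o xs
  codeˡ xs {ys} (post , eq) = ys ++ post , trans eq (List.++-assoc xs ys post)

  codeʳ : ∀ {o} xs {ys} → CodeAt P o (xs ++ ys) → CodeAt P (o + length xs) ys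
  codeʳ {o} xs {ys} (post , eq) = post , (begin
    drop (o + length xs) P              ≡⟨ List.drop-drop o (length xs) P ⟨
    drop (length xs) (drop o P)         ≡⟨ cong (drop (length xs)) eq ⟩
    drop (length xs) ((xs ++ ys) ++ post) ≡⟨ cong (drop (length xs)) (List.++-assoc xs ys post) ⟩
    drop (length xs) (xs ++ ys ++ post) ≡⟨ drop-++ xs ⟩
    ys ++ post                          ∎)
    where
    open ≡-Reasoning
    drop-++ : ∀ (zs : List Instr) {ws} → drop (length zs) (zs ++ ws) ≡ ws
    drop-++ []       = refl
    drop-++ (_ ∷ zs) = drop-++ zs

  code-tail : ∀ {o i is} → CodeAt P o (i ∷ is) → CodeAt P (suc o) is
  code-tail {o} {i} {is} code = subst (λ p → CodeAt P p is) (ℕ.+-comm o 1) (codeʳ {o} (i ∷ []) code)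

  code-fetch : ∀ {o i is} → CodeAt P o (i ∷ is) → fetch P o ≡ just i
  code-fetch (_ , eq) = cong head eq

infix 4 _⊢_↝[_]_

-- Halting runs do not compose. These partial runs do, and their exact lengths add up.
data _⊢_↝[_]_ (P : Program) (c : Config) : ℕ → Config → Set where
  here : P ⊢ c ↝[ 0 ] c
  next : ∀ {ins t c′} → fetch P (Config.pc c) ≡ just ins →
         P ⊢ exec ins c ↝[ t ] c′ → P ⊢ c ↝[ suc t ] c′

module _ {P : Program} where

  infixr 5 _▹_

  _▹_ : ∀ {c c′ c″ t t′} → P ⊢ c ↝[ t ] c′ → P ⊢ c′ ↝[ t′ ] c″ → P ⊢ c ↝[ t + t′ ] c″
  here      ▹ s = s
  next f s′ ▹ s = next f (s′ ▹ s)

  land : ∀ {c t p p′ X is os} → p ≡ p′ →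
         P ⊢ c ↝[ t ] config p X is os → P ⊢ c ↝[ t ] config p′ X is os
  land refl s = s

  steps⇒⇓ : ∀ {c t c′} → P ⊢ c ↝[ t ] c′ → fetch P (Config.pc c′) ≡ nothing →
            P ⊢ c ⇓[ t ] Config.output c′
  steps⇒⇓ here       none = halt none
  steps⇒⇓ (next f s) none = step f (steps⇒⇓ s none)

record Represents (X : Memory) (m : Store) : Set where
  constructor represents
  field
    lookup : ∀ a i → X (loc a i) ≡ m a i

open Represents

-- The frame condition of expression code: only temporaries from `k` upwards may change, so pending
-- operands, loop counters and arrays all survive.
record Agrees (k : ℕ) (X X′ : Memory) : Set where
  constructor agrees
  field
    untouched : ∀ z → (∀ j → k ≤ j → temp j ≢ z) → X′ z ≡ X z

open Agrees

agrees-refl : ∀ {k X} → Agrees k X X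
agrees-refl = agrees λ _ _ → refl

agrees-trans : ∀ {k X X′ X″} → Agrees k X X′ → Agrees k X′ X″ → Agrees k X X″
agrees-trans f g = agrees λ z z≢ → trans (untouched g z z≢) (untouched f z z≢)

agrees-suc : ∀ {k X X′} → Agrees (suc k) X X′ → Agrees k X X′
agrees-suc f = agrees λ z z≢ → untouched f z (λ j k<j → z≢ j (ℕ.<⇒≤ k<j))

agrees-upd : ∀ {k X X′} j x → k ≤ j → Agrees k X X′ → Agrees k X (X′ [ temp j ↦ x ])
agrees-upd {X′ = X′} j x k≤j f =
  agrees λ z z≢ → trans (upd-other X′ x (z≢ j k≤j)) (untouched f z z≢)

agrees-represents : ∀ {k X X′ m} → Agrees k X X′ → Represents X m → Represents X′ m
agrees-represents f r =
  represents λ a i → trans (untouched f _ (λ _ _ → temp≢loc)) (lookup r a i)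

agrees-temp : ∀ {k X X′} → Agrees (suc k) X X′ → X′ (temp k) ≡ X (temp k)
agrees-temp f = untouched f _ (λ j k<j eq → ℕ.<⇒≢ k<j (sym (cell-index eq)))

agrees-counter : ∀ {k X X′} d → Agrees k X X′ → X′ (counter d) ≡ X (counter d)
agrees-counter d f = untouched f _ (λ _ _ → temp≢counter)

length-++₂ : ∀ (xs ys : List Instr) o → o + length xs + length ys ≡ o + length (xs ++ ys)
length-++₂ xs ys o =
  trans (ℕ.+-assoc o (length xs) (length ys)) (cong (o +_) (sym (List.length-++ xs)))

length-++₃ : ∀ (xs ys zs : List Instr) o →
  o + length xs + length ys + length zs ≡ o + length (xs ++ ys ++ zs)
length-++₃ xs ys zs o =
  trans (length-++₂ ys zs (o + length xs)) (length-++₂ xs (ys ++ zs) o)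

length-++₄ : ∀ (xs ys zs ws : List Instr) o →
  o + length xs + length ys + length zs + length ws ≡ o + length (xs ++ ys ++ zs ++ ws)
length-++₄ xs ys zs ws o =
  trans (length-++₃ ys zs ws (o + length xs)) (length-++₂ xs (ys ++ zs ++ ws) o)

-- Correctness of compiled expressions

module _ {P : Program} {is os : List ℕ} where

  locate-correct : ∀ k a {o X i} → CodeAt P o (locate k a) → X (temp k) ≡ i →
    ∃[ X′ ] P ⊢ config o X is os ↝[ 7 ] config (o + 7) X′ is os ×
      X′ (temp k) ≡ loc a i × Agrees k X X′
  locate-correct k a {o} {X} {i} c₀ eq₀ =
    X₇ ,
    next (code-fetch c₀) (next (code-fetch c₁) (next (code-fetch c₂) (next (code-fetch c₃)
      (next (code-fetch c₄) (next (code-fetch c₅) (next (code-fetch c₆)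
        (land (ℕ.+-comm 7 o) here))))))) ,
    trans (upd-same X₆ t _) (trans
      (cong₂ _+_ (trans (upd-other X₅ _ t′≢t) eq₅) (upd-same X₅ t′ _)) (sym (cell-def _ i))) ,
    agrees-upd {X′ = X₆} k (X₆ t + X₆ t′) ℕ.≤-refl
      (agrees-upd {X′ = X₅} (suc k) (2 + toℕ a) (ℕ.n≤1+n k)
        (twice-agrees X₄ (twice-agrees X₃ (twice-agrees X₂ (twice-agrees X₁
          (twice-agrees X agrees-refl))))))
    where
    t t′ : ℕ
    t  = temp k
    t′ = temp (suc k)
    twice : Memory → Memory
    twice Y = Y [ t ↦ Y t + Y t ]
    twice-t : ∀ {Y x} → Y t ≡ x → twice Y t ≡ double x
    twice-t {Y} eq = trans (upd-same Y t _) (cong double eq)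
    twice-agrees : ∀ Y → Agrees k X Y → Agrees k X (twice Y)
    twice-agrees Y = agrees-upd {X′ = Y} k (Y t + Y t) ℕ.≤-refl
    t′≢t : t′ ≢ t
    t′≢t eq = ℕ.1+n≢n (cell-index eq)
    X₁ X₂ X₃ X₄ X₅ X₆ X₇ : Memory
    X₁ = twice X
    X₂ = twice X₁
    X₃ = twice X₂
    X₄ = twice X₃
    X₅ = twice X₄
    X₆ = X₅ [ t′ ↦ 2 + toℕ a ]
    X₇ = X₆ [ t ↦ X₆ t + X₆ t′ ]
    eq₅ : X₅ t ≡ shift i
    eq₅ = twice-t {X₄} (twice-t {X₃} (twice-t {X₂} (twice-t {X₁} (twice-t {X} eq₀))))
    c₁ = code-tail c₀
    c₂ = code-tail c₁
    c₃ = code-tail c₂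
    c₄ = code-tail c₃
    c₅ = code-tail c₄
    c₆ = code-tail c₅

  EvaluatesTo : ℕ → ℕ → Memory → ℕ → ℕ → ℕ → Set
  EvaluatesTo k o X t o′ x =
    ∃[ X′ ] P ⊢ config o X is os ↝[ t ] config o′ X′ is os ×
      X′ (temp k) ≡ x × Agrees k X X′

  prepend : ∀ {k o X X₁ t o₁ t₁ o₂ x} → P ⊢ config o X is os ↝[ t ] config o₁ X₁ is os →
    Agrees k X X₁ → EvaluatesTo k o₁ X₁ t₁ o₂ x → EvaluatesTo k o X (t + t₁) o₂ x
  prepend s a (X′ , s′ , x′ , a′) = X′ , s ▹ s′ , x′ , agrees-trans a a′

  abstract
    compileᴱ-correct : ∀ e k {o X m} → CodeAt P o (compileᴱ k e) → Represents X m →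
      EvaluatesTo k o X (costᴱ e) (o + length (compileᴱ k e)) (⟦ e ⟧ m)
    locate-index-correct : ∀ e k a {o X m} → CodeAt P o (compileᴱ k e) →
      CodeAt P (o + length (compileᴱ k e)) (locate k a) → Represents X m →
      EvaluatesTo k o X (costᴱ e + 7) (o + length (compileᴱ k e) + 7) (loc a (⟦ e ⟧ m))
    -- Abstracting the final instruction as an operation on two adjacent temporaries lets addition
    -- and subtraction share one proof.
    binary-correct : ∀ e e′ k {o X m} (i : Instr) (_∙_ : ℕ → ℕ → ℕ) →
      (∀ pc Y → exec i (config pc Y is os) ≡
        config (suc pc) (Y [ temp k ↦ Y (temp k) ∙ Y (temp (suc k)) ]) is os) →
      CodeAt P o (compileᴱ k e ++ compileᴱ (suc k) e′ ++ i ∷ []) → Represents X m →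
      EvaluatesTo k o X (costᴱ e + (costᴱ e′ + 1))
        (o + length (compileᴱ k e ++ compileᴱ (suc k) e′ ++ i ∷ [])) (⟦ e ⟧ m ∙ ⟦ e′ ⟧ m)

    compileᴱ-correct (# c) k {o} {X} code r =
      X [ temp k ↦ c ] , next (code-fetch code) (land (ℕ.+-comm 1 o) here) ,
      upd-same X (temp k) c , agrees-upd k c ℕ.≤-refl agrees-refl
    compileᴱ-correct (e ⊕ e′) k =
      binary-correct e e′ k (add (temp k) (temp k) (temp (suc k))) _+_ (λ _ _ → refl)
    compileᴱ-correct (e ⊖ e′) k =
      binary-correct e e′ k (sub (temp k) (temp k) (temp (suc k))) _∸_ (λ _ _ → refl)
    compileᴱ-correct (a ‹ e ›) k {o} {X} {m} code r =
      fetched (locate-index-correct e k a (codeˡ b code) (codeˡ (locate k a) (codeʳ b code)) r)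
      where
      b l : List Instr
      b = compileᴱ k e
      l = load (temp k) (temp k) ∷ []
      fetched : EvaluatesTo k o X (costᴱ e + 7) (o + length b + 7) (loc a (⟦ e ⟧ m)) →
        EvaluatesTo k o X (costᴱ e + 7 + 1) (o + length (b ++ locate k a ++ l)) (m a (⟦ e ⟧ m))
      fetched (X₂ , s₂ , x₂ , a₂) =
        X₂ [ temp k ↦ X₂ (X₂ (temp k)) ] ,
        s₂ ▹ next (code-fetch (codeʳ (locate k a) (codeʳ b code)))
          (land (trans (ℕ.+-comm 1 (o + length b + 7)) (length-++₃ b (locate k a) l o)) here) ,
        trans (upd-same X₂ (temp k) (X₂ (X₂ (temp k)))) (trans (cong X₂ x₂)
          (lookup (agrees-represents a₂ r) a (⟦ e ⟧ m))) ,
        agrees-upd k (X₂ (X₂ (temp k))) ℕ.≤-refl a₂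

    locate-index-correct e k a {o} {X} {m} code code′ r =
      located (compileᴱ-correct e k code r)
      where
      located : EvaluatesTo k o X (costᴱ e) (o + length (compileᴱ k e)) (⟦ e ⟧ m) →
        EvaluatesTo k o X (costᴱ e + 7) (o + length (compileᴱ k e) + 7) (loc a (⟦ e ⟧ m))
      located (X₁ , s₁ , x₁ , a₁) = prepend s₁ a₁ (locate-correct k a code′ x₁)

    binary-correct e e′ k {o} {X} {m} i _∙_ exec-i code r =
      first (compileᴱ-correct e k (codeˡ b code) r)
      where
      b b′ : List Instr
      b  = compileᴱ k e
      b′ = compileᴱ (suc k) e′
      second : ∀ {X₁} → X₁ (temp k) ≡ ⟦ e ⟧ m →
        EvaluatesTo (suc k) (o + length b) X₁ (costᴱ e′) (o + length b + length b′) (⟦ e′ ⟧ m) →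
        EvaluatesTo k (o + length b) X₁ (costᴱ e′ + 1) (o + length (b ++ b′ ++ i ∷ [])) (⟦ e ⟧ m ∙ ⟦ e′ ⟧ m)
      second x₁ (X₂ , s₂ , x₂ , a₂) =
        X₂ [ temp k ↦ y ] ,
        s₂ ▹ next (code-fetch (codeʳ b′ (codeʳ b code)))
          (subst (λ c → P ⊢ c ↝[ 0 ] config end (X₂ [ temp k ↦ y ]) is os)
            (sym (exec-i (o + length b + length b′) X₂))
            (land (trans (ℕ.+-comm 1 (o + length b + length b′)) (length-++₃ b b′ (i ∷ []) o)) here)) ,
        trans (upd-same X₂ (temp k) y) (cong₂ _∙_ (trans (agrees-temp a₂) x₁) x₂) ,
        agrees-upd k y ℕ.≤-refl (agrees-suc a₂)
        where
        y end : ℕ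
        y = X₂ (temp k) ∙ X₂ (temp (suc k))
        end = o + length (b ++ b′ ++ i ∷ [])
      first : EvaluatesTo k o X (costᴱ e) (o + length b) (⟦ e ⟧ m) →
        EvaluatesTo k o X (costᴱ e + (costᴱ e′ + 1)) (o + length (b ++ b′ ++ i ∷ [])) (⟦ e ⟧ m ∙ ⟦ e′ ⟧ m)
      first (X₁ , s₁ , x₁ , a₁) = prepend s₁ a₁ (second x₁
        (compileᴱ-correct e′ (suc k) (codeˡ b′ (codeʳ b code)) (agrees-represents a₁ r)))

loc-class : ∀ {a b i j} → loc a i ≡ loc b j → a ≡ b
loc-class {a} {b} {i} {j} eq = Fin.toℕ-injective (ℕ.suc-injective (ℕ.suc-injective
  (cell-region {2 + toℕ a} {2 + toℕ b} {i} {j} (loc< a) (loc< b) eq)))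

represents-put : ∀ {X m} a i x → Represents X m → Represents (X [ loc a i ↦ x ]) (put m a i x)
represents-put {X} {m} a i x r = represents put-at
  where
  put-at : ∀ b j → (X [ loc a i ↦ x ]) (loc b j) ≡ put m a i x b j
  put-at b j with a Fin.≟ b
  ... | no a≢b = trans (upd-other X x (a≢b ∘ loc-class)) (lookup r b j)
  ... | yes refl with i ℕ.≟ j
  ...   | yes refl = trans (upd-same X (loc a i) x) (sym (upd-same (m a) i x))
  ...   | no i≢j =
    trans (upd-other X x (i≢j ∘ cell-index)) (trans (lookup r a j) (sym (upd-other (m a) x i≢j)))

represents-temp : ∀ {X m} k x → Represents X m → Represents (X [ temp k ↦ x ]) m
represents-temp {X} k x r = represents λ a i → trans (upd-other X x temp≢loc) (lookup r a i)

represents-counter : ∀ {X m} d x → Represents X m → Represents (X [ counter d ↦ x ]) m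
represents-counter {X} d x r = represents λ a i → trans (upd-other X x counter≢loc) (lookup r a i)

jpos-zero : ∀ j l pc X is os → X j ≡ 0 →
  exec (jpos j l) (config pc X is os) ≡ config (suc pc) X is os
jpos-zero j l pc X is os eq with X j | eq
... | zero | _ = refl

jpos-suc : ∀ j l pc X is os {x} → X j ≡ suc x →
  exec (jpos j l) (config pc X is os) ≡ config l X is os
jpos-suc j l pc X is os eq with X j | eq
... | suc _ | _ = refl

-- The counters below d belong to the enclosing loops.
record Kept (d : ℕ) (X X′ : Memory) : Set where
  constructor keeps-counters
  field
    unchanged : ∀ j → j < d → X′ (counter j) ≡ X (counter j)

open Kept

kept-refl : ∀ {d X} → Kept d X X
kept-refl = keeps-counters λ _ _ → refl

kept-trans : ∀ {d X X′ X″} → Kept d X X′ → Kept d X′ X″ → Kept d X X″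
kept-trans f g = keeps-counters λ j j<d → trans (unchanged g j j<d) (unchanged f j j<d)

kept-upd : ∀ {d X} z x → (∀ j → j < d → z ≢ counter j) → Kept d X (X [ z ↦ x ])
kept-upd {X = X} z x z≢ = keeps-counters λ j j<d → upd-other X x (z≢ j j<d)

kept-temp : ∀ {d X} k x → Kept d X (X [ temp k ↦ x ])
kept-temp k x = kept-upd (temp k) x (λ _ _ → temp≢counter)

kept-counter : ∀ {d X} x → Kept d X (X [ counter d ↦ x ])
kept-counter {d} x = kept-upd (counter d) x (λ j j<d eq → ℕ.<⇒≢ j<d (sym (cell-index eq)))

kept-agrees : ∀ {k d X X′} → Agrees k X X′ → Kept d X X′
kept-agrees a = keeps-counters λ j _ → agrees-counter j a

kept-suc : ∀ {d X X′} → Kept (suc d) X X′ → Kept d X X′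
kept-suc f = keeps-counters λ j j<d → unchanged f j (ℕ.m<n⇒m<1+n j<d)

-- Correctness of compiled commands

module _ {P : Program} where

  next-by : ∀ {c ins c₁ t c′} → fetch P (Config.pc c) ≡ just ins → exec ins c ≡ c₁ →
    P ⊢ c₁ ↝[ t ] c′ → P ⊢ c ↝[ suc t ] c′
  next-by f refl s = next f s

  record Executes (X : Memory) (σ : State) (o t : ℕ) (σ′ : State) (o′ d : ℕ) : Set where
    constructor executes
    field
      {result}   : Memory
      steps      : P ⊢ config o X (inp σ) (out σ) ↝[ t ] config o′ result (inp σ′) (out σ′)
      stored     : Represents result (mem σ′)
      guarded    : Kept d X result

  executes-after : ∀ {d X X₁ σ σ₁ t o o₁ o₂ t₁ σ₂} →
    P ⊢ config o X (inp σ) (out σ) ↝[ t ] config o₁ X₁ (inp σ₁) (out σ₁) → Kept d X X₁ →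
    Executes X₁ σ₁ o₁ t₁ σ₂ o₂ d → Executes X σ o (t + t₁) σ₂ o₂ d
  executes-after s k (executes s₁ r₁ k₁) = executes (s ▹ s₁) r₁ (kept-trans k k₁)

  infixr 5 _▸_

  _▸_ : ∀ {d X σ t o o₁ o₂ σ₁ t₁ σ₂} → Executes X σ o t σ₁ o₁ d →
    (∀ {X₁} → Represents X₁ (mem σ₁) → Executes X₁ σ₁ o₁ t₁ σ₂ o₂ d) →
    Executes X σ o (t + t₁) σ₂ o₂ d
  _▸_ {σ₁ = σ₁} (executes s r k) f = executes-after {σ₁ = σ₁} s k (f r)

  after : ∀ {d k X σ t o o₁ o₂ t₁ σ₂ x} →
    EvaluatesTo {P} {inp σ} {out σ} k o X t o₁ x → Represents X (mem σ) →
    (∀ {X₁} → Represents X₁ (mem σ) → X₁ (temp k) ≡ x → Executes X₁ σ o₁ t₁ σ₂ o₂ d) →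
    Executes X σ o (t + t₁) σ₂ o₂ d
  after {σ = σ} (X₁ , s , x , a) r f =
    executes-after {σ₁ = σ} s (kept-agrees a) (f {X₁} (agrees-represents a r) x)

  after₁ : ∀ {d k X σ t o o₁ o₂ t₁ σ₂ x y} →
    EvaluatesTo {P} {inp σ} {out σ} (suc k) o X t o₁ x → Represents X (mem σ) → X (temp k) ≡ y →
    (∀ {X₁} → Represents X₁ (mem σ) → X₁ (temp k) ≡ y → X₁ (temp (suc k)) ≡ x →
      Executes X₁ σ o₁ t₁ σ₂ o₂ d) →
    Executes X σ o (t + t₁) σ₂ o₂ d
  after₁ {σ = σ} (X₁ , s , x , a) r y f =
    executes-after {σ₁ = σ} s (kept-agrees a) (f {X₁} (agrees-represents a r) (trans (agrees-temp a) y) x)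

  executes-land : ∀ {X σ o t σ′ o₁ o₂ d} → o₁ ≡ o₂ →
    Executes X σ o t σ′ o₁ d → Executes X σ o t σ′ o₂ d
  executes-land refl e = e

  Compiled : ℕ → ℕ → Cmd → Set
  Compiled d o C = ∀ {X σ} → Represents X (mem σ) →
    Executes X σ o (cost C σ) (run C σ) (o + length (compile d o C)) d

  store-correct : ∀ {d X σ o a i x} → fetch P o ≡ just (store (temp 0) (temp 1)) →
    Represents X (mem σ) → X (temp 0) ≡ loc a i → X (temp 1) ≡ x →
    Executes X σ o 1 (state (put (mem σ) a i x) (inp σ) (out σ)) (suc o) d
  store-correct {X = X} {a = a} {i} {x} f r eq₀ refl = executes {result = X [ X (temp 0) ↦ X (temp 1) ]}
    (next f here)
    (subst (λ z → Represents (X [ z ↦ x ]) (put _ a i x)) (sym eq₀) (represents-put a i x r))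
    (kept-upd _ x (λ j _ eq → counter≢loc (trans (sym eq) eq₀)))

  assign-correct : ∀ a e e′ {d o} → CodeAt P o (compile d o (a ‹ e ›≔ e′)) →
    Compiled d o (a ‹ e ›≔ e′)
  assign-correct a e e′ {d} {o} code {X} {σ} r =
    after (locate-index-correct e 0 a (codeˡ b code) (codeˡ l code₁) r) r λ r₁ z →
    after₁ (compileᴱ-correct e′ 1 (codeˡ b′ code₂) r₁) r₁ z λ r₂ z₂ x₂ →
    executes-land (trans (ℕ.+-comm 1 _) (length-++₄ b l b′ (store (temp 0) (temp 1) ∷ []) o))
      (store-correct {d = d} (code-fetch (codeʳ b′ code₂)) r₂ z₂ x₂)
    where
    b b′ l : List Instr
    b  = compileᴱ 0 e
    b′ = compileᴱ 1 e′
    l  = locate 0 a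
    code₁ : CodeAt P (o + length b) (l ++ b′ ++ store (temp 0) (temp 1) ∷ [])
    code₁ = codeʳ b code
    code₂ : CodeAt P (o + length b + 7) (b′ ++ store (temp 0) (temp 1) ∷ [])
    code₂ = codeʳ l code₁

  read-correct : ∀ a e {d o} → CodeAt P o (compile d o (read a e)) → Compiled d o (read a e)
  read-correct a e {d} {o} code {X} {σ} r =
    after (locate-index-correct e 0 a (codeˡ b code) (codeˡ l code₁) r) r λ r₁ z →
    executes-land (trans (ℕ.+-comm 2 _) (length-++₃ b l rs o)) (reading (inp σ) r₁ z)
    where
    b l rs : List Instr
    b  = compileᴱ 0 e
    l  = locate 0 a
    rs = read (temp 1) ∷ store (temp 0) (temp 1) ∷ []
    code₁ : CodeAt P (o + length b) (l ++ rs)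
    code₁ = codeʳ b code
    code₂ : CodeAt P (o + length b + 7) rs
    code₂ = codeʳ l code₁
    i : ℕ
    i = ⟦ e ⟧ (mem σ)
    temp₁≢temp₀ : temp 1 ≢ temp 0
    temp₁≢temp₀ eq = ℕ.1+n≢0 (cell-index eq)
    reading : ∀ is {X₁} → Represents X₁ (mem σ) → X₁ (temp 0) ≡ loc a i →
      Executes X₁ (state (mem σ) is (out σ)) (o + length b + 7) 2
        (state (put (mem σ) a i (hd is)) (tl is) (out σ)) (2 + (o + length b + 7)) d
    reading is {X₁} r₁ z = executes-after {σ₁ = σ₂} (read-step is) (kept-temp 1 (hd is))
      (store-correct {σ = σ₂} (code-fetch (code-tail code₂)) (represents-temp 1 (hd is) r₁)
        (trans (upd-other X₁ (hd is) temp₁≢temp₀) z) (upd-same X₁ (temp 1) (hd is)))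
      where
      p : ℕ
      p = o + length b + 7
      σ₂ : State
      σ₂ = state (mem σ) (tl is) (out σ)
      read-step : ∀ is → P ⊢ config p X₁ is (out σ) ↝[ 1 ]
        config (suc p) (X₁ [ temp 1 ↦ hd is ]) (tl is) (out σ)
      read-step []      = next (code-fetch code₂) here
      read-step (_ ∷ _) = next (code-fetch code₂) here

  print-correct : ∀ e {d o} → CodeAt P o (compile d o (print e)) → Compiled d o (print e)
  print-correct e {d} {o} code {X} {σ} r =
    after (compileᴱ-correct e 0 (codeˡ b code) r) r λ {X₁} r₁ z →
    executes
      (next-by (code-fetch (codeʳ b code))
        (cong (λ x → config (suc (o + length b)) X₁ (inp σ) (out σ ∷ʳ x)) z)
        (land (trans (ℕ.+-comm 1 _) (length-++₂ b (print (temp 0) ∷ []) o)) here))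
      r₁ kept-refl
    where
    b : List Instr
    b = compileᴱ 0 e

  seq-correct : ∀ C D {d o} → CodeAt P o (compile d o (C ⨾ D)) →
    Compiled d o C → Compiled d (o + length (compile d o C)) D → Compiled d o (C ⨾ D)
  seq-correct C D {d} {o} code C-ok D-ok {X} {σ} r =
    C-ok {X} {σ} r ▸ λ r₁ →
    executes-land (length-++₂ (compile d o C) (compile d (o + length (compile d o C)) D) o) (D-ok r₁)

  when-correct : ∀ e C {d o} → CodeAt P o (compile d o (when e then C)) →
    Compiled d (o + length (compileᴱ 0 e) + 3) C → Compiled d o (when e then C)
  when-correct e C {d} {o} code C-ok {X} {σ} r =
    after (compileᴱ-correct e 0 (codeˡ b code) r) r λ {X₁} r₁ z →
    executes-land (length-++₃ b js c o) (guard (⟦ e ⟧ (mem σ)) r₁ z)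
    where
    b c js : List Instr
    b = compileᴱ 0 e
    c = compile d (o + length b + 3) C
    end : ℕ
    end = o + length b + 3 + length c
    js = const (temp 1) 1 ∷ sub (temp 0) (temp 1) (temp 0) ∷ jpos (temp 0) end ∷ []
    code₀ : CodeAt P (o + length b) (js ++ c)
    code₀ = codeʳ b code
    code₁ : CodeAt P (suc (o + length b)) (sub (temp 0) (temp 1) (temp 0) ∷ jpos (temp 0) end ∷ c)
    code₁ = code-tail code₀
    code₂ : CodeAt P (suc (suc (o + length b))) (jpos (temp 0) end ∷ c)
    code₂ = code-tail code₁
    temp₁≢temp₀ : temp 1 ≢ temp 0
    temp₁≢temp₀ eq = ℕ.1+n≢0 (cell-index eq)
    guard : ∀ x {X₁} → Represents X₁ (mem σ) → X₁ (temp 0) ≡ x →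
      Executes X₁ σ (o + length b) (3 + pick x 0 (cost C σ)) (pick x σ (run C σ)) end d
    guard x {X₁} r₁ z = branch x X₃-temp₀
      where
      X₂ X₃ : Memory
      X₂ = X₁ [ temp 1 ↦ 1 ]
      X₃ = X₂ [ temp 0 ↦ X₂ (temp 1) ∸ X₂ (temp 0) ]
      X₃-temp₀ : X₃ (temp 0) ≡ 1 ∸ x
      X₃-temp₀ = trans (upd-same X₂ (temp 0) (X₂ (temp 1) ∸ X₂ (temp 0)))
        (cong₂ _∸_ (upd-same X₁ (temp 1) 1) (trans (upd-other X₁ 1 temp₁≢temp₀) z))
      r₃ : Represents X₃ (mem σ)
      r₃ = represents-temp 0 (X₂ (temp 1) ∸ X₂ (temp 0)) (represents-temp 1 1 r₁)
      k₃ : Kept d X₁ X₃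
      k₃ = kept-trans (kept-temp 1 1) (kept-temp 0 (X₂ (temp 1) ∸ X₂ (temp 0)))
      jump : ∀ {c₁} →
        exec (jpos (temp 0) end) (config (suc (suc (o + length b))) X₃ (inp σ) (out σ)) ≡ c₁ →
        P ⊢ config (o + length b) X₁ (inp σ) (out σ) ↝[ 3 ] c₁
      jump eq = next (code-fetch code₀) (next (code-fetch code₁) (next-by (code-fetch code₂) eq here))
      branch : ∀ x → X₃ (temp 0) ≡ 1 ∸ x →
        Executes X₁ σ (o + length b) (3 + pick x 0 (cost C σ)) (pick x σ (run C σ)) end d
      branch zero    eq = executes (jump (jpos-suc (temp 0) end _ X₃ (inp σ) (out σ) eq)) r₃ k₃
      branch (suc x) eq = executes-after {σ₁ = σ}
        (land (ℕ.+-comm 3 (o + length b)) (jump (jpos-zero (temp 0) end _ X₃ (inp σ) (out σ)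
          (trans eq (ℕ.0∸n≡0 x)))))
        k₃ (C-ok r₃)

  module _ (C : Cmd) (d s : ℕ) (code : CodeAt P s (compile (suc d) s C ++ again d s))
           (C-ok : Compiled (suc d) s C) where

    private
      c : List Instr
      c = compile (suc d) s C
      p end : ℕ
      p   = s + length c
      end = s + length c + 3
      code₀ : CodeAt P p (again d s)
      code₀ = codeʳ c code
      code₁ : CodeAt P (suc p) (sub (counter d) (counter d) (temp 0) ∷ jpos (counter d) s ∷ [])
      code₁ = code-tail code₀
      code₂ : CodeAt P (suc (suc p)) (jpos (counter d) s ∷ [])
      code₂ = code-tail code₁

    again-correct : ∀ k {X σ} → Represents X (mem σ) → X (counter d) ≡ suc k →
      ∃[ X′ ] P ⊢ config p X (inp σ) (out σ) ↝[ 3 ] config (pick k end s) X′ (inp σ) (out σ) ×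
        Represents X′ (mem σ) × Kept d X X′ × X′ (counter d) ≡ k
    again-correct k {X} {σ} r z = X₃ , jump k X₃-counter , r₃ , k₃ , X₃-counter
      where
      X₂ X₃ : Memory
      X₂ = X [ temp 0 ↦ 1 ]
      X₃ = X₂ [ counter d ↦ X₂ (counter d) ∸ X₂ (temp 0) ]
      X₃-counter : X₃ (counter d) ≡ k
      X₃-counter = trans (upd-same X₂ (counter d) (X₂ (counter d) ∸ X₂ (temp 0)))
        (cong₂ _∸_ (trans (upd-other X 1 temp≢counter) z) (upd-same X (temp 0) 1))
      r₃ : Represents X₃ (mem σ)
      r₃ = represents-counter d (X₂ (counter d) ∸ X₂ (temp 0)) (represents-temp 0 1 r)
      k₃ : Kept d X X₃
      k₃ = kept-trans (kept-temp 0 1) (kept-counter (X₂ (counter d) ∸ X₂ (temp 0)))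
      steps : ∀ {c₁} →
        exec (jpos (counter d) s) (config (suc (suc p)) X₃ (inp σ) (out σ)) ≡ c₁ →
        P ⊢ config p X (inp σ) (out σ) ↝[ 3 ] c₁
      steps eq = next (code-fetch code₀) (next (code-fetch code₁) (next-by (code-fetch code₂) eq here))
      jump : ∀ k → X₃ (counter d) ≡ k →
        P ⊢ config p X (inp σ) (out σ) ↝[ 3 ] config (pick k end s) X₃ (inp σ) (out σ)
      jump zero    eq =
        land (ℕ.+-comm 3 p) (steps (jpos-zero (counter d) s _ X₃ (inp σ) (out σ) eq))
      jump (suc k) eq = steps (jpos-suc (counter d) s _ X₃ (inp σ) (out σ) eq)

    -- The loop is cut at two program points: `loop-correct` starts before the body and `continue`
    -- at the closing test. The body is compiled at depth `suc d`, hence it preserves the counter of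
    -- this loop together with those of the enclosing ones.
    loop-correct : ∀ k {X σ} → Represents X (mem σ) → X (counter d) ≡ suc k →
      Executes X σ s (iterCost (suc k) (run C) (cost C) σ) (iter (suc k) (run C) σ) end d
    continue : ∀ k {X σ} → Represents X (mem σ) → X (counter d) ≡ suc k →
      Executes X σ p (3 + iterCost k (run C) (cost C) σ) (iter k (run C) σ) end d

    loop-correct k {X} {σ} r z = body (C-ok r)
      where
      body : Executes X σ s (cost C σ) (run C σ) p (suc d) →
        Executes X σ s (iterCost (suc k) (run C) (cost C) σ) (iter (suc k) (run C) σ) end d
      body (executes s₁ r₁ k₁) = executes-after {σ₁ = run C σ} s₁ (kept-suc k₁)
        (continue k r₁ (trans (unchanged k₁ d ℕ.≤-refl) z))

    continue zero {X} {σ} r z = finish (again-correct 0 r z)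
      where
      finish : ∃[ X′ ] P ⊢ config p X (inp σ) (out σ) ↝[ 3 ] config end X′ (inp σ) (out σ) ×
        Represents X′ (mem σ) × Kept d X X′ × X′ (counter d) ≡ 0 →
        Executes X σ p 3 σ end d
      finish (_ , s₁ , r₁ , k₁ , _) = executes s₁ r₁ k₁
    continue (suc k) {X} {σ} r z = restart (again-correct (suc k) r z)
      where
      restart : ∃[ X′ ] P ⊢ config p X (inp σ) (out σ) ↝[ 3 ] config s X′ (inp σ) (out σ) ×
        Represents X′ (mem σ) × Kept d X X′ × X′ (counter d) ≡ suc k →
        Executes X σ p (3 + iterCost (suc k) (run C) (cost C) σ) (iter (suc k) (run C) σ) end d
      restart (_ , s₁ , r₁ , k₁ , z₁) = executes-after {σ₁ = σ} s₁ k₁ (loop-correct k r₁ z₁)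

  repeat-correct : ∀ e C {d o} → CodeAt P o (compile d o (repeat e times C)) →
    Compiled (suc d) (o + length (compileᴱ 0 e) + 5) C → Compiled d o (repeat e times C)
  repeat-correct e C {d} {o} code C-ok {X} {σ} r =
    after (compileᴱ-correct e 0 (codeˡ b code) r) r λ {X₁} r₁ z →
    executes-land (length-++₄ b (enter d end) c (again d s) o) (guard (⟦ e ⟧ (mem σ)) r₁ z)
    where
    b c : List Instr
    b = compileᴱ 0 e
    q s end : ℕ
    q = o + length b
    s = q + 5
    c = compile (suc d) s C
    end = s + length c + 3
    code₀ : CodeAt P q (enter d end ++ c ++ again d s)
    code₀ = codeʳ b code
    code₅ : CodeAt P s (c ++ again d s)
    code₅ = codeʳ (enter d end) code₀
    guard : ∀ x {X₁} → Represents X₁ (mem σ) → X₁ (temp 0) ≡ x →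
      Executes X₁ σ q (5 + iterCost x (run C) (cost C) σ) (iter x (run C) σ) end d
    guard x {X₁} r₁ z = branch x X₅-counter X₅-temp₁
      where
      temp₁≢temp₀ : temp 1 ≢ temp 0
      temp₁≢temp₀ eq = ℕ.1+n≢0 (cell-index eq)
      X₂ X₃ X₄ X₅ : Memory
      X₂ = X₁ [ temp 1 ↦ 0 ]
      X₃ = X₂ [ counter d ↦ X₂ (temp 0) + X₂ (temp 1) ]
      X₄ = X₃ [ temp 1 ↦ 1 ]
      X₅ = X₄ [ temp 1 ↦ X₄ (temp 1) ∸ X₄ (temp 0) ]
      X₃-counter : X₃ (counter d) ≡ x
      X₃-counter = trans (upd-same X₂ (counter d) (X₂ (temp 0) + X₂ (temp 1)))
        (trans (cong₂ _+_ (trans (upd-other X₁ 0 temp₁≢temp₀) z) (upd-same X₁ (temp 1) 0))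
          (ℕ.+-identityʳ x))
      X₅-counter : X₅ (counter d) ≡ x
      X₅-counter = trans (upd-other X₄ (X₄ (temp 1) ∸ X₄ (temp 0)) temp≢counter)
        (trans (upd-other X₃ 1 temp≢counter) X₃-counter)
      X₄-temp₀ : X₄ (temp 0) ≡ x
      X₄-temp₀ = trans (upd-other X₃ 1 temp₁≢temp₀)
        (trans (upd-other X₂ (X₂ (temp 0) + X₂ (temp 1)) (temp≢counter ∘ sym))
          (trans (upd-other X₁ 0 temp₁≢temp₀) z))
      X₅-temp₁ : X₅ (temp 1) ≡ 1 ∸ x
      X₅-temp₁ = trans (upd-same X₄ (temp 1) (X₄ (temp 1) ∸ X₄ (temp 0)))
        (cong₂ _∸_ (upd-same X₃ (temp 1) 1) X₄-temp₀)
      r₅ : Represents X₅ (mem σ)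
      r₅ = represents-temp 1 (X₄ (temp 1) ∸ X₄ (temp 0)) (represents-temp 1 1
        (represents-counter d (X₂ (temp 0) + X₂ (temp 1)) (represents-temp 1 0 r₁)))
      k₅ : Kept d X₁ X₅
      k₅ = kept-trans (kept-temp 1 0) (kept-trans (kept-counter (X₂ (temp 0) + X₂ (temp 1)))
        (kept-trans (kept-temp 1 1) (kept-temp 1 (X₄ (temp 1) ∸ X₄ (temp 0)))))
      jump : ∀ {c₁} →
        exec (jpos (temp 1) end) (config (4 + q) X₅ (inp σ) (out σ)) ≡ c₁ →
        P ⊢ config q X₁ (inp σ) (out σ) ↝[ 5 ] c₁
      jump eq =
        next (code-fetch code₀) (next (code-fetch (code-tail code₀))
          (next (code-fetch (code-tail (code-tail code₀)))
            (next (code-fetch (code-tail (code-tail (code-tail code₀))))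
              (next-by (code-fetch (code-tail (code-tail (code-tail (code-tail code₀))))) eq here))))
      branch : ∀ x → X₅ (counter d) ≡ x → X₅ (temp 1) ≡ 1 ∸ x →
        Executes X₁ σ q (5 + iterCost x (run C) (cost C) σ) (iter x (run C) σ) end d
      branch zero    _ eq = executes (jump (jpos-suc (temp 1) end _ X₅ (inp σ) (out σ) eq)) r₅ k₅
      branch (suc x) z₅ eq = executes-after {σ₁ = σ}
        (land (ℕ.+-comm 5 q) (jump (jpos-zero (temp 1) end _ X₅ (inp σ) (out σ)
          (trans eq (ℕ.0∸n≡0 x)))))
        k₅ (loop-correct C d s code₅ C-ok x r₅ z₅)

  compile-correct : ∀ C {d o} → CodeAt P o (compile d o C) → Compiled d o C
  compile-correct (a ‹ e ›≔ e′) code = assign-correct a e e′ code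
  compile-correct (read a e)    code = read-correct a e code
  compile-correct (print e)     code = print-correct e code
  compile-correct (C ⨾ D) {d} {o} code =
    seq-correct C D code (compile-correct C (codeˡ c code)) (compile-correct D (codeʳ c code))
    where
    c : List Instr
    c = compile d o C
  compile-correct (when e then C) {d} {o} code = when-correct e C code
    (compile-correct C (codeʳ js (codeʳ (compileᴱ 0 e) code)))
    where
    end : ℕ
    end = o + length (compileᴱ 0 e) + 3 + length (compile d (o + length (compileᴱ 0 e) + 3) C)
    js : List Instr
    js = const (temp 1) 1 ∷ sub (temp 0) (temp 1) (temp 0) ∷ jpos (temp 0) end ∷ []
  compile-correct (repeat e times C) {d} {o} code = repeat-correct e C code
    (compile-correct C (codeˡ c (codeʳ (enter d (s + length c + 3)) (codeʳ (compileᴱ 0 e) code))))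
    where
    s : ℕ
    s = o + length (compileᴱ 0 e) + 5
    c : List Instr
    c = compile (suc d) s C

start : List ℕ → State
start is = state (λ _ _ → 0) is []

program : Cmd → Program
program C = compile 0 0 C

program-correct : ∀ C is → program C ⊢ initial is ⇓[ cost C (start is) ] out (run C (start is))
program-correct C is
  with compile-correct C {0} {0} ([] , sym (List.++-identityʳ (program C)))
         {λ _ → 0} {start is} (represents λ _ _ → refl)
-- The run ends with the program counter equal to the length of the program, so nothing can be
-- fetched and the machine halts.
... | executes s _ _ = steps⇒⇓ s (cong head (List.drop-all _ (program C) ℕ.≤-refl))

-- Weights of vertex sets

-- Cardinalities, colour counts and set codes are all weights, so additivity over disjoint unions is
-- proved once for all of them.
wt : ∀ {n} → (Fin n → ℕ) → Subset n → ℕ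
wt w []          = 0
wt w (true ∷ S)  = w zero + wt (w ∘ suc) S
wt w (false ∷ S) = wt (w ∘ suc) S

wt-∅ : ∀ {n} (w : Fin n → ℕ) → wt w ∅ ≡ 0
wt-∅ {zero}  w = refl
wt-∅ {suc n} w = wt-∅ (w ∘ suc)

wt-⁅⁆ : ∀ {n} (w : Fin n → ℕ) v → wt w ⁅ v ⁆ ≡ w v
wt-⁅⁆ w zero    = trans (cong (w zero +_) (wt-∅ (w ∘ suc))) (ℕ.+-identityʳ (w zero))
wt-⁅⁆ w (suc v) = wt-⁅⁆ (w ∘ suc) v

Disjoint : ∀ {n} → Subset n → Subset n → Set
Disjoint S T = ∀ {x} → x ∈ S → x ∉ T

wt-∪ : ∀ {n} (w : Fin n → ℕ) (S T : Subset n) → Disjoint S T → wt w (S ∪ T) ≡ wt w S + wt w T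
wt-∪ w []          []          dis = refl
wt-∪ w (true ∷ S)  (true ∷ T)  dis = contradiction here (dis here)
wt-∪ w (true ∷ S)  (false ∷ T) dis =
  trans (cong (w zero +_) (wt-∪ (w ∘ suc) S T (λ x∈ y∈ → dis (there x∈) (there y∈))))
    (sym (ℕ.+-assoc (w zero) (wt (w ∘ suc) S) (wt (w ∘ suc) T)))
wt-∪ w (false ∷ S) (true ∷ T)  dis =
  trans (cong (w zero +_) (wt-∪ (w ∘ suc) S T (λ x∈ y∈ → dis (there x∈) (there y∈))))
    (x∙yz≈y∙xz (w zero) (wt (w ∘ suc) S) (wt (w ∘ suc) T))
wt-∪ w (false ∷ S) (false ∷ T) dis =
  wt-∪ (w ∘ suc) S T (λ x∈ y∈ → dis (there x∈) (there y∈))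

wt-+ : ∀ {n} (v w : Fin n → ℕ) S → wt (λ x → v x + w x) S ≡ wt v S + wt w S
wt-+ v w []          = refl
wt-+ v w (true ∷ S)  = trans (cong (v zero + w zero +_) (wt-+ (v ∘ suc) (w ∘ suc) S))
  (interchange (v zero) (w zero) (wt (v ∘ suc) S) (wt (w ∘ suc) S))
wt-+ v w (false ∷ S) = wt-+ (v ∘ suc) (w ∘ suc) S

wt-const : ∀ {n} c (S : Subset n) → wt (λ _ → c) S ≡ ∣ S ∣ * c
wt-const c []          = refl
wt-const c (true ∷ S)  = cong (c +_) (wt-const c S)
wt-const c (false ∷ S) = wt-const c S

wt-positive : ∀ {n} {w : Fin n → ℕ} → (∀ v → 0 < w v) → ∀ {v S} → v ∈ S → 0 < wt w S
wt-positive {w = w} pos {S = true ∷ S}  v∈S = ℕ.<-≤-trans (pos zero) (ℕ.m≤m+n (w zero) (wt (w ∘ suc) S))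
wt-positive pos {S = false ∷ S} (there v∈S) = wt-positive (pos ∘ suc) v∈S

indicator : Bool → ℕ
indicator b = if b then 1 else 0

wt-colour : ∀ {n} (χ : Colouring n) c S →
  ∣ S ∩ colourClass χ c ∣ ≡ wt (λ v → indicator (does (χ v ≟ c))) S
wt-colour χ c []          = refl
wt-colour χ c (false ∷ S) = wt-colour (χ ∘ suc) c S
wt-colour χ c (true ∷ S) with does (χ zero ≟ c)
... | true  = cong suc (wt-colour (χ ∘ suc) c S)
... | false = wt-colour (χ ∘ suc) c S

∣∪∣ : ∀ {n} (S T : Subset n) → Disjoint S T → ∣ S ∪ T ∣ ≡ ∣ S ∣ + ∣ T ∣
∣∪∣ S T dis = begin
  ∣ S ∪ T ∣                               ≡⟨ ℕ.*-identityʳ _ ⟨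
  ∣ S ∪ T ∣ * 1                           ≡⟨ wt-const 1 (S ∪ T) ⟨
  wt (λ _ → 1) (S ∪ T)                    ≡⟨ wt-∪ (λ _ → 1) S T dis ⟩
  wt (λ _ → 1) S + wt (λ _ → 1) T         ≡⟨ cong₂ _+_ (wt-const 1 S) (wt-const 1 T) ⟩
  ∣ S ∣ * 1 + ∣ T ∣ * 1                   ≡⟨ cong₂ _+_ (ℕ.*-identityʳ ∣ S ∣) (ℕ.*-identityʳ ∣ T ∣) ⟩
  ∣ S ∣ + ∣ T ∣                           ∎
  where open ≡-Reasoning

-- Sets as numbers: vertex 0 is the most significant binary digit.

bit : ∀ {n} → Fin n → ℕ
bit {suc n} zero    = 2 ^ n
bit {suc n} (suc v) = bit v

bit≡ : ∀ {n} (v : Fin n) → bit v ≡ 2 ^ (n ∸ suc (toℕ v))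
bit≡ zero    = refl
bit≡ (suc v) = bit≡ v

wt-bit< : ∀ {n} (S : Subset n) → wt bit S < 2 ^ n
wt-bit< []          = s≤s z≤n
wt-bit< {suc n} (true ∷ S)  = subst (2 ^ n + wt bit S <_) (cong (2 ^ n +_) (sym (ℕ.+-identityʳ (2 ^ n))))
  (ℕ.+-monoʳ-< (2 ^ n) (wt-bit< S))
wt-bit< {suc n} (false ∷ S) = ℕ.<-≤-trans (wt-bit< S) (ℕ.m≤m+n (2 ^ n) (2 ^ n + 0))

-- Comparing the sums of these weights compares cardinalities first, and the sum
-- determines the set.
code : ∀ {n} → Fin n → ℕ
code {n} v = 2 ^ n + bit v

code>0 : ∀ {n} (v : Fin n) → 0 < code v
code>0 {n} v = ℕ.<-≤-trans (ℕ.m^n>0 2 n) (ℕ.m≤m+n (2 ^ n) (bit v))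

wt-code : ∀ {n} (S : Subset n) → wt code S ≡ ∣ S ∣ * 2 ^ n + wt bit S
wt-code {n} S = trans (wt-+ (λ _ → 2 ^ n) bit S) (cong (_+ wt bit S) (wt-const (2 ^ n) S))

-- The digits contribute less than `2 ^ n` in total, so they can never outweigh a difference of one
-- in cardinality.
wt-code-mono⁻ : ∀ {n} (S T : Subset n) → wt code S ≤ wt code T → ∣ S ∣ ≤ ∣ T ∣
wt-code-mono⁻ {n} S T le = ℕ.≤-pred (ℕ.*-cancelʳ-< (2 ^ n) (∣ S ∣) (suc ∣ T ∣) (begin-strict
  ∣ S ∣ * 2 ^ n             ≤⟨ ℕ.m≤m+n (∣ S ∣ * 2 ^ n) (wt bit S) ⟩
  ∣ S ∣ * 2 ^ n + wt bit S  ≡⟨ wt-code S ⟨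
  wt code S                 ≤⟨ le ⟩
  wt code T                 ≡⟨ wt-code T ⟩
  ∣ T ∣ * 2 ^ n + wt bit T  <⟨ ℕ.+-monoʳ-< (∣ T ∣ * 2 ^ n) (wt-bit< T) ⟩
  ∣ T ∣ * 2 ^ n + 2 ^ n     ≡⟨ ℕ.+-comm (∣ T ∣ * 2 ^ n) (2 ^ n) ⟩
  suc ∣ T ∣ * 2 ^ n         ∎))
  where open ℕ.≤-Reasoning

-- Walks

module _ {n : ℕ} {R : Fin n → Fin n → Set} {Q : Fin n → Set} (Q? : ∀ v → Dec (Q v)) where

  -- Take the first step of the walk that lands in `Q`. The arguments about spanning, about parts
  -- and about sets trapped in a part all extract a crossing edge in this way.
  walk-enters : ∀ {u v} → Star R u v → ¬ Q u → Q v → ∃[ x ] ∃[ y ] (R x y × ¬ Q x × Q y)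
  walk-enters ε ¬Qu Qu = contradiction Qu ¬Qu
  walk-enters {u} (_◅_ {j = w} u~w walk) ¬Qu Qv with Q? w
  ... | yes Qw = u , w , u~w , ¬Qu , Qw
  ... | no ¬Qw = walk-enters walk ¬Qw Qv

module _ {n : ℕ} (G : Graph n) where
  open Graph G

  -- A walk through S that leaves D at p can only come back at p: cut out the excursion.
  shortcut : ∀ (S D : Subset n) p → p ∈ S → p ∈ D →
    (∀ {a b} → InducedAdj G S a b → a ∈ D → b ∉ D → a ≡ p) →
    InducesConnected G S → InducesConnected G (S ∩ D)
  shortcut S D p p∈S p∈D exit conn {u} {v} u∈ v∈ =
    inside (conn (proj₁ (split u∈)) (proj₁ (split v∈))) (proj₂ (split u∈))
    where
    split : ∀ {x} → x ∈ S ∩ D → x ∈ S × x ∈ D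
    split = Sub.x∈p∩q⁻ S D
    v∈D : v ∈ D
    v∈D = proj₂ (split v∈)
    inside  : ∀ {a} → Star (InducedAdj G S) a v → a ∈ D → Star (InducedAdj G (S ∩ D)) a v
    outside : ∀ {a} → Star (InducedAdj G S) a v → a ∉ D → Star (InducedAdj G (S ∩ D)) p v
    inside ε a∈D = ε
    inside (_◅_ {j = b} ab@(a∈S , b∈S , a~b) walk) a∈D with b Sub.∈? D
    ... | yes b∈D = (Sub.x∈p∩q⁺ (a∈S , a∈D) , Sub.x∈p∩q⁺ (b∈S , b∈D) , a~b) ◅ inside walk b∈D
    ... | no b∉D with refl ← exit ab a∈D b∉D = outside walk b∉D
    outside ε v∉D = contradiction v∈D v∉D
    outside (_◅_ {j = b} (a∈S , b∈S , a~b) walk) a∉D with b Sub.∈? D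
    ... | no b∉D = outside walk b∉D
    ... | yes b∈D with refl ← exit (b∈S , a∈S , ~-sym a~b) b∈D a∉D = inside walk b∈D

  -- Simple paths and cycles

  data Path (W : Fin n → Set) : Fin n → Fin n → List (Fin n) → Set where
    stop : ∀ {u} → W u → Path W u u (u ∷ [])
    cons : ∀ {u v w xs} → W u → u ~ v → u ∉ₗ xs → Path W v w xs → Path W u w (u ∷ xs)

  module _ {W : Fin n → Set} where

    path-suffix : ∀ {a b w xs} → a ∈ₗ xs → Path W b w xs → ∃[ ys ] Path W a w ys
    path-suffix (here refl) path@(stop _)       = _ , path
    path-suffix (here refl) path@(cons _ _ _ _) = _ , path
    path-suffix (there a∈)  (cons _ _ _ path)   = path-suffix a∈ path

    path-within : ∀ {u w xs x} → Path W u w xs → x ∈ₗ xs → W x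
    path-within (stop Wu)         (here refl) = Wu
    path-within (cons Wu _ _ _)   (here refl) = Wu
    path-within (cons _ _ _ path) (there x∈)  = path-within path x∈

    open DecMembership (Fin._≟_ {n}) using (_∈?_)

    -- Loop erasure: if the starting vertex already lies on the path found for the rest of the walk,
    -- only the suffix from that vertex on is kept.
    walk⇒path : ∀ {u v} → W u → Star (λ a b → W a × W b × a ~ b) u v → ∃[ xs ] Path W u v xs
    walk⇒path Wu ε = _ , stop Wu
    walk⇒path {u} Wu ((_ , Wb , u~b) ◅ walk) with walk⇒path Wb walk
    ... | xs , path with u ∈? xs
    ...   | yes u∈xs = path-suffix u∈xs path
    ...   | no u∉xs  = _ , cons Wu u~b u∉xs path

    path-step : ∀ {u w x xs} → Path W u w (x ∷ xs) → ∀ i →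
      L.lookup (x ∷ xs) (inject₁ i) ~ L.lookup (x ∷ xs) (suc i)
    path-step (cons _ u~v _ (stop _))         zero    = u~v
    path-step (cons _ u~v _ (cons _ _ _ _))   zero    = u~v
    path-step (cons _ _ _ path@(cons _ _ _ _)) (suc i) = path-step path i

    path-last : ∀ {u w x xs} → Path W u w (x ∷ xs) → L.lookup (x ∷ xs) (fromℕ (length xs)) ≡ w
    path-last (stop _) = refl
    path-last (cons _ _ _ path@(stop _))       = path-last path
    path-last (cons _ _ _ path@(cons _ _ _ _)) = path-last path

    path-injective : ∀ {u w xs} → Path W u w xs → ∀ i j → L.lookup xs i ≡ L.lookup xs j → i ≡ j
    path-injective (stop _)            zero    zero    _  = refl
    path-injective (cons _ _ _ _)      zero    zero    _  = refl
    path-injective (cons {xs = xs} _ _ u∉ _) zero (suc j) eq =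
      contradiction (subst (_∈ₗ xs) (sym eq) (∈-lookup j)) u∉
    path-injective (cons {xs = xs} _ _ u∉ _) (suc i) zero eq =
      contradiction (subst (_∈ₗ xs) eq (∈-lookup i)) u∉
    path-injective (cons _ _ _ path)   (suc i) (suc j) eq = cong suc (path-injective path i j eq)

    -- The vertex `c` lies off the path because the path stays within `W`, so it closes the path
    -- without repetition; `p ≢ w` gives the path a second vertex, hence the cycle at least three.
    path⇒cycle : ∀ {c p w xs} → ¬ W c → c ~ p → c ~ w → p ≢ w → Path W p w xs → Cycle G
    path⇒cycle ¬Wc c~p c~w p≢w (stop _) = contradiction refl p≢w
    path⇒cycle {c} ¬Wc c~p c~w p≢w path@(cons {u = p} {xs = y ∷ ys} _ _ _ rest) = record
      { k         = length ys
      ; vertex    = L.lookup (c ∷ p ∷ y ∷ ys)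
      ; injective = λ {i} {j} → injective i j
      ; step      = steps
      ; close     = subst (_~ c) (sym (path-last path)) (~-sym c~w)
      }
      where
      c∉ : c ∉ₗ p ∷ y ∷ ys
      c∉ c∈ = ¬Wc (path-within path c∈)
      injective : ∀ i j → L.lookup (c ∷ p ∷ y ∷ ys) i ≡ L.lookup (c ∷ p ∷ y ∷ ys) j → i ≡ j
      injective zero    zero    _  = refl
      injective zero    (suc j) eq = contradiction (subst (_∈ₗ p ∷ y ∷ ys) (sym eq) (∈-lookup j)) c∉
      injective (suc i) zero    eq = contradiction (subst (_∈ₗ p ∷ y ∷ ys) eq (∈-lookup i)) c∉
      injective (suc i) (suc j) eq = cong suc (path-injective path i j eq)
      steps : ∀ i → L.lookup (c ∷ p ∷ y ∷ ys) (inject₁ i) ~ L.lookup (c ∷ p ∷ y ∷ ys) (suc i)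
      steps zero    = c~p
      steps (suc i) = path-step path i

-- Growing a spanning tree: the list holds the pairs (child , parent), latest first.

module Growth {n : ℕ} (r : Fin n) where

  open DecMembership (Fin._≟_ {n}) using (_∈?_)

  Pairs : Set
  Pairs = List (Fin n × Fin n)

  -- During growth these are the vertices of the tree. During contraction, which consumes the list
  -- from its head, they are the vertices not yet merged into a parent.
  active : Pairs → List (Fin n)
  active []            = r ∷ []
  active ((c , _) ∷ L) = c ∷ active L

  r∈active : ∀ L → r ∈ₗ active L
  r∈active []      = here refl
  r∈active (_ ∷ L) = there (r∈active L)

  length-active : ∀ L → length (active L) ≡ suc (length L)
  length-active []      = refl
  length-active (_ ∷ L) = cong suc (length-active L)

  attach : Fin n → Fin n → Pairs → Pairs
  attach c p L with p ∈? active L | c ∈? active L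
  ... | yes _ | no _  = (c , p) ∷ L
  ... | yes _ | yes _ = L
  ... | no _  | _     = L

  -- The edge list fixes an arbitrary orientation, so both are tried. At most one succeeds, since
  -- after a success both ends are active.
  attachEdge : Pairs → Fin n × Fin n → Pairs
  attachEdge L (u , v) = attach u v (attach v u L)

  pass : Pairs → List (Fin n × Fin n) → Pairs
  pass = foldl attachEdge

  passes : ℕ → List (Fin n × Fin n) → Pairs
  passes zero    es = []
  passes (suc k) es = pass (passes k es) es

  -- Having equality itself as the alternative to strict growth lets `progress` refute an idle pass:
  -- what the pass reaches would already be active.
  record _⊑_ (L L′ : Pairs) : Set where
    field
      keeps : ∀ {v} → v ∈ₗ active L → v ∈ₗ active L′
      grows : L′ ≡ L ⊎ length L < length L′

  open _⊑_

  ⊑-refl : ∀ {L} → L ⊑ L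
  ⊑-refl = record { keeps = λ v∈ → v∈ ; grows = inj₁ refl }

  ⊑-trans : ∀ {L L′ L″} → L ⊑ L′ → L′ ⊑ L″ → L ⊑ L″
  ⊑-trans {L} {L′} {L″} p q = record { keeps = keeps q ∘ keeps p ; grows = both (grows p) (grows q) }
    where
    both : L′ ≡ L ⊎ length L < length L′ → L″ ≡ L′ ⊎ length L′ < length L″ →
      L″ ≡ L ⊎ length L < length L″
    both (inj₁ refl) g           = g
    both (inj₂ lt)   (inj₁ refl) = inj₂ lt
    both (inj₂ lt)   (inj₂ lt′)  = inj₂ (ℕ.<-trans lt lt′)

  attach-⊑ : ∀ c p L → L ⊑ attach c p L
  attach-⊑ c p L with p ∈? active L | c ∈? active L
  ... | yes _ | no _  = record { keeps = there ; grows = inj₂ ℕ.≤-refl }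
  ... | yes _ | yes _ = ⊑-refl
  ... | no _  | _     = ⊑-refl

  attachEdge-⊑ : ∀ L e → L ⊑ attachEdge L e
  attachEdge-⊑ L (u , v) = ⊑-trans (attach-⊑ v u L) (attach-⊑ u v (attach v u L))

  pass-⊑ : ∀ L es → L ⊑ pass L es
  pass-⊑ L []       = ⊑-refl
  pass-⊑ L (e ∷ es) = ⊑-trans (attachEdge-⊑ L e) (pass-⊑ (attachEdge L e) es)

  attach-child : ∀ c p L → p ∈ₗ active L → c ∈ₗ active (attach c p L)
  attach-child c p L p∈ with p ∈? active L | c ∈? active L
  ... | yes _  | no _   = here refl
  ... | yes _  | yes c∈ = c∈
  ... | no p∉  | _      = contradiction p∈ p∉

  -- Active vertices stay active, so `u` is still active when the pass meets the edge, and `v`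
  -- becomes active then at the latest.
  pass-reaches : ∀ {u v} es L → u ∈ₗ active L → (u , v) ∈ₗ es ⊎ (v , u) ∈ₗ es →
    v ∈ₗ active (pass L es)
  pass-reaches {u} {v} (e ∷ es) L u∈ (inj₁ (here refl)) =
    keeps (pass-⊑ (attachEdge L e) es)
      (keeps (attach-⊑ u v (attach v u L)) (attach-child v u L u∈))
  pass-reaches {u} {v} (e ∷ es) L u∈ (inj₂ (here refl)) =
    keeps (pass-⊑ (attachEdge L e) es)
      (attach-child v u (attach u v L) (keeps (attach-⊑ u v L) u∈))
  pass-reaches (e ∷ es) L u∈ (inj₁ (there e∈)) =
    pass-reaches es (attachEdge L e) (keeps (attachEdge-⊑ L e) u∈) (inj₁ e∈)
  pass-reaches (e ∷ es) L u∈ (inj₂ (there e∈)) =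
    pass-reaches es (attachEdge L e) (keeps (attachEdge-⊑ L e) u∈) (inj₂ e∈)

  unique⇒length≤ : ∀ {xs : List (Fin n)} → Unique xs → length xs ≤ n
  unique⇒length≤ {xs} uniq = Fin.injective⇒≤ {f = L.lookup xs} (λ {i} {j} → injective uniq i j)
    where
    injective : ∀ {xs : List (Fin n)} → Unique xs → ∀ i j → L.lookup xs i ≡ L.lookup xs j → i ≡ j
    injective (_ ∷ _)  zero    zero    eq = refl
    injective (x≢ ∷ _) zero    (suc j) eq = contradiction eq (All.lookup x≢ (∈-lookup j))
    injective (x≢ ∷ _) (suc i) zero    eq = contradiction (sym eq) (All.lookup x≢ (∈-lookup i))
    injective (_ ∷ u)  (suc i) (suc j) eq = cong suc (injective u i j eq)

  module Tree (G : Graph n) where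
    open Graph G

    data Grown : Pairs → Set where
      []   : Grown []
      grow : ∀ {c p L} → c ∉ₗ active L → p ∈ₗ active L → c ~ p → Grown L → Grown ((c , p) ∷ L)

    grown-unique : ∀ {L} → Grown L → Unique (active L)
    grown-unique []                    = [] ∷ []
    grown-unique (grow c∉ _ _ grown) =
      All.¬Any⇒All¬ _ c∉ ∷ grown-unique grown

    grown-length : ∀ {L} → Grown L → length L < n
    grown-length {L} grown =
      subst (_≤ n) (length-active L) (unique⇒length≤ (grown-unique grown))

    grown-head : ∀ {c p L} → Grown ((c , p) ∷ L) →
      c ∉ₗ active L × p ∈ₗ active L × c ~ p × Grown L
    grown-head (grow c∉ p∈ c~p grown) = c∉ , p∈ , c~p , grown

    grown-ends : ∀ {L c p} → Grown L → (c , p) ∈ₗ L → c ∈ₗ active L × p ∈ₗ active L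
    grown-ends (grow _ p∈ _ _) (here refl) = here refl , there p∈
    grown-ends (grow _ _ _ grown) (there e∈) with grown-ends grown e∈
    ... | c∈ , p∈ = there c∈ , there p∈

    grown-attach : ∀ {c p L} → c ~ p → Grown L → Grown (attach c p L)
    grown-attach {c} {p} {L} c~p grown with p ∈? active L | c ∈? active L
    ... | yes p∈ | no c∉ = grow c∉ p∈ c~p grown
    ... | yes _  | yes _ = grown
    ... | no _   | _     = grown

    grown-pass : ∀ {es L} → All (uncurry _~_) es → Grown L → Grown (pass L es)
    grown-pass []         grown = grown
    grown-pass (u~v ∷ es) grown =
      grown-pass es (grown-attach u~v (grown-attach (~-sym u~v) grown))

    -- Spanning, tree edges and the number of edges

    module _ (tree : IsTree G) {es : List (Fin n × Fin n)} (edges : IsEdgeList G es) where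
      open IsTree tree
      open IsEdgeList edges

      grown-passes : ∀ k → Grown (passes k es)
      grown-passes zero    = []
      grown-passes (suc k) = grown-pass sound (grown-passes k)

      Spans : Pairs → Set
      Spans L = ∀ v → v ∈ₗ active L

      -- A walk from the root to a missing vertex crosses an edge out of the active vertices. The
      -- pass makes the far end of that edge active, so it cannot leave `L` unchanged.
      progress : ∀ L → Spans L ⊎ length L < length (pass L es)
      progress L with Fin.any? (λ v → ¬? (v ∈? active L))
      ... | no none = inj₁ λ v → decidable-stable (v ∈? active L) (λ v∉ → none (v , v∉))
      ... | yes (v , v∉)
        with walk-enters (λ x → ¬? (x ∈? active L)) (connected r v) (λ r∉ → r∉ (r∈active L)) v∉
      ...   | x , y , x~y , ¬x∉ , y∉ = inj₂ (strict (grows (pass-⊑ L es)))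
        where
        x∈ : x ∈ₗ active L
        x∈ = decidable-stable (x ∈? active L) ¬x∉
        strict : pass L es ≡ L ⊎ length L < length (pass L es) → length L < length (pass L es)
        strict (inj₂ lt) = lt
        strict (inj₁ eq) =
          contradiction (subst (λ L → y ∈ₗ active L) eq (pass-reaches es L x∈ (complete x~y))) y∉

      passes-progress : ∀ k → Spans (passes k es) ⊎ k ≤ length (passes k es)
      passes-progress zero = inj₂ z≤n
      passes-progress (suc k) with passes-progress k | progress (passes k es)
      ... | inj₁ spans | _          = inj₁ λ v → keeps (pass-⊑ (passes k es) es) (spans v)
      ... | _          | inj₁ spans = inj₁ λ v → keeps (pass-⊑ (passes k es) es) (spans v)
      ... | inj₂ k≤    | inj₂ lt    = inj₂ (ℕ.≤-trans (s≤s k≤) lt)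

      -- If none of the n passes were idle, n pairs would have been added, but a grown list has
      -- fewer than n because the root is active without a pair.
      passes-span : Spans (passes n es)
      passes-span with passes-progress n
      ... | inj₁ spans = spans
      ... | inj₂ n≤    = contradiction (grown-length (grown-passes n)) (ℕ.≤⇒≯ n≤)

      Among : Pairs → Fin n → Fin n → Set
      Among L u v = (u , v) ∈ₗ L ⊎ (v , u) ∈ₗ L

      Inner : Pairs → Fin n → Fin n → Set
      Inner L a b = a ∈ₗ active L × b ∈ₗ active L × a ~ b

      grown-connected : ∀ {L} → Grown L → ∀ {v} → v ∈ₗ active L → Star (Inner L) r v
      grown-connected [] (here refl) = ε
      grown-connected (grow c∉ p∈ c~p grown) (here refl) =
        Star.map (λ (a∈ , b∈ , a~b) → there a∈ , there b∈ , a~b) (grown-connected grown p∈)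
          ◅◅ (there p∈ , here refl , ~-sym c~p) ◅ ε
      grown-connected (grow c∉ p∈ c~p grown) (there v∈) =
        Star.map (λ (a∈ , b∈ , a~b) → there a∈ , there b∈ , a~b) (grown-connected grown v∈)

      -- The active vertices are connected through the root, so two different neighbours of the
      -- outside vertex `c` among them would close a cycle through `c`.
      no-chord : ∀ {L c p w} → Grown L → c ∉ₗ active L → p ∈ₗ active L → w ∈ₗ active L →
        c ~ p → c ~ w → p ≡ w
      no-chord {L} {c} {p} {w} grown c∉ p∈ w∈ c~p c~w with p Fin.≟ w
      ... | yes p≡w = p≡w
      ... | no p≢w  = contradiction
        (path⇒cycle G c∉ c~p c~w p≢w (proj₂ (walk⇒path G p∈
          (Star.reverse (λ (a∈ , b∈ , a~b) → b∈ , a∈ , ~-sym a~b) (grown-connected grown p∈)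
            ◅◅ grown-connected grown w∈))))
        acyclic

      -- Induction along the growth: an edge between the newest vertex and an older one can only
      -- lead to its parent, by `no-chord`.
      edges-among : ∀ {L u v} → Grown L → u ∈ₗ active L → v ∈ₗ active L → u ~ v → Among L u v
      edges-among [] (here refl) (here refl) u~u = contradiction u~u ~-irr
      edges-among (grow _ _ _ _) (here refl) (here refl) u~u = contradiction u~u ~-irr
      edges-among (grow c∉ p∈ c~p grown) (here refl) (there v∈) c~v
        with refl ← no-chord grown c∉ p∈ v∈ c~p c~v = inj₁ (here refl)
      edges-among (grow c∉ p∈ c~p grown) (there u∈) (here refl) u~c
        with refl ← no-chord grown c∉ p∈ u∈ c~p (~-sym u~c) = inj₂ (here refl)
      edges-among (grow c∉ p∈ c~p grown) (there u∈) (there v∈) u~v with edges-among grown u∈ v∈ u~v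
      ... | inj₁ e∈ = inj₁ (there e∈)
      ... | inj₂ e∈ = inj₂ (there e∈)

      tree-edges : ∀ {u v} → u ~ v → Among (passes n es) u v
      tree-edges = edges-among (grown-passes n) (passes-span _) (passes-span _)

      grown-parent : ∀ {L c p q} → Grown L → (c , p) ∈ₗ L → (c , q) ∈ₗ L → p ≡ q
      grown-parent (grow _ _ _ _)      (here refl) (here refl) = refl
      grown-parent (grow c∉ _ _ grown) (here refl) (there e∈)  =
        contradiction (proj₁ (grown-ends grown e∈)) c∉
      grown-parent (grow c∉ _ _ grown) (there e∈)  (here refl) =
        contradiction (proj₁ (grown-ends grown e∈)) c∉
      grown-parent (grow _ _ _ grown)  (there e∈)  (there e∈′) = grown-parent grown e∈ e∈′

      -- Distinct edges have distinct lower ends, so there are at most n of them.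
      lower-ends : ∀ {L} → Grown L → ∀ {es′} → All (uncurry (Among L)) es′ →
        AllPairs (λ e f → e ≢ f × e ≢ swap f) es′ →
        ∃[ cs ] length cs ≡ length es′ × Unique cs ×
          (∀ {c} → c ∈ₗ cs → ∃[ p ] ((c , p) ∈ₗ L × ((c , p) ∈ₗ es′ ⊎ (p , c) ∈ₗ es′)))
      lower-ends grown [] [] = [] , refl , [] , λ ()
      lower-ends {L} grown {(u , v) ∷ es′} (among ∷ amongs) (≢es ∷ distinct)
        with lower-ends grown amongs distinct
      ... | cs , len , uniq , low = include among
        where
        later : ∀ {c} → c ∈ₗ cs → ∃[ p ] ((c , p) ∈ₗ L × ((c , p) ∈ₗ (u , v) ∷ es′ ⊎ (p , c) ∈ₗ (u , v) ∷ es′))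
        later c∈ with low c∈
        ... | p , e∈ , inj₁ in-es = p , e∈ , inj₁ (there in-es)
        ... | p , e∈ , inj₂ in-es = p , e∈ , inj₂ (there in-es)
        include : Among L u v → ∃[ cs ] length cs ≡ suc (length es′) × Unique cs ×
          (∀ {c} → c ∈ₗ cs → ∃[ p ] ((c , p) ∈ₗ L × ((c , p) ∈ₗ (u , v) ∷ es′ ⊎ (p , c) ∈ₗ (u , v) ∷ es′)))
        include (inj₁ uv∈) = u ∷ cs , cong suc len , All.¬Any⇒All¬ _ u∉ ∷ uniq , low′
          where
          u∉ : u ∉ₗ cs
          u∉ u∈ with low u∈
          -- A repeated lower end has the same parent, so it would come from the same edge in one of
          -- its two orientations, and `distinct` excludes both.
          ... | p , up∈ , in-es with grown-parent grown uv∈ up∈ | in-es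
          ...   | refl | inj₁ e∈ = proj₁ (All.lookup ≢es e∈) refl
          ...   | refl | inj₂ e∈ = proj₂ (All.lookup ≢es e∈) refl
          low′ : ∀ {c} → c ∈ₗ u ∷ cs → _
          low′ (here refl) = v , uv∈ , inj₁ (here refl)
          low′ (there c∈)  = later c∈
        include (inj₂ vu∈) = v ∷ cs , cong suc len , All.¬Any⇒All¬ _ v∉ ∷ uniq , low′
          where
          v∉ : v ∉ₗ cs
          v∉ v∈ with low v∈
          ... | p , vp∈ , in-es with grown-parent grown vu∈ vp∈ | in-es
          ...   | refl | inj₁ e∈ = proj₂ (All.lookup ≢es e∈) refl
          ...   | refl | inj₂ e∈ = proj₁ (All.lookup ≢es e∈) refl
          low′ : ∀ {c} → c ∈ₗ v ∷ cs → _
          low′ (here refl) = u , vu∈ , inj₂ (here refl)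
          low′ (there c∈)  = later c∈

      few-edges : length es ≤ n
      few-edges with lower-ends (grown-passes n) (All.map (λ {e} → tree-edges) sound) distinct
      ... | cs , len , uniq , _ = subst (_≤ n) len (unique⇒length≤ uniq)

    -- Contracting the tree from its leaves.  comp v is the part of the tree that has been
    -- merged into v, and L lists the tree edges still to be contracted, the next one first.
    record Stage (L : Pairs) (comp : Fin n → Subset n) : Set where
      field
        self     : ∀ v → v ∈ comp v
        disjoint : ∀ {u v x} → u ∈ₗ active L → v ∈ₗ active L → x ∈ comp u → x ∈ comp v → u ≡ v
        closed   : ∀ {v a b} → v ∈ₗ active L → a ∈ comp v → a ~ b →
                   b ∈ comp v ⊎ (a , b) ∈ₗ L ⊎ (b , a) ∈ₗ L
        -- Either the topmost vertex `t` of S is known, which persists because parts never shrink,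
        -- or S is still open: it meets an active part only if it contains the vertex of that part.
        topped   : ∀ {S} → InducesConnected G S →
                   (∃[ t ] t ∈ S × S ⊆ comp t) ⊎
                   (∀ {v x} → v ∈ₗ active L → v ∉ S → x ∈ S → x ∉ comp v)

    stage-initial : ∀ {L} → (∀ {u v} → u ~ v → (u , v) ∈ₗ L ⊎ (v , u) ∈ₗ L) → Stage L ⁅_⁆
    stage-initial edges = record
      { self     = Sub.x∈⁅x⁆
      ; disjoint = λ _ _ x∈ x∈′ → trans (sym (Sub.x∈⁅y⁆⇒x≡y _ x∈)) (Sub.x∈⁅y⁆⇒x≡y _ x∈′)
      ; closed   = λ _ _ a~b → inj₂ (edges a~b)
      ; topped   = λ {S} _ → inj₂ λ _ v∉S x∈S x∈v →
                     v∉S (subst (_∈ S) (Sub.x∈⁅y⁆⇒x≡y _ x∈v) x∈S)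
      }

    -- The part of the child is left as it is: its table remains a candidate for the solutions whose
    -- topmost vertex is `c`.
    merge : Fin n → Fin n → (Fin n → Subset n) → Fin n → Subset n
    merge c p comp v = if does (v Fin.≟ p) then comp p ∪ comp c else comp v

    merge-same : ∀ c p comp → merge c p comp p ≡ comp p ∪ comp c
    merge-same c p comp with p Fin.≟ p
    ... | yes _  = refl
    ... | no p≢p = contradiction refl p≢p

    merge-other : ∀ c p comp {v} → v ≢ p → merge c p comp v ≡ comp v
    merge-other c p comp {v} v≢p with v Fin.≟ p
    ... | yes v≡p = contradiction v≡p v≢p
    ... | no _    = refl

    module _ {c p L comp} (grown : Grown ((c , p) ∷ L)) (stage : Stage ((c , p) ∷ L) comp) where
      open Stage stage

      private
        c∉ : c ∉ₗ active L
        c∉ = proj₁ (grown-head grown)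

        p∈ : p ∈ₗ active L
        p∈ = proj₁ (proj₂ (grown-head grown))

        grown′ : Grown L
        grown′ = proj₂ (proj₂ (proj₂ (grown-head grown)))

        c≢p : c ≢ p
        c≢p refl = c∉ p∈

        -- Both ends of an uncontracted edge are active and lie in their own parts. As active parts
        -- are disjoint, an end lying in the part of `v` is `v`; thus `v` is the only exit of its
        -- part.
        end≡ : ∀ {v a b} → v ∈ₗ active ((c , p) ∷ L) → a ∈ comp v →
          (a , b) ∈ₗ (c , p) ∷ L ⊎ (b , a) ∈ₗ (c , p) ∷ L → a ≡ v
        end≡ v∈ a∈ (inj₁ e∈) = disjoint (proj₁ (grown-ends grown e∈)) v∈ (self _) a∈
        end≡ v∈ a∈ (inj₂ e∈) = disjoint (proj₂ (grown-ends grown e∈)) v∈ (self _) a∈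

        leaves : ∀ {v a b} → v ∈ₗ active ((c , p) ∷ L) → a ∈ comp v → a ~ b → b ∉ comp v → a ≡ v
        leaves v∈ a∈ a~b b∉ with closed v∈ a∈ a~b
        ... | inj₁ b∈ = contradiction b∈ b∉
        ... | inj₂ e∈ = end≡ v∈ a∈ e∈

      comps-disjoint : Disjoint (comp p) (comp c)
      comps-disjoint x∈p x∈c = c≢p (disjoint (here refl) (there p∈) x∈c x∈p)

      merge-⊇ : ∀ v → comp v ⊆ merge c p comp v
      merge-⊇ v {x} x∈ with v Fin.≟ p
      ... | yes refl = Sub.x∈p∪q⁺ (inj₁ x∈)
      ... | no _     = x∈

      stage-merge : Stage L (merge c p comp)
      stage-merge = record
        { self     = λ v → merge-⊇ v (self v)
        ; disjoint = disjoint′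
        ; closed   = closed′
        ; topped   = topped′
        }
        where
        member : ∀ {v x} → x ∈ merge c p comp v → x ∈ comp v ⊎ (v ≡ p × x ∈ comp c)
        member {v} x∈ with v Fin.≟ p
        ... | no _ = inj₁ x∈
        ... | yes refl with Sub.x∈p∪q⁻ (comp p) (comp c) x∈
        ...   | inj₁ x∈p = inj₁ x∈p
        ...   | inj₂ x∈c = inj₂ (refl , x∈c)
        c-merged : ∀ {x} → x ∈ comp c → x ∈ merge c p comp p
        c-merged x∈ = subst (_ ∈_) (sym (merge-same c p comp)) (Sub.x∈p∪q⁺ (inj₂ x∈))
        away : ∀ {v x} → v ∈ₗ active L → x ∈ comp c → x ∉ comp v
        away v∈ x∈c x∈v = c∉ (subst (_∈ₗ active L) (disjoint (there v∈) (here refl) x∈v x∈c) v∈)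
        disjoint′ : ∀ {u v x} → u ∈ₗ active L → v ∈ₗ active L →
          x ∈ merge c p comp u → x ∈ merge c p comp v → u ≡ v
        disjoint′ u∈ v∈ x∈u x∈v with member x∈u | member x∈v
        ... | inj₁ x∈u′        | inj₁ x∈v′        = disjoint (there u∈) (there v∈) x∈u′ x∈v′
        ... | inj₁ x∈u′        | inj₂ (_ , x∈c)   = contradiction x∈u′ (away u∈ x∈c)
        ... | inj₂ (_ , x∈c)   | inj₁ x∈v′        = contradiction x∈v′ (away v∈ x∈c)
        ... | inj₂ (refl , _)  | inj₂ (refl , _)  = refl
        narrow : ∀ {v a b} → v ∈ₗ active L → a ∈ comp v ⊎ (v ≡ p × a ∈ comp c) →
          (a , b) ∈ₗ (c , p) ∷ L ⊎ (b , a) ∈ₗ (c , p) ∷ L →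
          b ∈ merge c p comp v ⊎ (a , b) ∈ₗ L ⊎ (b , a) ∈ₗ L
        narrow _  _ (inj₁ (there e∈)) = inj₂ (inj₁ e∈)
        narrow _  _ (inj₂ (there e∈)) = inj₂ (inj₂ e∈)
        narrow v∈ (inj₁ a∈) (inj₁ (here refl)) = contradiction a∈ (away v∈ (self c))
        narrow v∈ (inj₁ a∈) (inj₂ (here refl))
          with refl ← disjoint (there p∈) (there v∈) (self p) a∈ = inj₁ (c-merged (self c))
        narrow v∈ (inj₂ (refl , a∈)) (inj₁ (here refl)) = inj₁ (merge-⊇ p (self p))
        narrow v∈ (inj₂ (refl , a∈)) (inj₂ (here refl)) = inj₁ (c-merged (self c))
        closed′ : ∀ {v a b} → v ∈ₗ active L → a ∈ merge c p comp v → a ~ b →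
          b ∈ merge c p comp v ⊎ (a , b) ∈ₗ L ⊎ (b , a) ∈ₗ L
        closed′ {v} v∈ a∈ a~b with member {v} a∈
        ... | inj₁ a∈v with closed (there v∈) a∈v a~b
        ...   | inj₁ b∈ = inj₁ (merge-⊇ v b∈)
        ...   | inj₂ e∈ = narrow v∈ (inj₁ a∈v) e∈
        closed′ {v} v∈ a∈ a~b | inj₂ (refl , a∈c) with closed (here refl) a∈c a~b
        ...   | inj₁ b∈ = inj₁ (c-merged b∈)
        ...   | inj₂ e∈ = narrow v∈ (inj₂ (refl , a∈c)) e∈
        -- A walk that leaves comp c goes through p.
        trapped : ∀ {S} → InducesConnected G S → c ∈ S → p ∉ S → S ⊆ comp c
        trapped {S} conn c∈S p∉S {x} x∈S with x Sub.∈? comp c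
        ... | yes x∈c = x∈c
        ... | no x∉c with walk-enters (λ y → ¬? (y Sub.∈? comp c)) (conn c∈S x∈S) (λ ¬c → ¬c (self c)) x∉c
        ...   | a , b , (a∈S , b∈S , a~b) , ¬a∉ , b∉ = ⊥-elim (go (closed (here refl) a∈c a~b))
          where
          a∈c : a ∈ comp c
          a∈c = decidable-stable (a Sub.∈? comp c) ¬a∉
          a≡c : a ≡ c
          a≡c = leaves (here refl) a∈c a~b b∉
          -- The edge cannot be the one being contracted, since either orientation would put `p`
          -- into S, nor a later one, since `a ≡ c` is no longer active in `L`.
          go : ¬ (b ∈ comp c ⊎ (a , b) ∈ₗ (c , p) ∷ L ⊎ (b , a) ∈ₗ (c , p) ∷ L)
          go (inj₁ b∈)                 = b∉ b∈
          go (inj₂ (inj₁ (here refl))) = p∉S b∈S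
          go (inj₂ (inj₂ (here refl))) = p∉S a∈S
          go (inj₂ (inj₁ (there e∈)))  = c∉ (subst (_∈ₗ active L) a≡c (proj₁ (grown-ends grown′ e∈)))
          go (inj₂ (inj₂ (there e∈)))  = c∉ (subst (_∈ₗ active L) a≡c (proj₂ (grown-ends grown′ e∈)))
        topped′ : ∀ {S} → InducesConnected G S →
          (∃[ t ] t ∈ S × S ⊆ merge c p comp t) ⊎
          (∀ {v x} → v ∈ₗ active L → v ∉ S → x ∈ S → x ∉ merge c p comp v)
        topped′ {S} conn with topped conn
        ... | inj₁ (t , t∈S , S⊆t) = inj₁ (t , t∈S , λ {x} x∈ → merge-⊇ t (S⊆t x∈))
        ... | inj₂ none with c Sub.∈? S | p Sub.∈? S
        -- This is the only case that settles S. In the others, S contains `p`, or it avoids `c` and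
        -- hence the whole part of `c`.
        ...   | yes c∈S | no p∉S = inj₁ (c , c∈S , λ {x} x∈ → merge-⊇ c (trapped conn c∈S p∉S x∈))
        ...   | _       | yes p∈S = inj₂ missing
          where
          missing : ∀ {v x} → v ∈ₗ active L → v ∉ S → x ∈ S → x ∉ merge c p comp v
          missing {v} v∈ v∉S x∈S x∈v with member {v} x∈v
          ... | inj₁ x∈v′       = none (there v∈) v∉S x∈S x∈v′
          ... | inj₂ (refl , _) = v∉S p∈S
        ...   | no c∉S  | no p∉S = inj₂ missing
          where
          missing : ∀ {v x} → v ∈ₗ active L → v ∉ S → x ∈ S → x ∉ merge c p comp v
          missing {v} v∈ v∉S x∈S x∈v with member {v} x∈v
          ... | inj₁ x∈v′       = none (there v∈) v∉S x∈S x∈v′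
          ... | inj₂ (_ , x∈c) = none (here refl) c∉S x∈S x∈c

      module _ {S} (conn : InducesConnected G S) (S⊆ : S ⊆ comp p ∪ comp c) (p∈S : p ∈ S) where

        parent-part : InducesConnected G (S ∩ comp p)
        parent-part = shortcut G S (comp p) p p∈S (self p)
          (λ (_ , _ , a~b) a∈ b∉ → leaves (there p∈) a∈ a~b b∉) conn

        -- A walk in S from `p` to `x` must enter the part of the child, and the entering edge ends
        -- at `c`, the only exit of that part.
        child-part : ∀ {x} → x ∈ S → x ∈ comp c → c ∈ S × InducesConnected G (S ∩ comp c)
        child-part {x} x∈S x∈c
          with walk-enters (λ y → y Sub.∈? comp c) (conn p∈S x∈S) (comps-disjoint (self p)) x∈c
        ... | a , b , (a∈S , b∈S , a~b) , a∉ , b∈c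
          with refl ← leaves (here refl) b∈c (~-sym a~b) a∉ =
          b∈S , shortcut G S (comp c) c b∈S (self c)
            (λ (_ , _ , a~b) a∈ b∉ → leaves (here refl) a∈ a~b b∉) conn

    -- With no edge left to contract, the part of the root is closed under adjacency and so contains
    -- every vertex. A set that is still open meets it and must therefore contain the root.
    stage-final : Connected G → ∀ {comp} → Stage [] comp → ∀ {S x} → x ∈ S → InducesConnected G S →
      ∃[ t ] t ∈ S × S ⊆ comp t
    stage-final connected {comp} stage {S} {x} x∈S conn = top (topped conn)
      where
      open Stage stage
      all : ∀ v → v ∈ comp r
      all v with v Sub.∈? comp r
      ... | yes v∈ = v∈
      ... | no v∉
        with walk-enters (λ y → ¬? (y Sub.∈? comp r)) (connected r v) (λ ¬r → ¬r (self r)) v∉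
      ...   | a , b , a~b , ¬a∉ , b∉
        with closed (here refl) (decidable-stable (a Sub.∈? comp r) ¬a∉) a~b
      ...     | inj₁ b∈ = contradiction b∈ b∉
      ...     | inj₂ (inj₁ ())
      ...     | inj₂ (inj₂ ())
      top : (∃[ t ] t ∈ S × S ⊆ comp t) ⊎
            (∀ {v x} → v ∈ₗ r ∷ [] → v ∉ S → x ∈ S → x ∉ comp v) → ∃[ t ] t ∈ S × S ⊆ comp t
      top (inj₁ found) = found
      top (inj₂ none) with r Sub.∈? S
      ... | yes r∈S = r , r∈S , λ {v} _ → all v
      ... | no r∉S  = contradiction (all x) (none (here refl) r∉S x∈S)

    -- Tables.  An entry k of the table of v accounts for the connected sets S with
    -- v ∈ S ⊆ D and k = ∣D∣ + (number of blue vertices) − (number of red vertices).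
    module Tables (χ : Colouring n) where

      is : Colour → Fin n → ℕ
      is c v = indicator (does (χ v ≟ c))

      -- The red count stands on the left so that no truncated subtraction occurs; keys then simply
      -- add up over disjoint parts.
      HasKey : Subset n → Subset n → ℕ → Set
      HasKey D S k = k + wt (is red) S ≡ ∣ D ∣ + wt (is blue) S

      Rooted : Subset n → Fin n → Subset n → Set
      Rooted D v S = v ∈ S × S ⊆ D × InducesConnected G S

      -- The entry 0 means that no set exists, as rooted sets have positive codes. Soundness is
      -- limited to indices up to twice ∣D∣, since the cells beyond may belong to other rows.
      record Table (D : Subset n) (v : Fin n) (t : ℕ → ℕ) : Set where
        field
          sound    : ∀ k → k ≤ ∣ D ∣ + ∣ D ∣ → 0 < t k →
                     ∃[ S ] (Rooted D v S × HasKey D S k × wt code S ≡ t k)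
          complete : ∀ {S k} → Rooted D v S → HasKey D S k → wt code S ≤ t k

      colour≤ : ∀ c S → wt (is c) S ≤ ∣ S ∣
      colour≤ c S = subst (_≤ ∣ S ∣) (wt-colour χ c S) (Sub.∣p∩q∣≤∣p∣ S (colourClass χ c))

      key-bound : ∀ {D S k} → S ⊆ D → HasKey D S k → k ≤ ∣ D ∣ + ∣ D ∣
      key-bound {D} {S} {k} S⊆D key = begin
        k                        ≤⟨ ℕ.m≤m+n k (wt (is red) S) ⟩
        k + wt (is red) S        ≡⟨ key ⟩
        ∣ D ∣ + wt (is blue) S   ≤⟨ ℕ.+-monoʳ-≤ ∣ D ∣ (ℕ.≤-trans (colour≤ blue S) (Sub.p⊆q⇒∣p∣≤∣q∣ S⊆D)) ⟩
        ∣ D ∣ + ∣ D ∣            ∎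
        where open ℕ.≤-Reasoning

      key-exists : ∀ {D S} → S ⊆ D → ∃[ k ] HasKey D S k
      key-exists {D} {S} S⊆D = ∣ D ∣ + wt (is blue) S ∸ wt (is red) S ,
        ℕ.m∸n+n≡m (ℕ.≤-trans (ℕ.≤-trans (colour≤ red S) (Sub.p⊆q⇒∣p∣≤∣q∣ S⊆D)) (ℕ.m≤m+n ∣ D ∣ (wt (is blue) S)))

      key-unique : ∀ {D S k k′} → HasKey D S k → HasKey D S k′ → k ≡ k′
      key-unique key key′ = ℕ.+-cancelʳ-≡ _ _ _ (trans key (sym key′))

      -- The empty set has difference zero, hence index `d`, and code 0. So at that one index the
      -- child entry may be used even when it is 0.
      Admissible : ℕ → (ℕ → ℕ) → ℕ → Set
      Admissible d t k = 0 < t k ⊎ k ≡ d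

      -- t is the max-plus convolution of tp and tc, where tc also offers the empty set.
      record Convolution (dp dc : ℕ) (tp tc t : ℕ → ℕ) : Set where
        field
          from : ∀ k → 0 < t k → ∃[ k₁ ] ∃[ k₂ ] (k₁ ≤ dp + dp × k₂ ≤ dc + dc × 0 < tp k₁ ×
                 Admissible dc tc k₂ × k₁ + k₂ ≡ k × t k ≡ tp k₁ + tc k₂)
          into : ∀ {k₁ k₂} → k₁ ≤ dp + dp → k₂ ≤ dc + dc → 0 < tp k₁ → Admissible dc tc k₂ →
                 tp k₁ + tc k₂ ≤ t (k₁ + k₂)

      table-singleton : ∀ v k₀ t → k₀ + is red v ≡ 1 + is blue v → t k₀ ≡ code v →
        (∀ k → k ≤ 2 → k ≢ k₀ → t k ≡ 0) → Table ⁅ v ⁆ v t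
      table-singleton v k₀ t key₀ t-k₀ t-other = record { sound = sound′ ; complete = complete′ }
        where
        key : HasKey ⁅ v ⁆ ⁅ v ⁆ k₀
        key = trans (cong (k₀ +_) (wt-⁅⁆ (is red) v))
          (trans key₀ (sym (cong₂ _+_ (Sub.∣⁅x⁆∣≡1 v) (wt-⁅⁆ (is blue) v))))
        connected : InducesConnected G ⁅ v ⁆
        connected u∈ w∈ with refl ← Sub.x∈⁅y⁆⇒x≡y v u∈ | refl ← Sub.x∈⁅y⁆⇒x≡y v w∈ = ε
        sound′ : ∀ k → k ≤ ∣ ⁅ v ⁆ ∣ + ∣ ⁅ v ⁆ ∣ → 0 < t k →
          ∃[ S ] (Rooted ⁅ v ⁆ v S × HasKey ⁅ v ⁆ S k × wt code S ≡ t k)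
        sound′ k k≤ 0<t with k ℕ.≟ k₀
        ... | yes refl = ⁅ v ⁆ , (Sub.x∈⁅x⁆ v , (λ x∈ → x∈) , connected) , key ,
                         trans (wt-⁅⁆ code v) (sym t-k₀)
        ... | no k≢ = contradiction 0<t (ℕ.≤⇒≯ (ℕ.≤-reflexive
                        (t-other k (subst (k ≤_) (cong₂ _+_ (Sub.∣⁅x⁆∣≡1 v) (Sub.∣⁅x⁆∣≡1 v)) k≤) k≢)))
        complete′ : ∀ {S k} → Rooted ⁅ v ⁆ v S → HasKey ⁅ v ⁆ S k → wt code S ≤ t k
        complete′ {S} {k} (v∈S , S⊆ , _) key′
          with refl ← Sub.⊆-antisym {i = S} {j = ⁅ v ⁆} S⊆
                 (λ x∈ → subst (_∈ S) (sym (Sub.x∈⁅y⁆⇒x≡y v x∈)) v∈S)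
          with refl ← key-unique {⁅ v ⁆} {⁅ v ⁆} key′ key =
          ℕ.≤-reflexive (trans (wt-⁅⁆ code v) (sym t-k₀))

      table-cong : ∀ {D v t t′} → (∀ k → k ≤ ∣ D ∣ + ∣ D ∣ → t k ≡ t′ k) → Table D v t → Table D v t′
      table-cong {D} {v} {t} {t′} eq table = record
        { sound    = λ k k≤ 0<t′ →
            let S , rooted , key , code≡ = Table.sound table k k≤ (subst (0 <_) (sym (eq k k≤)) 0<t′)
            in S , rooted , key , trans code≡ (eq k k≤)
        ; complete = λ {S} {k} rooted key → subst (wt code S ≤_)
            (eq k (key-bound {D} {S} (proj₁ (proj₂ rooted)) key)) (Table.complete table rooted key)
        }

      key-∪ : ∀ {D E S T k l} → Disjoint D E → S ⊆ D → T ⊆ E → HasKey D S k → HasKey E T l →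
        HasKey (D ∪ E) (S ∪ T) (k + l)
      key-∪ {D} {E} {S} {T} {k} {l} dis S⊆ T⊆ key key′ = begin
        k + l + wt (is red) (S ∪ T)                       ≡⟨ cong (k + l +_) (wt-∪ (is red) S T dis′) ⟩
        k + l + (wt (is red) S + wt (is red) T)           ≡⟨ interchange k l _ _ ⟩
        (k + wt (is red) S) + (l + wt (is red) T)         ≡⟨ cong₂ _+_ key key′ ⟩
        (∣ D ∣ + wt (is blue) S) + (∣ E ∣ + wt (is blue) T) ≡⟨ interchange (∣ D ∣) _ (∣ E ∣) _ ⟩
        (∣ D ∣ + ∣ E ∣) + (wt (is blue) S + wt (is blue) T) ≡⟨ cong₂ _+_ (∣∪∣ D E dis) (wt-∪ (is blue) S T dis′) ⟨
        ∣ D ∪ E ∣ + wt (is blue) (S ∪ T)                  ∎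
        where
        open ≡-Reasoning
        dis′ : Disjoint S T
        dis′ x∈S x∈T = dis (S⊆ x∈S) (T⊆ x∈T)

      module _ {c p L comp} (grown : Grown ((c , p) ∷ L)) (stage : Stage ((c , p) ∷ L) comp)
               {tp tc t : ℕ → ℕ} (table-p : Table (comp p) p tp) (table-c : Table (comp c) c tc)
               (conv : Convolution ∣ comp p ∣ ∣ comp c ∣ tp tc t) where
        open Convolution conv

        private
          dis : Disjoint (comp p) (comp c)
          dis = comps-disjoint grown stage

          dis′ : ∀ {S T} → S ⊆ comp p → T ⊆ comp c → Disjoint S T
          dis′ S⊆ T⊆ x∈S x∈T = dis (S⊆ x∈S) (T⊆ x∈T)

          c~p : c ~ p
          c~p = proj₁ (proj₂ (proj₂ (grown-head grown)))

          -- The possible contributions of the child: a set rooted at `c`, or the empty set, for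
          -- which the condition on `c` is vacuous.
          Child : Subset n → Set
          Child T = T ⊆ comp c × (∀ {x} → x ∈ T → c ∈ T) × InducesConnected G T

          child-sound : ∀ k → k ≤ ∣ comp c ∣ + ∣ comp c ∣ → Admissible ∣ comp c ∣ tc k →
            ∃[ T ] (Child T × HasKey (comp c) T k × wt code T ≡ tc k)
          child-sound k k≤ adm with tc k in eq
          ... | suc x =
            let T , (c∈T , T⊆ , conn) , key , code≡ = Table.sound table-c k k≤ (subst (0 <_) (sym eq) (s≤s z≤n))
            in T , ((λ {x} → T⊆ {x}) , (λ _ → c∈T) , (λ {u} {v} → conn {u} {v})) , key , trans code≡ eq
          child-sound k k≤ (inj₂ refl) | zero =
            ∅ , ((λ x∈ → contradiction x∈ Sub.∉⊥) , (λ x∈ → contradiction x∈ Sub.∉⊥) ,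
                 (λ x∈ → contradiction x∈ Sub.∉⊥)) ,
            cong (∣ comp c ∣ +_) (trans (wt-∅ (is red)) (sym (wt-∅ (is blue)))) , wt-∅ (code {n})

          child-complete : ∀ {T k} → Child T → HasKey (comp c) T k →
            Admissible ∣ comp c ∣ tc k × wt code T ≤ tc k
          child-complete {T} {k} (T⊆ , hits , conn) key with c Sub.∈? T
          ... | yes c∈T =
            let ≤t = Table.complete table-c (c∈T , (λ {x} → T⊆ {x}) , (λ {u} {v} → conn {u} {v})) key
            in inj₁ (ℕ.<-≤-trans (wt-positive code>0 c∈T) ≤t) , ≤t
          ... | no c∉T
            with refl ← Sub.⊆-antisym {i = T} {j = ∅} (λ x∈ → contradiction (hits x∈) c∉T) (Sub.⊆-min T) =
            inj₂ (key-unique {comp c} {∅} key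
              (cong (∣ comp c ∣ +_) (trans (wt-∅ (is red)) (sym (wt-∅ (is blue)))))) ,
            subst (_≤ tc k) (sym (wt-∅ (code {n}))) z≤n

          join-connected : ∀ {S T} → p ∈ S → InducesConnected G S → Child T → InducesConnected G (S ∪ T)
          join-connected {S} {T} p∈S conn (_ , hits , conn′) u∈ v∈ = to u∈ ◅◅ back v∈
            where
            widenˡ : ∀ {u v} → Star (InducedAdj G S) u v → Star (InducedAdj G (S ∪ T)) u v
            widenˡ = Star.map λ (a∈ , b∈ , a~b) → Sub.x∈p∪q⁺ (inj₁ a∈) , Sub.x∈p∪q⁺ (inj₁ b∈) , a~b
            widenʳ : ∀ {u v} → Star (InducedAdj G T) u v → Star (InducedAdj G (S ∪ T)) u v
            widenʳ = Star.map λ (a∈ , b∈ , a~b) → Sub.x∈p∪q⁺ (inj₂ a∈) , Sub.x∈p∪q⁺ (inj₂ b∈) , a~b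
            to : ∀ {u} → u ∈ S ∪ T → Star (InducedAdj G (S ∪ T)) u p
            to u∈ with Sub.x∈p∪q⁻ S T u∈
            ... | inj₁ u∈S = widenˡ (conn u∈S p∈S)
            ... | inj₂ u∈T = widenʳ (conn′ u∈T (hits u∈T)) ◅◅
              (Sub.x∈p∪q⁺ (inj₂ (hits u∈T)) , Sub.x∈p∪q⁺ (inj₁ p∈S) , c~p) ◅ ε
            back : ∀ {u} → u ∈ S ∪ T → Star (InducedAdj G (S ∪ T)) p u
            back u∈ = Star.reverse (λ (a∈ , b∈ , a~b) → b∈ , a∈ , ~-sym a~b) (to u∈)

        table-merge : Table (comp p ∪ comp c) p t
        table-merge = record { sound = sound′ ; complete = complete′ }
          where
          sound′ : ∀ k → k ≤ ∣ comp p ∪ comp c ∣ + ∣ comp p ∪ comp c ∣ → 0 < t k →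
            ∃[ S ] (Rooted (comp p ∪ comp c) p S × HasKey (comp p ∪ comp c) S k × wt code S ≡ t k)
          sound′ k _ 0<t =
            let k₁ , k₂ , k₁≤ , k₂≤ , 0<tp , adm , k≡ , t≡ = from k 0<t
                S , (p∈S , S⊆ , conn) , key₁ , code₁ = Table.sound table-p k₁ k₁≤ 0<tp
                T , child , key₂ , code₂ = child-sound k₂ k₂≤ adm
                T⊆ = proj₁ child
            in S ∪ T ,
               (Sub.x∈p∪q⁺ (inj₁ p∈S) , ∪-mono {S} {T} (λ {x} → S⊆ {x}) (λ {x} → T⊆ {x}) ,
                join-connected {S} {T} p∈S (λ {u} {v} → conn {u} {v}) child) ,
               subst (HasKey (comp p ∪ comp c) (S ∪ T)) k≡
                 (key-∪ {comp p} {comp c} {S} {T} dis (λ {x} → S⊆ {x}) (λ {x} → T⊆ {x}) key₁ key₂) ,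
               trans (wt-∪ code S T (dis′ {S} {T} (λ {x} → S⊆ {x}) (λ {x} → T⊆ {x})))
                 (trans (cong₂ _+_ code₁ code₂) (sym t≡))
            where
            ∪-mono : ∀ {S T} → S ⊆ comp p → T ⊆ comp c → S ∪ T ⊆ comp p ∪ comp c
            ∪-mono {S} {T} S⊆ T⊆ x∈ with Sub.x∈p∪q⁻ S T x∈
            ... | inj₁ x∈S = Sub.x∈p∪q⁺ (inj₁ (S⊆ x∈S))
            ... | inj₂ x∈T = Sub.x∈p∪q⁺ (inj₂ (T⊆ x∈T))
          complete′ : ∀ {S k} → Rooted (comp p ∪ comp c) p S → HasKey (comp p ∪ comp c) S k → wt code S ≤ t k
          complete′ {S} {k} (p∈S , S⊆ , conn) key =
            let k₁ , key₁ = key-exists {comp p} {S₁} S₁⊆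
                k₂ , key₂ = key-exists {comp c} {S₂} S₂⊆
                adm , code₂ = child-complete {S₂} child key₂
                code₁ = Table.complete table-p rooted key₁
                -- The parent part of S contains `p`, so its code is positive and the convolution
                -- does not take the entry for an absent one.
                0<tp = ℕ.<-≤-trans (wt-positive code>0 (proj₁ rooted)) code₁
                k≡ = key-unique {comp p ∪ comp c} {S₁ ∪ S₂}
                       (key-∪ {comp p} {comp c} {S₁} {S₂} dis S₁⊆ S₂⊆ key₁ key₂)
                       (subst (λ S → HasKey (comp p ∪ comp c) S k) S≡ key)
            in begin
              wt code S               ≡⟨ cong (wt code) S≡ ⟩
              wt code (S₁ ∪ S₂)       ≡⟨ wt-∪ code S₁ S₂ (dis′ {S₁} {S₂} S₁⊆ S₂⊆) ⟩
              wt code S₁ + wt code S₂ ≤⟨ ℕ.+-mono-≤ code₁ code₂ ⟩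
              tp k₁ + tc k₂           ≤⟨ into (key-bound {comp p} {S₁} S₁⊆ key₁) (key-bound {comp c} {S₂} S₂⊆ key₂)
                                           0<tp adm ⟩
              t (k₁ + k₂)             ≡⟨ cong t k≡ ⟩
              t k                     ∎
            where
            open ℕ.≤-Reasoning
            S₁ S₂ : Subset n
            S₁ = S ∩ comp p
            S₂ = S ∩ comp c
            S₁⊆ : S₁ ⊆ comp p
            S₁⊆ = Sub.p∩q⊆q S (comp p)
            S₂⊆ : S₂ ⊆ comp c
            S₂⊆ = Sub.p∩q⊆q S (comp c)
            S≡ : S ≡ S₁ ∪ S₂
            S≡ = trans (Sub.⊆-antisym {i = S} (λ x∈ → Sub.x∈p∩q⁺ (x∈ , S⊆ x∈)) (Sub.p∩q⊆p S (comp p ∪ comp c)))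
              (Sub.∩-distribˡ-∪ S (comp p) (comp c))
            rooted : Rooted (comp p) p S₁
            rooted = Sub.x∈p∩q⁺ (p∈S , Stage.self stage p) , (λ {x} → S₁⊆ {x}) ,
              (λ {u} {v} → parent-part grown stage {S} conn S⊆ p∈S {u} {v})
            child : Child S₂
            child = (λ {x} → S₂⊆ {x}) ,
              (λ x∈ → let x∈S , x∈c = Sub.x∈p∩q⁻ S (comp c) x∈ in
                Sub.x∈p∩q⁺ (proj₁ (child-part grown stage {S} conn S⊆ p∈S x∈S x∈c) , Stage.self stage c)) ,
              (λ {u} {v} u∈ v∈ → let u∈S , u∈c = Sub.x∈p∩q⁻ S (comp c) u∈ in
                proj₂ (child-part grown stage {S} conn S⊆ p∈S u∈S u∈c) u∈ v∈)

      -- Balanced sets and the optimum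

      balanced⇒key : ∀ {D S} → Balanced G χ S → HasKey D S ∣ D ∣
      balanced⇒key {D} {S} bal = cong (∣ D ∣ +_)
        (trans (sym (wt-colour χ red S)) (trans (sym bal) (wt-colour χ blue S)))

      key⇒balanced : ∀ {D S} → HasKey D S ∣ D ∣ → Balanced G χ S
      key⇒balanced {D} {S} key = trans (wt-colour χ blue S)
        (trans (sym (ℕ.+-cancelˡ-≡ ∣ D ∣ _ _ key)) (sym (wt-colour χ red S)))

      -- The running maximum starts at 0, the code of the empty set, hence the first alternative of
      -- `attained`.
      record Optimum (comp : Fin n → Subset n) (t : Fin n → ℕ → ℕ) (b : ℕ) : Set where
        field
          attained : b ≡ 0 ⊎ ∃[ v ] b ≡ t v ∣ comp v ∣
          above    : ∀ v → t v ∣ comp v ∣ ≤ b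

      -- A nonempty feasible set lies in the part of its topmost vertex and is balanced, so the
      -- entry at index `∣ comp v ∣` there dominates its code; comparing codes then compares
      -- cardinalities.
      best⇒BCS : Connected G → ∀ {comp t b} → Stage [] comp → (∀ v → Table (comp v) v (t v)) →
        Optimum comp t b → ∃[ S ] (IsBCS G χ S × wt code S ≡ b)
      best⇒BCS connected {comp} {t} {b} stage table best = found (Optimum.attained best) b refl
        where
        upper : ∀ {S} → Feasible G χ S → wt code S ≤ b
        upper {S} (conn , bal) with Sub.nonempty? S
        ... | no empty = subst (_≤ b)
          (sym (trans (cong (wt (code {n})) (Sub.Empty-unique empty)) (wt-∅ (code {n})))) z≤n
        ... | yes (x , x∈S) with stage-final connected stage x∈S conn
        ...   | v , v∈S , S⊆ = ℕ.≤-trans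
          (Table.complete (table v) (v∈S , S⊆ , conn) (balanced⇒key {comp v} {S} bal))
          (Optimum.above best v)
        solution : ∀ {S} → InducesConnected G S → Balanced G χ S → wt code S ≡ b →
          ∃[ S ] (IsBCS G χ S × wt code S ≡ b)
        solution {S} conn bal eq = S , ((conn , bal) , λ S′ feasible →
          wt-code-mono⁻ S′ S (subst (wt code S′ ≤_) (sym eq) (upper feasible))) , eq
        found : b ≡ 0 ⊎ ∃[ v ] b ≡ t v ∣ comp v ∣ → ∀ x → x ≡ b → ∃[ S ] (IsBCS G χ S × wt code S ≡ b)
        found (inj₁ b≡0) _ _ = solution {∅} (λ u∈ → contradiction u∈ Sub.∉⊥)
          (trans (wt-colour χ blue ∅) (trans (wt-∅ (is blue)) (sym (trans (wt-colour χ red ∅) (wt-∅ (is red))))))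
          (trans (wt-∅ (code {n})) (sym b≡0))
        -- A maximum of 0 may be an absent entry, which yields no set from the table; the empty set
        -- is the answer.
        found (inj₂ _) zero 0≡b = found (inj₁ (sym 0≡b)) zero 0≡b
        found (inj₂ (v , b≡)) (suc _) eq =
          let S , (_ , _ , conn) , key , code≡ = Table.sound (table v) ∣ comp v ∣
                (ℕ.m≤m+n ∣ comp v ∣ ∣ comp v ∣) (subst (0 <_) (trans eq b≡) (s≤s z≤n))
          in solution {S} (λ {u} {w} → conn {u} {w}) (key⇒balanced {comp v} {S} key) (trans code≡ (sym b≡))

-- Reasoning about commands

-- A syntactic over-approximation. On a concrete command it evaluates, so frame conditions are
-- discharged by `refl`.
writes : Cmd → Class → Bool
writes (b ‹ _ ›≔ _)        a = does (b Fin.≟ a)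
writes (read b _)          a = does (b Fin.≟ a)
writes (print _)           a = false
writes (C ⨾ D)             a = writes C a ∨ writes D a
writes (when _ then C)     a = writes C a
writes (repeat _ times C)  a = writes C a

iter-preserves : ∀ {A B : Set} (f : A → A) (g : A → B) → (∀ x → g (f x) ≡ g x) →
  ∀ k x → g (iter k f x) ≡ g x
iter-preserves f g pres zero    x = refl
iter-preserves f g pres (suc k) x = trans (iter-preserves f g pres k (f x)) (pres x)

frame : ∀ C a → writes C a ≡ false → ∀ σ → mem (run C σ) a ≡ mem σ a
frame (b ‹ _ ›≔ _) a eq σ rewrite eq = refl
frame (read b _)   a eq σ rewrite eq = refl
frame (print _)    a eq σ = refl
frame (C ⨾ D)      a eq σ with writes C a in eqC
... | false = trans (frame D a eq (run C σ)) (frame C a eqC σ)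
frame (when e then C) a eq σ with ⟦ e ⟧ (mem σ)
... | zero  = refl
... | suc _ = frame C a eq σ
frame (repeat e times C) a eq σ =
  iter-preserves (run C) (λ σ → mem σ a) (frame C a eq) (⟦ e ⟧ (mem σ)) σ

frame-at : ∀ C a → writes C a ≡ false → ∀ σ i → mem (run C σ) a i ≡ mem σ a i
frame-at C a eq σ i = cong (λ m → m i) (frame C a eq σ)

prints : Cmd → Bool
prints (print _)          = true
prints (C ⨾ D)            = prints C ∨ prints D
prints (when _ then C)    = prints C
prints (repeat _ times C) = prints C
prints _                  = false

frame-out : ∀ C → prints C ≡ false → ∀ σ → out (run C σ) ≡ out σ
frame-out (_ ‹ _ ›≔ _) eq σ = refl
frame-out (read _ _)   eq σ = refl
frame-out (C ⨾ D)      eq σ with prints C in eqC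
... | false = trans (frame-out D eq (run C σ)) (frame-out C eqC σ)
frame-out (when e then C) eq σ with ⟦ e ⟧ (mem σ)
... | zero  = refl
... | suc _ = frame-out C eq σ
frame-out (repeat e times C) eq σ =
  iter-preserves (run C) out (frame-out C eq) (⟦ e ⟧ (mem σ)) σ

loopFree : Cmd → Bool
loopFree (C ⨾ D)            = loopFree C ∧ loopFree D
loopFree (when _ then C)    = loopFree C
loopFree (repeat _ times _) = false
loopFree _                  = true

-- Meaningful for loop-free commands only.
maxCost : Cmd → ℕ
maxCost (_ ‹ e ›≔ e′)      = costᴱ e + 7 + (costᴱ e′ + 1)
maxCost (read _ e)         = costᴱ e + 7 + 2
maxCost (print e)          = costᴱ e + 1
maxCost (C ⨾ D)            = maxCost C + maxCost D
maxCost (when e then C)    = costᴱ e + (3 + maxCost C)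
maxCost (repeat _ times _) = 0

pick-≤ : ∀ x m → pick x 0 m ≤ m
pick-≤ zero    m = z≤n
pick-≤ (suc _) m = ℕ.≤-refl

cost≤ : ∀ C → loopFree C ≡ true → ∀ σ → cost C σ ≤ maxCost C
cost≤ (_ ‹ _ ›≔ _) eq σ = ℕ.≤-refl
cost≤ (read _ _)   eq σ = ℕ.≤-refl
cost≤ (print _)    eq σ = ℕ.≤-refl
cost≤ (C ⨾ D)      eq σ with loopFree C in eqC
... | true = ℕ.+-mono-≤ (cost≤ C eqC σ) (cost≤ D eq (run C σ))
cost≤ (when e then C) eq σ = ℕ.+-monoʳ-≤ (costᴱ e) (ℕ.+-monoʳ-≤ 3
  (ℕ.≤-trans (pick-≤ (⟦ e ⟧ (mem σ)) (cost C σ)) (cost≤ C eq σ)))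

module Loop (C : Cmd) (P : ℕ → State → Set) (b : ℕ) where

  -- While `iter` counts the remaining iterations down, the invariant counts the completed ones up;
  -- `go` carries both numbers, with sum at most `k`.
  loop-rule : ∀ k → (∀ i σ → i < k → P i σ → P (suc i) (run C σ) × cost C σ ≤ b) → ∀ {σ} → P 0 σ →
    P k (iter k (run C) σ) × iterCost k (run C) (cost C) σ ≤ k * (b + 3)
  loop-rule k body {σ} p =
    subst (λ m → P m (iter k (run C) σ) × iterCost k (run C) (cost C) σ ≤ k * (b + 3))
      (ℕ.+-identityʳ k) (go k 0 (ℕ.≤-reflexive (ℕ.+-identityʳ k)) p)
    where
    go : ∀ j i {σ} → j + i ≤ k → P i σ →
      P (j + i) (iter j (run C) σ) × iterCost j (run C) (cost C) σ ≤ j * (b + 3)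
    go zero    i _  p = p , z≤n
    go (suc j) i {σ} le p
      with body i σ (ℕ.≤-trans (s≤s (ℕ.m≤n+m i j)) le) p
    ... | p₁ , c₁ with go j (suc i) (subst (_≤ k) (sym (ℕ.+-suc j i)) le) p₁
    ...   | p₂ , c₂ = subst (λ m → P m (iter j (run C) (run C σ))) (ℕ.+-suc j i) p₂ ,
      subst (_≤ suc j * (b + 3)) (ℕ.+-assoc (cost C σ) 3 _)
        (ℕ.+-mono-≤ (ℕ.+-monoˡ-≤ 3 c₁) c₂)

record Ensures (C : Cmd) (σ : State) (Q : State → Set) (b : ℕ) : Set where
  constructor ensures
  field
    holds   : Q (run C σ)
    bounded : cost C σ ≤ b

open Ensures

ensures-seq : ∀ C D {σ Q R b b′} → Ensures C σ Q b → (Q (run C σ) → Ensures D (run C σ) R b′) →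
  Ensures (C ⨾ D) σ R (b + b′)
ensures-seq C D {σ} (ensures q c) f = ensures (holds (f q)) (ℕ.+-mono-≤ c (bounded (f q)))

ensures-free : ∀ C {σ Q} → loopFree C ≡ true → Q (run C σ) → Ensures C σ Q (maxCost C)
ensures-free C {σ} free q = ensures q (cost≤ C free σ)

ensures-repeat : ∀ e C {σ Q b} k → ⟦ e ⟧ (mem σ) ≡ k →
  Q (iter k (run C) σ) × iterCost k (run C) (cost C) σ ≤ b →
  Ensures (repeat e times C) σ Q (costᴱ e + (5 + b))
ensures-repeat e C _ refl (q , c) = ensures q (ℕ.+-monoʳ-≤ (costᴱ e) (ℕ.+-monoʳ-≤ 5 c))

ensures-weaken : ∀ {C σ Q b b′} → b ≤ b′ → Ensures C σ Q b → Ensures C σ Q b′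
ensures-weaken le (ensures q c) = ensures q (ℕ.≤-trans c le)

ensures-map : ∀ {C σ Q R b} → (Q (run C σ) → R (run C σ)) → Ensures C σ Q b → Ensures C σ R b
ensures-map f (ensures q c) = ensures (f q) c

ensures-when : ∀ e C {σ Q b} → (⟦ e ⟧ (mem σ) ≡ 0 → Q σ) → (0 < ⟦ e ⟧ (mem σ) → Ensures C σ Q b) →
  Ensures (when e then C) σ Q (costᴱ e + (3 + b))
ensures-when e C {σ} {Q} {b} skip go = ensures (proj₁ (branch (⟦ e ⟧ (mem σ)) refl))
  (ℕ.+-monoʳ-≤ (costᴱ e) (ℕ.+-monoʳ-≤ 3 (proj₂ (branch (⟦ e ⟧ (mem σ)) refl))))
  where
  branch : ∀ x → ⟦ e ⟧ (mem σ) ≡ x → Q (pick x σ (run C σ)) × pick x 0 (cost C σ) ≤ b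
  branch zero    eq = skip eq , z≤n
  branch (suc x) eq = let ensures q c = go (subst (0 <_) (sym eq) (s≤s z≤n)) in q , c

ensures-first : ∀ C D {σ R b} → loopFree C ≡ true → Ensures D (run C σ) R b →
  Ensures (C ⨾ D) σ R (maxCost C + b)
ensures-first C D {σ} free (ensures r c) = ensures r (ℕ.+-mono-≤ (cost≤ C free σ) c)

-- The algorithm

N M I K Count Free Best B K₁ K₂ C P RowP RowC SizeP SizeC : Class
N     = class 0
M     = class 1
I     = class 2
K     = class 3
Count = class 6
Free  = class 7
Best  = class 8
B     = class 9
K₁    = class 10
K₂    = class 11
C     = class 12
P     = class 13
RowP  = class 14
RowC  = class 15
SizeP = class 16
SizeC = class 17

Col EdgeU EdgeV Pow Visited Child Parent Size Row Cell : Class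
Col     = class 18
EdgeU   = class 19
EdgeV   = class 20
Pow     = class 21
Visited = class 22
Child   = class 23
Parent  = class 24
Size    = class 25
Row     = class 26
Cell    = class 27

infix 9 $_
infix 4 _≔_

$_ : Class → Exp
$ a = a ‹ # 0 ›

_≔_ : Class → Exp → Cmd
a ≔ e = a ‹ # 0 ›≔ e

increment : Class → Cmd
increment a = a ≔ $ a ⊕ # 1

readColour readEdge readColours readEdges : Cmd
readColour  = read Col ($ I) ⨾ increment I
readEdge    = read EdgeU ($ I) ⨾ read EdgeV ($ I) ⨾ increment I
readColours = read N (# 0) ⨾ I ≔ # 0 ⨾ repeat $ N times readColour
readEdges   = read M (# 0) ⨾ I ≔ # 0 ⨾ repeat $ M times readEdge

nextPower powers : Cmd
nextPower = Pow ‹ $ I ⊕ # 1 ›≔ Pow ‹ $ I › ⊕ Pow ‹ $ I › ⨾ increment I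
powers    = Pow ‹ # 0 ›≔ # 1 ⨾ I ≔ # 0 ⨾ repeat $ N times nextPower

addChild attachChild growEdge growPass growTree : Cmd
addChild =
  Visited ‹ $ C ›≔ # 1 ⨾ Child ‹ $ Count ›≔ $ C ⨾ Parent ‹ $ Count ›≔ $ P ⨾ increment Count
-- For flags 0 and 1, the truncated difference is positive exactly when `P` is in the tree and `C`
-- is not.
attachChild = when Visited ‹ $ P › ⊖ Visited ‹ $ C › then addChild
growEdge =
  C ≔ EdgeV ‹ $ K › ⨾ P ≔ EdgeU ‹ $ K › ⨾ attachChild ⨾
  C ≔ EdgeU ‹ $ K › ⨾ P ≔ EdgeV ‹ $ K › ⨾ attachChild ⨾ increment K
growPass = K ≔ # 0 ⨾ repeat $ M times growEdge
growTree = Visited ‹ # 0 ›≔ # 1 ⨾ repeat $ N times growPass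

-- Rows of Cell are allocated from Free upwards and never reused, so a new row is blank.
initVertex initTables : Cmd
initVertex =
  Size ‹ $ I ›≔ # 1 ⨾ Row ‹ $ I ›≔ $ Free ⨾
  -- The index is 1 + blue - red for a single vertex: 2 for blue, whose colour code is 0, and 0 for
  -- red. Indices 0 to 2 make a row of three cells.
  Cell ‹ $ Free ⊕ ((# 1 ⊖ Col ‹ $ I ›) ⊕ (# 1 ⊖ Col ‹ $ I ›)) ›≔
    Pow ‹ $ N › ⊕ Pow ‹ $ N ⊖ ($ I ⊕ # 1) › ⨾
  Free ≔ $ Free ⊕ # 3 ⨾ increment I
initTables = I ≔ # 0 ⨾ repeat $ N times initVertex

-- One of the two truncated differences is zero, so their sum is the distance of the two numbers.
equal : Class → Class → Exp
equal a b = # 1 ⊖ (($ a ⊖ $ b) ⊕ ($ b ⊖ $ a))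

target sumP+C : Exp
target = Cell ‹ $ Free ⊕ ($ K₁ ⊕ $ K₂) ›
sumP+C = Cell ‹ $ RowP ⊕ $ K₁ › ⊕ Cell ‹ $ RowC ⊕ $ K₂ ›

-- x ⊕ (y ⊖ x) is the maximum of x and y.
relax relaxStep convolveRow convolveStep convolve : Cmd
relax = Cell ‹ $ Free ⊕ ($ K₁ ⊕ $ K₂) ›≔ target ⊕ (sumP+C ⊖ target)
-- The sum acts as a disjunction: the child entry is present, or the index is that of the empty set.
relaxStep = (when Cell ‹ $ RowC ⊕ $ K₂ › ⊕ equal K₂ SizeC then relax) ⨾ increment K₂
convolveRow = K₂ ≔ # 0 ⨾ repeat # 1 ⊕ ($ SizeC ⊕ $ SizeC) times relaxStep
convolveStep = (when Cell ‹ $ RowP ⊕ $ K₁ › then convolveRow) ⨾ increment K₁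
convolve = K₁ ≔ # 0 ⨾ repeat # 1 ⊕ ($ SizeP ⊕ $ SizeP) times convolveStep

fetchPair storeRow contract contractAll : Cmd
fetchPair =
  Count ≔ $ Count ⊖ # 1 ⨾ C ≔ Child ‹ $ Count › ⨾ P ≔ Parent ‹ $ Count › ⨾
  RowP ≔ Row ‹ $ P › ⨾ RowC ≔ Row ‹ $ C › ⨾ SizeP ≔ Size ‹ $ P › ⨾ SizeC ≔ Size ‹ $ C ›
storeRow =
  Row ‹ $ P ›≔ $ Free ⨾ Size ‹ $ P ›≔ $ SizeP ⊕ $ SizeC ⨾
  Free ≔ $ Free ⊕ (# 1 ⊕ (($ SizeP ⊕ $ SizeC) ⊕ ($ SizeP ⊕ $ SizeC)))
contract = fetchPair ⨾ convolve ⨾ storeRow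
contractAll = repeat $ Count times contract

chooseVertex choose : Cmd
chooseVertex =
  Best ≔ $ Best ⊕ (Cell ‹ Row ‹ $ I › ⊕ Size ‹ $ I › › ⊖ $ Best) ⨾ increment I
choose = I ≔ # 0 ⨾ repeat $ N times chooseVertex

-- The guard `($ Best ⊕ # 1) ⊖ Pow ‹ $ N ›` is positive exactly when `2 ^ n` can be subtracted, so n
-- rounds strip the cardinality part of the code. The remaining binary digits are then read off from
-- the most significant one, which belongs to vertex 0.
dropCardinality printDigit printDigits printSet : Cmd
dropCardinality = when ($ Best ⊕ # 1) ⊖ Pow ‹ $ N › then Best ≔ $ Best ⊖ Pow ‹ $ N ›
printDigit =
  I ≔ $ I ⊖ # 1 ⨾ B ≔ # 1 ⊖ (Pow ‹ $ I › ⊖ $ Best) ⨾ print ($ B) ⨾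
  when $ B then Best ≔ $ Best ⊖ Pow ‹ $ I ›
printDigits = I ≔ $ N ⨾ repeat $ N times printDigit
printSet = repeat $ N times dropCardinality ⨾ printDigits

algorithm : Cmd
algorithm =
  readColours ⨾ readEdges ⨾ powers ⨾ growTree ⨾ initTables ⨾ contractAll ⨾ choose ⨾ printSet

val : State → Class → ℕ
val σ a = mem σ a 0

-- Correctness of the phases

Stored : (ℕ → ℕ) → ℕ → List ℕ → Set
Stored f i []       = ⊤
Stored f i (x ∷ xs) = f i ≡ x × Stored f (suc i) xs

stored-tabulate : ∀ {f i n} (g : Fin n → ℕ) → Stored f i (toList (tabulate g)) → ∀ v → f (toℕ v + i) ≡ g v
stored-tabulate g (eq , _)      zero    = eq
stored-tabulate {f} g (_ , stored) (suc v) =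
  trans (cong f (sym (ℕ.+-suc (toℕ v) _))) (stored-tabulate (g ∘ suc) stored v)

-- The claim about the cells below `i` is there for the induction: the remaining iterations must not
-- disturb the colours already stored.
readColours-loop : ∀ xs {rest σ i} → inp σ ≡ xs ++ rest → val σ I ≡ i →
  let σ′ = iter (length xs) (run readColour) σ in
  inp σ′ ≡ rest × Stored (mem σ′ Col) i xs × (∀ {j} → j < i → mem σ′ Col j ≡ mem σ Col j) ×
  iterCost (length xs) (run readColour) (cost readColour) σ ≤ length xs * (maxCost readColour + 3)
readColours-loop [] eq I≡ = eq , tt , (λ _ → refl) , z≤n
readColours-loop (x ∷ xs) {rest} {σ} {i} eq refl
  = let inp≡ , stored , kept , cost′ = readColours-loop xs {rest} {run readColour σ} {suc i}
          (cong tl eq) (ℕ.+-comm (val σ I) 1) in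
  inp≡ , (trans (kept ℕ.≤-refl) (trans (upd-same (mem σ Col) (val σ I) (hd (inp σ))) (cong hd eq)) , stored) ,
  (λ {j} j<i → trans (kept (ℕ.m<n⇒m<1+n j<i)) (upd-other (mem σ Col) (hd (inp σ)) (ℕ.<⇒≢ j<i ∘ sym))) ,
  ℕ.+-mono-≤ (cost≤ readColour refl σ) (ℕ.+-monoʳ-≤ 3 cost′)

StoredEdges : ∀ {n} → (ℕ → ℕ) → (ℕ → ℕ) → ℕ → List (Fin n × Fin n) → Set
StoredEdges f g i []             = ⊤
StoredEdges f g i ((u , v) ∷ es) = f i ≡ toℕ u × g i ≡ toℕ v × StoredEdges f g (suc i) es

endpoints : ∀ {n} → List (Fin n × Fin n) → List ℕ
endpoints = concatMap (λ (u , v) → toℕ u ∷ toℕ v ∷ [])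

readEdges-loop : ∀ {n} (es : List (Fin n × Fin n)) {σ i} → inp σ ≡ endpoints es → val σ I ≡ i →
  let σ′ = iter (length es) (run readEdge) σ in
  StoredEdges (mem σ′ EdgeU) (mem σ′ EdgeV) i es ×
  (∀ {j} → j < i → mem σ′ EdgeU j ≡ mem σ EdgeU j × mem σ′ EdgeV j ≡ mem σ EdgeV j) ×
  iterCost (length es) (run readEdge) (cost readEdge) σ ≤ length es * (maxCost readEdge + 3)
readEdges-loop [] eq I≡ = tt , (λ _ → refl , refl) , z≤n
readEdges-loop ((u , v) ∷ es) {σ} {i} eq refl =
  let stored , kept , cost′ = readEdges-loop es {run readEdge σ} {suc i}
        (cong (tl ∘ tl) eq) (ℕ.+-comm (val σ I) 1)
      kept₁ = kept ℕ.≤-refl in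
  (trans (proj₁ kept₁) (trans (upd-same (mem σ EdgeU) (val σ I) (hd (inp σ))) (cong hd eq)) ,
   trans (proj₂ kept₁) (trans (upd-same (mem σ EdgeV) (val σ I) (hd (tl (inp σ)))) (cong (hd ∘ tl) eq)) ,
   stored) ,
  (λ {j} j<i → let kept₂ = kept (ℕ.m<n⇒m<1+n j<i) in
    trans (proj₁ kept₂) (upd-other (mem σ EdgeU) (hd (inp σ)) (ℕ.<⇒≢ j<i ∘ sym)) ,
    trans (proj₂ kept₂) (upd-other (mem σ EdgeV) (hd (tl (inp σ))) (ℕ.<⇒≢ j<i ∘ sym))) ,
  ℕ.+-mono-≤ (cost≤ readEdge refl σ) (ℕ.+-monoʳ-≤ 3 cost′)

powers-loop : ∀ k {σ} → val σ I ≡ 0 → mem σ Pow 0 ≡ 1 →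
  (val (iter k (run nextPower) σ) I ≡ k × (∀ {j} → j ≤ k → mem (iter k (run nextPower) σ) Pow j ≡ 2 ^ j)) ×
  iterCost k (run nextPower) (cost nextPower) σ ≤ k * (maxCost nextPower + 3)
powers-loop k I≡ Pow≡ = loop-rule k extended (I≡ , λ { z≤n → Pow≡ })
  where
  open Loop nextPower (λ i σ → val σ I ≡ i × (∀ {j} → j ≤ i → mem σ Pow j ≡ 2 ^ j)) (maxCost nextPower)
  extended : ∀ i σ → i < k → val σ I ≡ i × (∀ {j} → j ≤ i → mem σ Pow j ≡ 2 ^ j) →
    (val (run nextPower σ) I ≡ suc i × (∀ {j} → j ≤ suc i → mem (run nextPower σ) Pow j ≡ 2 ^ j)) ×
    cost nextPower σ ≤ maxCost nextPower
  extended i σ _ (I≡ , Pow≡) =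
    (trans (cong (_+ 1) I≡) (ℕ.+-comm i 1) , powered) , cost≤ nextPower refl σ
    where
    index : val σ I + 1 ≡ suc i
    index = trans (cong (_+ 1) I≡) (ℕ.+-comm i 1)
    x : ℕ
    x = mem σ Pow (val σ I) + mem σ Pow (val σ I)
    powered : ∀ {j} → j ≤ suc i → mem (run nextPower σ) Pow j ≡ 2 ^ j
    powered {j} j≤ with ℕ.m≤n⇒m<n∨m≡n j≤
    ... | inj₁ (s≤s j≤i) = trans
      (upd-other (mem σ Pow) x (λ eq → ℕ.1+n≰n (subst (_≤ i) (trans (sym eq) index) j≤i))) (Pow≡ j≤i)
    ... | inj₂ refl = trans (cong (mem (run nextPower σ) Pow) (sym index))
      (trans (upd-same (mem σ Pow) (val σ I + 1) x)
        (trans (cong (λ y → mem σ Pow y + mem σ Pow y) I≡)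
          (trans (cong (λ y → y + y) (Pow≡ ℕ.≤-refl)) (cong (2 ^ i +_) (sym (ℕ.+-identityʳ (2 ^ i)))))))

pick-zero : ∀ {A : Set} {x} {a b : A} → x ≡ 0 → pick x a b ≡ a
pick-zero refl = refl

pick-positive : ∀ {A : Set} {x} {a b : A} → 0 < x → pick x a b ≡ b
pick-positive (s≤s _) = refl

-- Growing the tree on the machine

module Growing {n : ℕ} (r : Fin n) where
  open Growth r
  open DecMembership (Fin._≟_ {n}) using (_∈?_)

  -- The latest pair, at the head of the list, has the highest index, so the two arrays form a
  -- stack: growth pushes and contraction pops.
  Recorded : (ℕ → ℕ) → (ℕ → ℕ) → Pairs → Set
  Recorded f g []            = ⊤
  Recorded f g ((c , p) ∷ L) = f (length L) ≡ toℕ c × g (length L) ≡ toℕ p × Recorded f g L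

  recorded-upd : ∀ {f g} L {i x y} → length L ≤ i → Recorded f g L → Recorded (f [ i ↦ x ]) (g [ i ↦ y ]) L
  recorded-upd [] _ _ = tt
  recorded-upd {f} {g} (_ ∷ L) {i} {x} {y} le (f≡ , g≡ , rec) =
    trans (upd-other f x (ℕ.<⇒≢ le ∘ sym)) f≡ , trans (upd-other g y (ℕ.<⇒≢ le ∘ sym)) g≡ ,
    recorded-upd L (ℕ.<⇒≤ le) rec

  record Holds (L : Pairs) (σ : State) : Set where
    field
      visited   : ∀ {v} → v ∈ₗ active L → mem σ Visited (toℕ v) ≡ 1
      unvisited : ∀ {v} → v ∉ₗ active L → mem σ Visited (toℕ v) ≡ 0
      count     : val σ Count ≡ length L
      recorded  : Recorded (mem σ Child) (mem σ Parent) L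

  open Holds

  addChild-correct : ∀ {L σ c p} → val σ C ≡ toℕ c → val σ P ≡ toℕ p → Holds L σ →
    Holds ((c , p) ∷ L) (run addChild σ)
  addChild-correct {L} {σ} {c} {p} C≡ P≡ h = record
    { visited   = visited′
    ; unvisited = λ v∉ → trans (upd-other (mem σ Visited) 1
        (λ eq → v∉ (here (Fin.toℕ-injective (trans (sym eq) C≡))))) (unvisited h (v∉ ∘ there))
    ; count     = trans (ℕ.+-comm (val σ Count) 1) (cong suc (count h))
    ; recorded  =
        trans (cong (mem σ Child [ val σ Count ↦ val σ C ]) (sym (count h)))
          (trans (upd-same (mem σ Child) (val σ Count) (val σ C)) C≡) ,
        trans (cong (mem σ Parent [ val σ Count ↦ val σ P ]) (sym (count h)))
          (trans (upd-same (mem σ Parent) (val σ Count) (val σ P)) P≡) ,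
        recorded-upd L (ℕ.≤-reflexive (sym (count h))) (recorded h)
    }
    where
    visited′ : ∀ {v} → v ∈ₗ c ∷ active L → (mem σ Visited [ val σ C ↦ 1 ]) (toℕ v) ≡ 1
    visited′ {v} v∈ = by (val σ C ℕ.≟ toℕ v) v∈
      where
      by : Dec (val σ C ≡ toℕ v) → v ∈ₗ c ∷ active L → (mem σ Visited [ val σ C ↦ 1 ]) (toℕ v) ≡ 1
      by (yes eq) _           =
        trans (cong (mem σ Visited [ val σ C ↦ 1 ]) (sym eq)) (upd-same (mem σ Visited) (val σ C) 1)
      by (no neq) (here refl) = contradiction C≡ neq
      by (no neq) (there v∈L) = trans (upd-other (mem σ Visited) 1 neq) (visited h v∈L)

  attachChild-correct : ∀ {L σ c p} → val σ C ≡ toℕ c → val σ P ≡ toℕ p → Holds L σ →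
    Holds (attach c p L) (run attachChild σ)
  attachChild-correct {L} {σ} {c} {p} C≡ P≡ h with p ∈? active L | c ∈? active L
  ... | yes p∈ | yes c∈ = subst (Holds L) (sym (pick-zero {a = σ} {run addChild σ} (cong₂ _∸_
    (trans (cong (mem σ Visited) P≡) (visited h p∈)) (trans (cong (mem σ Visited) C≡) (visited h c∈))))) h
  ... | no p∉ | _ = subst (Holds L) (sym (pick-zero {a = σ} {run addChild σ}
    (trans (cong (_∸ mem σ Visited (val σ C)) (trans (cong (mem σ Visited) P≡) (unvisited h p∉)))
      (ℕ.0∸n≡0 (mem σ Visited (val σ C)))))) h
  ... | yes p∈ | no c∉ = subst (Holds ((c , p) ∷ L))
    (sym (pick-positive {a = σ} {run addChild σ} (ℕ.≤-reflexive (sym (cong₂ _∸_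
      (trans (cong (mem σ Visited) P≡) (visited h p∈))
      (trans (cong (mem σ Visited) C≡) (unvisited h c∉)))))))
    (addChild-correct C≡ P≡ h)

  holds-cong : ∀ {L σ σ′} → mem σ′ Visited ≡ mem σ Visited → mem σ′ Count ≡ mem σ Count →
    mem σ′ Child ≡ mem σ Child → mem σ′ Parent ≡ mem σ Parent → Holds L σ → Holds L σ′
  holds-cong {L} v≡ n≡ c≡ p≡ h = record
    { visited   = λ v∈ → trans (cong (λ f → f _) v≡) (visited h v∈)
    ; unvisited = λ v∉ → trans (cong (λ f → f _) v≡) (unvisited h v∉)
    ; count     = trans (cong (λ f → f 0) n≡) (count h)
    ; recorded  = subst₂ (λ f g → Recorded f g L) (sym c≡) (sym p≡) (recorded h)
    }

  growEdge-correct : ∀ {L σ u v} → mem σ EdgeU (val σ K) ≡ toℕ u → mem σ EdgeV (val σ K) ≡ toℕ v →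
    Holds L σ → Holds (attachEdge L (u , v)) (run growEdge σ)
  growEdge-correct {L} {σ} {u} {v} U≡ V≡ h =
    holds-cong {σ = run attachChild σ₃} refl refl refl refl
      (attachChild-correct {attach v u L} {σ₃} {u} {v}
        (trans (cong₂ (λ f i → f i) (frame attachChild EdgeU refl σ₁) K≡) U≡)
        (trans (cong₂ (λ f i → f i) (frame attachChild EdgeV refl σ₁) K≡) V≡)
        (holds-cong {σ = σ₂} refl refl refl refl
          (attachChild-correct {L} {σ₁} {v} {u} V≡ U≡ (holds-cong {σ = σ} refl refl refl refl h))))
    where
    σ₁ σ₂ σ₃ : State
    σ₁ = run (P ≔ EdgeU ‹ $ K ›) (run (C ≔ EdgeV ‹ $ K ›) σ)
    σ₂ = run attachChild σ₁
    σ₃ = run (P ≔ EdgeV ‹ $ K ›) (run (C ≔ EdgeU ‹ $ K ›) σ₂)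
    K≡ : val σ₂ K ≡ val σ K
    K≡ = frame-at attachChild K refl σ₁ 0

  growPass-loop : ∀ es {L σ i} → val σ K ≡ i → StoredEdges (mem σ EdgeU) (mem σ EdgeV) i es → Holds L σ →
    Holds (pass L es) (iter (length es) (run growEdge) σ) ×
    iterCost (length es) (run growEdge) (cost growEdge) σ ≤ length es * (maxCost growEdge + 3)
  growPass-loop [] _ _ h = h , z≤n
  growPass-loop ((u , v) ∷ es) {L} {σ} refl (U≡ , V≡ , stored) h =
    let h′ , c = growPass-loop es {attachEdge L (u , v)} {run growEdge σ} {suc (val σ K)} K≡
          (subst₂ (λ f g → StoredEdges f g (suc (val σ K)) es)
            (sym (frame growEdge EdgeU refl σ)) (sym (frame growEdge EdgeV refl σ)) stored)
          (growEdge-correct U≡ V≡ h)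
    in h′ , ℕ.+-mono-≤ (cost≤ growEdge refl σ) (ℕ.+-monoʳ-≤ 3 c)
    where
    before : Cmd
    before = C ≔ EdgeV ‹ $ K › ⨾ P ≔ EdgeU ‹ $ K › ⨾ attachChild ⨾
      C ≔ EdgeU ‹ $ K › ⨾ P ≔ EdgeV ‹ $ K › ⨾ attachChild
    K≡ : val (run growEdge σ) K ≡ suc (val σ K)
    K≡ = trans (ℕ.+-comm (val (run before σ) K) 1) (cong (λ f → suc (f 0)) (frame before K refl σ))

  passCost : ℕ → ℕ
  passCost m = 10 + (9 + (5 + m * (maxCost growEdge + 3)))

  GrowState : List (Fin n × Fin n) → ℕ → State → Set
  GrowState es k σ = Holds (passes k es) σ × StoredEdges (mem σ EdgeU) (mem σ EdgeV) 0 es × val σ M ≡ length es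

  growPass-correct : ∀ es {k σ} → GrowState es k σ →
    Ensures growPass σ (GrowState es (suc k)) (passCost (length es))
  growPass-correct es {k} {σ} (h , stored , M≡) = ensures-map {Q = Holds (passes (suc k) es)}
    (λ h′ → h′ , subst₂ (λ f g → StoredEdges f g 0 es)
       (sym (frame growPass EdgeU refl σ)) (sym (frame growPass EdgeV refl σ)) stored ,
     trans (frame-at growPass M refl σ 0) M≡)
    (ensures-first (K ≔ # 0) (repeat $ M times growEdge) refl
      (ensures-repeat ($ M) growEdge (length es) M≡
        (growPass-loop es {passes k es} {run (K ≔ # 0) σ} refl stored (holds-cong {σ = σ} refl refl refl refl h))))

  growTree-correct : ∀ es {σ} → val σ N ≡ n → GrowState es 0 (run (Visited ‹ # 0 ›≔ # 1) σ) →
    Ensures growTree σ (Holds (passes n es)) (10 + (9 + (5 + n * (passCost (length es) + 3))))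
  growTree-correct es {σ} N≡ started = ensures-map {Q = GrowState es n} proj₁
    (ensures-first (Visited ‹ # 0 ›≔ # 1) (repeat $ N times growPass) refl
      (ensures-repeat ($ N) growPass n N≡
        (loop-rule n (λ i σ _ g → let ensures q c = growPass-correct es {i} {σ} g in q , c) started)))
    where open Loop growPass (GrowState es) (passCost (length es))

-- Rows of cells and the initial tables

module Initialising {n : ℕ} (r : Fin n) (G : Graph n) (χ : Colouring n) where
  open Growth r
  open Tree G
  open Tables χ
  open Growing r

  record Ready (D : Subset n) (v : Fin n) (σ : State) : Set where
    field
      size  : mem σ Size (toℕ v) ≡ ∣ D ∣
      bound : mem σ Row (toℕ v) + (∣ D ∣ + ∣ D ∣) < val σ Free
      table : Table D v (λ k → mem σ Cell (mem σ Row (toℕ v) + k))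

  Fresh : State → Set
  Fresh σ = ∀ j → val σ Free ≤ j → mem σ Cell j ≡ 0

  -- By `bound` a row ends below `Free`, so filling a newly allocated row cannot spoil a table
  -- stored earlier.
  ready-preserved : ∀ {D v σ σ′} → mem σ′ Size (toℕ v) ≡ mem σ Size (toℕ v) →
    mem σ′ Row (toℕ v) ≡ mem σ Row (toℕ v) → val σ Free ≤ val σ′ Free →
    (∀ j → j < val σ Free → mem σ′ Cell j ≡ mem σ Cell j) → Ready D v σ → Ready D v σ′
  ready-preserved {D} {v} {σ} {σ′} size≡ row≡ free≤ cell≡ ready = record
    { size  = trans size≡ size
    ; bound = subst (λ x → x + (∣ D ∣ + ∣ D ∣) < val σ′ Free) (sym row≡) (ℕ.<-≤-trans bound free≤)
    ; table = table-cong (λ k k≤ → trans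
        (sym (cell≡ (mem σ Row (toℕ v) + k) (ℕ.≤-<-trans (ℕ.+-monoʳ-≤ (mem σ Row (toℕ v)) k≤) bound)))
        (cong (λ x → mem σ′ Cell (x + k)) (sym row≡))) table
    }
    where open Ready ready

  record Inputs (σ : State) : Set where
    field
      order   : val σ N ≡ n
      powered : ∀ {j} → j ≤ n → mem σ Pow j ≡ 2 ^ j
      colours : ∀ v → mem σ Col (toℕ v) ≡ colourCode (χ v)

  record Initialised (i : ℕ) (σ : State) : Set where
    field
      index  : val σ I ≡ i
      inputs : Inputs σ
      ready  : ∀ v → toℕ v < i → Ready ⁅ v ⁆ v σ
      fresh  : Fresh σ

  initVertex-correct : ∀ {i σ} → i < n → Initialised i σ → Initialised (suc i) (run initVertex σ)
  initVertex-correct {i} {σ} i<n init = record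
    { index  = trans (ℕ.+-comm (val σ I) 1) (cong suc index)
    ; inputs = record { order = order ; powered = powered ; colours = colours }
    ; ready  = λ v v≤i → ready-by v v≤i (toℕ v ℕ.≟ i)
    ; fresh  = λ j le → trans (upd-other (mem σ Cell) x (λ eq →
        ℕ.<⇒≱ (ℕ.+-monoʳ-< f (key<3 (mem σ Col (val σ I)))) (subst (f + 3 ≤_) (sym eq) le)))
        (fresh j (ℕ.≤-trans (ℕ.m≤m+n f 3) le))
    }
    where
    open Initialised init
    open Inputs inputs
    σ′ : State
    σ′ = run initVertex σ
    f x : ℕ
    f = val σ Free
    x = mem σ Pow (val σ N) + mem σ Pow (val σ N ∸ (val σ I + 1))
    key : ℕ → ℕ
    key c = (1 ∸ c) + (1 ∸ c)
    key<3 : ∀ c → key c < 3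
    key<3 zero    = ℕ.≤-refl
    key<3 (suc c) = subst (λ y → y + y < 3) (sym (ℕ.0∸n≡0 c)) (s≤s z≤n)
    ready-new : ∀ v → toℕ v ≡ i → Ready ⁅ v ⁆ v σ′
    ready-new v v≡i = record
      { size  = trans (cong (mem σ Size [ val σ I ↦ 1 ]) v≡I)
          (trans (upd-same (mem σ Size) (val σ I) 1) (sym (Sub.∣⁅x⁆∣≡1 v)))
      ; bound = subst₂ (λ a b → a + b < f + 3) (sym row≡) (sym (cong₂ _+_ (Sub.∣⁅x⁆∣≡1 v) (Sub.∣⁅x⁆∣≡1 v)))
          (ℕ.+-monoʳ-< f ℕ.≤-refl)
      ; table = table-singleton v k₀ (λ k → mem σ′ Cell (mem σ′ Row (toℕ v) + k)) key₀
          (trans (cong (mem σ′ Cell) (cong₂ _+_ row≡ k₀≡))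
            (trans (upd-same (mem σ Cell) (f + key (mem σ Col (val σ I))) x) x≡))
          λ k _ k≢ → trans (cong (λ y → mem σ′ Cell (y + k)) row≡)
            (trans (upd-other (mem σ Cell) x (λ eq → k≢ (sym (trans k₀≡ (ℕ.+-cancelˡ-≡ f _ _ eq)))))
              (fresh (f + k) (ℕ.m≤m+n f k)))
      }
      where
      v≡I : toℕ v ≡ val σ I
      v≡I = trans v≡i (sym index)
      row≡ : mem σ′ Row (toℕ v) ≡ f
      row≡ = trans (cong (mem σ Row [ val σ I ↦ f ]) v≡I) (upd-same (mem σ Row) (val σ I) f)
      k₀ : ℕ
      k₀ = key (colourCode (χ v))
      k₀≡ : k₀ ≡ key (mem σ Col (val σ I))
      k₀≡ = cong key (trans (sym (colours v)) (cong (mem σ Col) v≡I))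
      key₀ : k₀ + is red v ≡ 1 + is blue v
      key₀ with χ v
      ... | blue = refl
      ... | red  = refl
      x≡ : x ≡ code v
      x≡ = cong₂ _+_ (trans (cong (mem σ Pow) order) (powered ℕ.≤-refl))
        (trans (cong (mem σ Pow) (cong₂ _∸_ order (trans (ℕ.+-comm (val σ I) 1) (cong suc (sym v≡I)))))
          (trans (powered (ℕ.m∸n≤m n (suc (toℕ v)))) (sym (bit≡ v))))
    ready-by : ∀ v → toℕ v < suc i → Dec (toℕ v ≡ i) → Ready ⁅ v ⁆ v σ′
    ready-by v _         (yes v≡i) = ready-new v v≡i
    ready-by v (s≤s v≤i) (no v≢i)  = ready-preserved {σ = σ} {σ′}
      (upd-other (mem σ Size) 1 (λ eq → v≢i (trans (sym eq) index)))
      (upd-other (mem σ Row) f (λ eq → v≢i (trans (sym eq) index)))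
      (ℕ.m≤m+n f 3)
      (λ j j<f → upd-other (mem σ Cell) x (λ eq → ℕ.<⇒≱ j<f (subst (f ≤_) eq (ℕ.m≤m+n f _))))
      (ready v (ℕ.≤∧≢⇒< v≤i v≢i))

  initTables-correct : ∀ {σ} → Inputs σ → val σ Free ≡ 0 → (∀ j → mem σ Cell j ≡ 0) →
    Ensures initTables σ (Initialised n) (10 + (9 + (5 + n * (maxCost initVertex + 3))))
  initTables-correct {σ} inputs free≡ cell≡ =
    ensures-first (I ≔ # 0) (repeat $ N times initVertex) refl
      (ensures-repeat ($ N) initVertex n order
        (loop-rule n (λ i σ i<n init → initVertex-correct i<n init , cost≤ initVertex refl σ) record
          { index  = refl
          ; inputs = record { order = order ; powered = powered ; colours = colours }
          ; ready  = λ _ ()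
          ; fresh  = λ j _ → cell≡ j
          }))
    where
    open Inputs inputs
    open Loop initVertex Initialised (maxCost initVertex)

-- The max-plus convolution on the machine

-- Taking a maximum preserves lower bounds already reached, establishes the new one, and writes
-- nothing but an old value or `s`; the first two facts serve `into`, the third serves `from`.
relax-at : ∀ (g : ℕ → ℕ) a s → let g′ = g [ a ↦ g a + (s ∸ g a) ] in
  (∀ j → g j ≤ g′ j) × s ≤ g′ a × (∀ j → g′ j ≡ g j ⊎ (j ≡ a × g′ j ≡ s))
relax-at g a s = (λ j → increases j (a ℕ.≟ j)) , reaches , λ j → either j (a ℕ.≟ j)
  where
  x : ℕ
  x = g a + (s ∸ g a)
  at-a : (g [ a ↦ x ]) a ≡ x
  at-a = upd-same g a x
  increases : ∀ j → Dec (a ≡ j) → g j ≤ (g [ a ↦ x ]) j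
  increases j (yes refl) = ℕ.≤-trans (ℕ.m≤m+n (g a) (s ∸ g a)) (ℕ.≤-reflexive (sym at-a))
  increases j (no a≢j)   = ℕ.≤-reflexive (sym (upd-other g x a≢j))
  reaches : s ≤ (g [ a ↦ x ]) a
  reaches = subst (s ≤_) (sym at-a) (ℕ.m≤n+m∸n s (g a))
  either : ∀ j → Dec (a ≡ j) → (g [ a ↦ x ]) j ≡ g j ⊎ (j ≡ a × (g [ a ↦ x ]) j ≡ s)
  either j (no a≢j)   = inj₁ (upd-other g x a≢j)
  either j (yes refl) with ℕ.≤-total s (g a)
  ... | inj₁ s≤ = inj₁ (trans at-a (trans (cong (g a +_) (ℕ.m≤n⇒m∸n≡0 s≤)) (ℕ.+-identityʳ (g a))))
  ... | inj₂ ≥s = inj₂ (refl , trans at-a (ℕ.m+[n∸m]≡n ≥s))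

equality : ℕ → ℕ → ℕ
equality x y = 1 ∸ ((x ∸ y) + (y ∸ x))

equality-refl : ∀ x → equality x x ≡ 1
equality-refl x rewrite ℕ.n∸n≡0 x = refl

equality⇒≡ : ∀ x y → 0 < equality x y → x ≡ y
equality⇒≡ x y pos with (x ∸ y) + (y ∸ x) in eq
... | zero = ℕ.≤-antisym (ℕ.m∸n≡0⇒m≤n (ℕ.m+n≡0⇒m≡0 (x ∸ y) eq)) (ℕ.m∸n≡0⇒m≤n (ℕ.m+n≡0⇒n≡0 (x ∸ y) eq))
... | suc z = contradiction (subst (0 <_) (ℕ.0∸n≡0 z) pos) λ ()

module Convolving {n : ℕ} (r : Fin n) (G : Graph n) (χ : Colouring n) (σ₀ : State) where
  open Growth r
  open Tree G
  open Tables χ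

  f rp rc dp dc : ℕ
  f  = val σ₀ Free
  rp = val σ₀ RowP
  rc = val σ₀ RowC
  dp = val σ₀ SizeP
  dc = val σ₀ SizeC

  tp tc : ℕ → ℕ
  tp k = mem σ₀ Cell (rp + k)
  tc k = mem σ₀ Cell (rc + k)

  Origin : ℕ → ℕ → Set
  Origin k x = ∃[ k₁ ] ∃[ k₂ ] (k₁ ≤ dp + dp × k₂ ≤ dc + dc × 0 < tp k₁ ×
    Admissible dc tc k₂ × k₁ + k₂ ≡ k × x ≡ tp k₁ + tc k₂)

  -- Only the lower bounds `into` depend on the pairs of indices processed so far; every nonzero
  -- cell of the new row has an origin at all times. The source rows, lying below `f`, still hold
  -- their values from `σ₀`.
  record Partial (Done : ℕ → ℕ → Set) (σ : State) : Set where
    field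
      free  : val σ Free ≡ f
      rowP  : val σ RowP ≡ rp
      rowC  : val σ RowC ≡ rc
      sizeP : val σ SizeP ≡ dp
      sizeC : val σ SizeC ≡ dc
      below : ∀ j → j < f → mem σ Cell j ≡ mem σ₀ Cell j
      from  : ∀ k → 0 < mem σ Cell (f + k) → Origin k (mem σ Cell (f + k))
      into  : ∀ {k₁ k₂} → Done k₁ k₂ → k₁ ≤ dp + dp → k₂ ≤ dc + dc → 0 < tp k₁ →
              Admissible dc tc k₂ → tp k₁ + tc k₂ ≤ mem σ Cell (f + (k₁ + k₂))

  -- The change of `Done` has to be justified only for pairs in range with usable entries, so an
  -- iteration skipped by a guard counts as done.
  partial-map : ∀ {Done Done′ σ} →
    (∀ {k₁ k₂} → Done′ k₁ k₂ → k₁ ≤ dp + dp → k₂ ≤ dc + dc → 0 < tp k₁ → Admissible dc tc k₂ → Done k₁ k₂) →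
    Partial Done σ → Partial Done′ σ
  partial-map weaken p = record
    { free = free ; rowP = rowP ; rowC = rowC ; sizeP = sizeP ; sizeC = sizeC
    ; below = below ; from = from
    ; into = λ d k₁≤ k₂≤ pos adm → into (weaken d k₁≤ k₂≤ pos adm) k₁≤ k₂≤ pos adm
    }
    where open Partial p

  -- The lexicographic order in which the nested loops visit the pairs of indices.
  Before After : ℕ → ℕ → ℕ → ℕ → Set
  Before k₁ k₂ a b = a < k₁ ⊎ (a ≡ k₁ × b < k₂)
  After k₁ k₂ = Before k₁ (suc k₂)

  record Relaxing (k₁ k₂ : ℕ) (σ : State) : Set where
    field
      partial : Partial (Before k₁ k₂) σ
      index₁  : val σ K₁ ≡ k₁
      index₂  : val σ K₂ ≡ k₂

  module _ (rp< : rp + (dp + dp) < f) (rc< : rc + (dc + dc) < f) where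

    relax-correct : ∀ {k₁ k₂ σ} → k₁ ≤ dp + dp → k₂ ≤ dc + dc → 0 < tp k₁ → Admissible dc tc k₂ →
      Relaxing k₁ k₂ σ → Partial (After k₁ k₂) (run relax σ)
    relax-correct {k₁} {k₂} {σ} k₁≤ k₂≤ pos adm inner = record
      { free = free ; rowP = rowP ; rowC = rowC ; sizeP = sizeP ; sizeC = sizeC
      ; below = below′ ; from = from′ ; into = into′
      }
      where
      open Relaxing inner
      open Partial partial
      g g′ : ℕ → ℕ
      g  = mem σ Cell
      a s : ℕ
      a  = val σ Free + (val σ K₁ + val σ K₂)
      s  = g (val σ RowP + val σ K₁) + g (val σ RowC + val σ K₂)
      g′ = g [ a ↦ g a + (s ∸ g a) ]
      a≡ : a ≡ f + (k₁ + k₂)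
      a≡ = cong₂ _+_ free (cong₂ _+_ index₁ index₂)
      s≡ : s ≡ tp k₁ + tc k₂
      s≡ = cong₂ _+_
        (trans (cong g (cong₂ _+_ rowP index₁)) (below _ (ℕ.≤-<-trans (ℕ.+-monoʳ-≤ rp k₁≤) rp<)))
        (trans (cong g (cong₂ _+_ rowC index₂)) (below _ (ℕ.≤-<-trans (ℕ.+-monoʳ-≤ rc k₂≤) rc<)))
      increases : ∀ j → g j ≤ g′ j
      increases = proj₁ (relax-at g a s)
      reaches : s ≤ g′ a
      reaches = proj₁ (proj₂ (relax-at g a s))
      either : ∀ j → g′ j ≡ g j ⊎ (j ≡ a × g′ j ≡ s)
      either = proj₂ (proj₂ (relax-at g a s))
      below′ : ∀ j → j < f → g′ j ≡ mem σ₀ Cell j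
      below′ j j<f with either j
      ... | inj₁ eq = trans eq (below j j<f)
      ... | inj₂ (j≡a , _) = contradiction (subst (_< f) (trans j≡a a≡) j<f) (ℕ.≤⇒≯ (ℕ.m≤m+n f (k₁ + k₂)))
      from′ : ∀ k → 0 < g′ (f + k) → Origin k (g′ (f + k))
      from′ k pos′ with either (f + k)
      ... | inj₁ eq = subst (Origin k) (sym eq) (from k (subst (0 <_) eq pos′))
      ... | inj₂ (fk≡a , eq) = k₁ , k₂ , k₁≤ , k₂≤ , pos , adm ,
        sym (ℕ.+-cancelˡ-≡ f _ _ (trans fk≡a a≡)) , trans eq s≡
      into′ : ∀ {l₁ l₂} → After k₁ k₂ l₁ l₂ → l₁ ≤ dp + dp → l₂ ≤ dc + dc → 0 < tp l₁ →
        Admissible dc tc l₂ → tp l₁ + tc l₂ ≤ g′ (f + (l₁ + l₂))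
      into′ {l₁} {l₂} (inj₁ lt) l₁≤ l₂≤ pos′ adm′ =
        ℕ.≤-trans (into (inj₁ lt) l₁≤ l₂≤ pos′ adm′) (increases (f + (l₁ + l₂)))
      into′ {l₁} {l₂} (inj₂ (refl , s≤s l₂≤k₂)) l₁≤ l₂≤ pos′ adm′ with ℕ.m≤n⇒m<n∨m≡n l₂≤k₂
      ... | inj₁ lt   = ℕ.≤-trans (into (inj₂ (refl , lt)) l₁≤ l₂≤ pos′ adm′) (increases (f + (l₁ + l₂)))
      ... | inj₂ refl = subst₂ _≤_ s≡ (cong g′ a≡) reaches

    relaxStep-correct : ∀ {k₁ k₂ σ} → k₁ ≤ dp + dp → k₂ ≤ dc + dc → 0 < tp k₁ →
      Relaxing k₁ k₂ σ → Relaxing k₁ (suc k₂) (run relaxStep σ)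
    relaxStep-correct {k₁} {k₂} {σ} k₁≤ k₂≤ pos inner = record
      { partial = record { free = free ; rowP = rowP ; rowC = rowC ; sizeP = sizeP ; sizeC = sizeC
                         ; below = below ; from = from ; into = into }
      ; index₁  = trans (frame-at relaxStep K₁ refl σ 0) index₁
      ; index₂  = trans (ℕ.+-comm (val σ₁ K₂) 1) (cong suc
          (trans (frame-at guarded K₂ refl σ 0) index₂))
      }
      where
      open Relaxing inner using (index₁; index₂)
      guard : Exp
      guard = Cell ‹ $ RowC ⊕ $ K₂ › ⊕ equal K₂ SizeC
      guarded : Cmd
      guarded = when guard then relax
      σ₁ : State
      σ₁ = run guarded σ
      guard≡ : ⟦ guard ⟧ (mem σ) ≡ tc k₂ + equality k₂ dc
      guard≡ = cong₂ _+_
        (trans (cong (mem σ Cell) (cong₂ _+_ (Partial.rowC (Relaxing.partial inner)) index₂))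
          (Partial.below (Relaxing.partial inner) _ (ℕ.≤-<-trans (ℕ.+-monoʳ-≤ rc k₂≤) rc<)))
        (cong₂ equality index₂ (Partial.sizeC (Relaxing.partial inner)))
      admissible : 0 < tc k₂ + equality k₂ dc → Admissible dc tc k₂
      admissible lt with tc k₂
      ... | zero  = inj₂ (equality⇒≡ k₂ dc lt)
      ... | suc x = inj₁ (s≤s z≤n)
      inadmissible : tc k₂ + equality k₂ dc ≡ 0 → ¬ Admissible dc tc k₂
      inadmissible eq (inj₁ lt)   = ℕ.<⇒≢ lt (sym (ℕ.m+n≡0⇒m≡0 (tc k₂) eq))
      inadmissible eq (inj₂ refl) = ℕ.1+n≢0 (trans (sym (equality-refl dc)) (ℕ.m+n≡0⇒n≡0 (tc k₂) eq))
      skip : ⟦ guard ⟧ (mem σ) ≡ 0 → Partial (After k₁ k₂) σ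
      skip eq = partial-map weaken (Relaxing.partial inner)
        where
        weaken : ∀ {a b} → After k₁ k₂ a b → a ≤ dp + dp → b ≤ dc + dc → 0 < tp a →
          Admissible dc tc b → Before k₁ k₂ a b
        weaken (inj₁ lt) _ _ _ _ = inj₁ lt
        weaken (inj₂ (a≡ , s≤s b≤)) _ _ _ adm with ℕ.m≤n⇒m<n∨m≡n b≤
        ... | inj₁ lt   = inj₂ (a≡ , lt)
        ... | inj₂ refl = contradiction adm (inadmissible (trans (sym guard≡) eq))
      open Partial (holds (ensures-when guard relax {σ} {Partial (After k₁ k₂)} {maxCost relax} skip
        λ lt → ensures-free relax refl (relax-correct k₁≤ k₂≤ pos (admissible (subst (0 <_) guard≡ lt)) inner)))

    rowCost : ℕ
    rowCost = 10 + (costᴱ (# 1 ⊕ ($ SizeC ⊕ $ SizeC)) + (5 + (1 + (dc + dc)) * (maxCost relaxStep + 3)))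

    convolveRow-correct : ∀ {k₁ σ} → k₁ ≤ dp + dp → 0 < tp k₁ → val σ K₁ ≡ k₁ →
      Partial (λ a _ → a < k₁) σ → Ensures convolveRow σ (Partial (λ a _ → a < suc k₁)) rowCost
    convolveRow-correct {k₁} {σ} k₁≤ pos K₁≡ p = ensures-map {Q = Relaxing k₁ (1 + (dc + dc))}
      (λ inner → partial-map finished (Relaxing.partial inner))
      (ensures-first (K₂ ≔ # 0) (repeat # 1 ⊕ ($ SizeC ⊕ $ SizeC) times relaxStep) refl
        (ensures-repeat (# 1 ⊕ ($ SizeC ⊕ $ SizeC)) relaxStep (1 + (dc + dc))
          (cong (λ x → 1 + (x + x)) sizeC)
          (loop-rule (1 + (dc + dc))
            (λ { k₂ σ (s≤s k₂≤) inner → relaxStep-correct k₁≤ k₂≤ pos inner , cost≤ relaxStep refl σ })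
            {run (K₂ ≔ # 0) σ} record
              { partial = record { free = free ; rowP = rowP ; rowC = rowC ; sizeP = sizeP ; sizeC = sizeC
                                 ; below = below ; from = from
                                 ; into = λ { (inj₁ lt) → into lt ; (inj₂ (_ , ())) } }
              ; index₁  = K₁≡
              ; index₂  = refl
              })))
      where
      open Partial p
      open Loop relaxStep (Relaxing k₁) (maxCost relaxStep)
      finished : ∀ {a b} → a < suc k₁ → a ≤ dp + dp → b ≤ dc + dc → 0 < tp a → Admissible dc tc b →
        Before k₁ (1 + (dc + dc)) a b
      finished (s≤s a≤) _ b≤ _ _ with ℕ.m≤n⇒m<n∨m≡n a≤
      ... | inj₁ lt = inj₁ lt
      ... | inj₂ eq = inj₂ (eq , s≤s b≤)

    Outer : ℕ → State → Set
    Outer k₁ σ = Partial (λ a _ → a < k₁) σ × val σ K₁ ≡ k₁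

    stepCost : ℕ
    stepCost = costᴱ (Cell ‹ $ RowP ⊕ $ K₁ ›) + (3 + rowCost) + maxCost (increment K₁)

    convolveStep-correct : ∀ {k₁ σ} → k₁ ≤ dp + dp → Outer k₁ σ → Ensures convolveStep σ (Outer (suc k₁)) stepCost
    convolveStep-correct {k₁} {σ} k₁≤ (p , K₁≡) =
      ensures-seq (when guard then convolveRow) (increment K₁) {Q = Q}
        (ensures-when guard convolveRow {σ} {Q} {rowCost} (λ eq → partial-map (weaken eq) p , K₁≡) λ lt →
          ensures-map {Q = Partial (λ a _ → a < suc k₁)}
            (λ p′ → p′ , trans (frame-at convolveRow K₁ refl σ 0) K₁≡)
            (convolveRow-correct k₁≤ (subst (0 <_) guard≡ lt) K₁≡ p))
        λ (p′ , K₁≡′) → ensures-free (increment K₁) refl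
          (record { Partial p′ } , trans (cong (_+ 1) K₁≡′) (ℕ.+-comm k₁ 1))
      where
      open Partial p
      guard : Exp
      guard = Cell ‹ $ RowP ⊕ $ K₁ ›
      Q : State → Set
      Q σ = Partial (λ a _ → a < suc k₁) σ × val σ K₁ ≡ k₁
      guard≡ : ⟦ guard ⟧ (mem σ) ≡ tp k₁
      guard≡ = trans (cong (mem σ Cell) (cong₂ _+_ rowP K₁≡))
        (below _ (ℕ.≤-<-trans (ℕ.+-monoʳ-≤ rp k₁≤) rp<))
      weaken : ⟦ guard ⟧ (mem σ) ≡ 0 → ∀ {a b} → a < suc k₁ → a ≤ dp + dp → b ≤ dc + dc → 0 < tp a →
        Admissible dc tc b → a < k₁
      weaken eq (s≤s a≤) _ _ pos _ with ℕ.m≤n⇒m<n∨m≡n a≤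
      ... | inj₁ lt   = lt
      ... | inj₂ refl = contradiction (trans (sym guard≡) eq) (ℕ.<⇒≢ pos ∘ sym)

    convolveCost : ℕ
    convolveCost = 10 + (costᴱ (# 1 ⊕ ($ SizeP ⊕ $ SizeP)) + (5 + (1 + (dp + dp)) * (stepCost + 3)))

    convolve-correct : (∀ j → f ≤ j → mem σ₀ Cell j ≡ 0) →
      Ensures convolve σ₀ (Partial (λ a _ → a < 1 + (dp + dp))) convolveCost
    convolve-correct fresh = ensures-map {Q = Outer (1 + (dp + dp))} proj₁
      (ensures-first (K₁ ≔ # 0) (repeat # 1 ⊕ ($ SizeP ⊕ $ SizeP) times convolveStep) refl
        (ensures-repeat (# 1 ⊕ ($ SizeP ⊕ $ SizeP)) convolveStep (1 + (dp + dp)) refl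
          (loop-rule (1 + (dp + dp))
            (λ { k₁ σ (s≤s k₁≤) outer → let ensures q c = convolveStep-correct {k₁} {σ} k₁≤ outer in q , c })
            {run (K₁ ≔ # 0) σ₀} (record
              { free = refl ; rowP = refl ; rowC = refl ; sizeP = refl ; sizeC = refl
              ; below = λ _ _ → refl
              ; from  = λ k pos → contradiction (sym (fresh (f + k) (ℕ.m≤m+n f k))) (ℕ.<⇒≢ pos)
              ; into  = λ () } , refl))))
      where open Loop convolveStep Outer stepCost

    convolved : ∀ {σ} → Partial (λ a _ → a < 1 + (dp + dp)) σ →
      Convolution dp dc tp tc (λ k → mem σ Cell (f + k))
    convolved p = record { from = from ; into = λ k₁≤ → into (s≤s k₁≤) k₁≤ }
      where open Partial p

    -- A nonzero cell has an origin whose indices add up to at most 2 (dp + dc), so nothing is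
    -- written past the end of the new row.
    convolved-fresh : ∀ {σ} → Partial (λ a _ → a < 1 + (dp + dp)) σ →
      ∀ j → f + (1 + ((dp + dc) + (dp + dc))) ≤ j → mem σ Cell j ≡ 0
    convolved-fresh {σ} p j le with mem σ Cell j in eq
    ... | zero  = refl
    ... | suc x =
      let k₁ , k₂ , k₁≤ , k₂≤ , _ , _ , k≡ , _ = Partial.from p (j ∸ f)
            (subst (λ y → 0 < mem σ Cell y) (sym j≡) (subst (0 <_) (sym eq) (s≤s z≤n)))
      in contradiction (ℕ.+-cancelˡ-≤ f _ _ (subst (f + (1 + ((dp + dc) + (dp + dc))) ≤_) (sym j≡) le))
        (ℕ.<⇒≱ (s≤s (subst₂ _≤_ k≡ (interchange dp dp dc dc) (ℕ.+-mono-≤ k₁≤ k₂≤))))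
      where
      j≡ : f + (j ∸ f) ≡ j
      j≡ = ℕ.m+[n∸m]≡n (ℕ.≤-trans (ℕ.m≤m+n f _) le)

-- Contraction and its amortised cost

sumOver : ∀ {A : Set} → (A → ℕ) → List A → ℕ
sumOver f []       = 0
sumOver f (x ∷ xs) = f x + sumOver f xs

sumOver-mono : ∀ {A : Set} {f g : A → ℕ} xs → (∀ x → f x ≤ g x) → sumOver f xs ≤ sumOver g xs
sumOver-mono []       le = z≤n
sumOver-mono (x ∷ xs) le = ℕ.+-mono-≤ (le x) (sumOver-mono xs le)

sumOver-gain : ∀ {A : Set} {f g : A → ℕ} {x xs} d → x ∈ₗ xs → (∀ x → f x ≤ g x) → d + f x ≤ g x →
  d + sumOver f xs ≤ sumOver g xs
sumOver-gain {f = f} {g} {xs = x ∷ xs} d (here refl) le gain =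
  subst (_≤ g x + sumOver g xs) (ℕ.+-assoc d (f x) (sumOver f xs)) (ℕ.+-mono-≤ gain (sumOver-mono xs le))
sumOver-gain {f = f} {g} {xs = y ∷ xs} d (there x∈) le gain =
  subst (_≤ g y + sumOver g xs) (x∙yz≈y∙xz (f y) d (sumOver f xs))
    (ℕ.+-mono-≤ (le y) (sumOver-gain d x∈ le gain))

square : ℕ → ℕ
square x = x * x

square-mono : ∀ {x y} → x ≤ y → square x ≤ square y
square-mono le = ℕ.*-mono-≤ le le

-- Replacing two squares by the square of the sum gains the cross product twice; one copy pays for a
-- convolution, and the other is dropped.
square-+ : ∀ p c → p * c + square c + square p ≤ square (p + c)
square-+ p c = begin
  p * c + square c + square p           ≤⟨ ℕ.m≤m+n _ (c * p) ⟩
  p * c + square c + square p + c * p   ≡⟨ expand p c ⟩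
  square (p + c)                        ∎
  where
  open ℕ.≤-Reasoning
  expand : ∀ p c → p * c + c * c + p * p + c * p ≡ (p + c) * (p + c)
  expand = solve 2 (λ p c → p :* c :+ c :* c :+ p :* p :+ c :* p := (p :+ c) :* (p :+ c)) refl
    where open +-*-Solver

1+2s≤3s : ∀ {s} → 1 ≤ s → 1 + (s + s) ≤ 3 * s
1+2s≤3s {s} 1≤s = ℕ.+-mono-≤ 1≤s (ℕ.+-monoʳ-≤ s (ℕ.≤-reflexive (sym (ℕ.+-identityʳ s))))

-- A loop over the 1 + 2s indices of a row has overhead independent of s. As parts are nonempty, s
-- absorbs it, and the nested loops end up bounded by the bare product of the sizes.
affine-bound : ∀ a b {s} → 1 ≤ s → a + (1 + (s + s)) * b ≤ s * (a + 3 * b)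
affine-bound a b {s} 1≤s = begin
  a + (1 + (s + s)) * b ≤⟨ ℕ.+-mono-≤ (ℕ.≤-trans (ℕ.≤-reflexive (sym (ℕ.*-identityˡ a))) (ℕ.*-monoˡ-≤ a 1≤s))
                             (ℕ.*-monoˡ-≤ b (1+2s≤3s 1≤s)) ⟩
  s * a + 3 * s * b     ≡⟨ collect s a b ⟩
  s * (a + 3 * b)       ∎
  where
  open ℕ.≤-Reasoning
  collect : ∀ s a b → s * a + 3 * s * b ≡ s * (a + 3 * b)
  collect = solve 3 (λ s a b → s :* a :+ con 3 :* s :* b := s :* (a :+ con 3 :* b)) refl
    where open +-*-Solver

-- The factors result from `affine-bound`, applied to the inner loop of the convolution and then to
-- the outer one; each 3 comes from 1 + 2s ≤ 3s.
stepFactor pairFactor contractBase : ℕ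
stepFactor =
  (costᴱ (Cell ‹ $ RowP ⊕ $ K₁ ›) + (3 + (10 + (costᴱ (# 1 ⊕ ($ SizeC ⊕ $ SizeC)) + 5))) +
    maxCost (increment K₁) + 3) + 3 * (maxCost relaxStep + 3)
pairFactor = (10 + (costᴱ (# 1 ⊕ ($ SizeP ⊕ $ SizeP)) + 5)) + 3 * stepFactor
contractBase = maxCost fetchPair + maxCost storeRow

module Contracting {n : ℕ} (r : Fin n) (G : Graph n) (χ : Colouring n) where
  open Growth r
  open Tree G
  open Tables χ
  open Growing r
  open Initialising r G χ

  record Contracted (L : Pairs) (comp : Fin n → Subset n) (σ : State) : Set where
    field
      grown    : Grown L
      stage    : Stage L comp
      count    : val σ Count ≡ length L
      recorded : Recorded (mem σ Child) (mem σ Parent) L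
      ready    : ∀ v → Ready (comp v) v σ
      fresh    : Fresh σ

  record Fetched (c p : Fin n) (L : Pairs) (comp : Fin n → Subset n) (σ : State) : Set where
    field
      grown    : Grown ((c , p) ∷ L)
      stage    : Stage ((c , p) ∷ L) comp
      count    : val σ Count ≡ length L
      recorded : Recorded (mem σ Child) (mem σ Parent) L
      ready    : ∀ v → Ready (comp v) v σ
      fresh    : Fresh σ
      parent≡  : val σ P ≡ toℕ p
      rowP≡    : val σ RowP ≡ mem σ Row (toℕ p)
      rowC≡    : val σ RowC ≡ mem σ Row (toℕ c)
      sizeP≡   : val σ SizeP ≡ ∣ comp p ∣
      sizeC≡   : val σ SizeC ≡ ∣ comp c ∣

  fetchPair-correct : ∀ {c p L comp σ} → Contracted ((c , p) ∷ L) comp σ →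
    Fetched c p L comp (run fetchPair σ)
  fetchPair-correct {c} {p} {L} {comp} {σ} inv = record
    { grown    = grown
    ; stage    = stage
    ; count    = i≡
    ; recorded = proj₂ (proj₂ recorded)
    ; ready    = λ v → record { Ready (ready v) }
    ; fresh    = fresh
    ; parent≡  = P≡
    ; rowP≡    = cong (mem σ Row) P≡
    ; rowC≡    = cong (mem σ Row) C≡
    ; sizeP≡   = trans (cong (mem σ Size) P≡) (Ready.size (ready p))
    ; sizeC≡   = trans (cong (mem σ Size) C≡) (Ready.size (ready c))
    }
    where
    open Contracted inv
    i≡ : val σ Count ∸ 1 ≡ length L
    i≡ = cong (_∸ 1) count
    C≡ : mem σ Child (val σ Count ∸ 1) ≡ toℕ c
    C≡ = trans (cong (mem σ Child) i≡) (proj₁ recorded)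
    P≡ : mem σ Parent (val σ Count ∸ 1) ≡ toℕ p
    P≡ = trans (cong (mem σ Parent) i≡) (proj₁ (proj₂ recorded))

  module _ {c p L comp σ₁} (fetched : Fetched c p L comp σ₁) where
    open Fetched fetched
    open Ready using (size; bound; table)
    open Convolving r G χ σ₁

    fetched-rp< : rp + (dp + dp) < f
    fetched-rp< = subst₂ (λ x y → x + (y + y) < f) (sym rowP≡) (sym sizeP≡) (bound (ready p))

    fetched-rc< : rc + (dc + dc) < f
    fetched-rc< = subst₂ (λ x y → x + (y + y) < f) (sym rowC≡) (sym sizeC≡) (bound (ready c))

    Convolved : State → Set
    Convolved = Partial (λ a _ → a < 1 + (dp + dp))

    -- Only `p` is redirected to the new row; all other rows, including that of `c`, lie below the
    -- old `Free` and stay valid.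
    storeRow-correct : ∀ {σ₂} → (∀ a → writes convolve a ≡ false → mem σ₂ a ≡ mem σ₁ a) →
      Convolved σ₂ → Contracted L (merge c p comp) (run storeRow σ₂)
    storeRow-correct {σ₂} unwritten conv = record
      { grown    = proj₂ (proj₂ (proj₂ (grown-head grown)))
      ; stage    = stage-merge grown stage
      ; count    = trans (cong (λ m → m 0) (unwritten Count refl)) count
      ; recorded = subst₂ (λ g h → Recorded g h L) (sym (unwritten Child refl))
          (sym (unwritten Parent refl)) recorded
      ; ready    = λ v → ready-by v (v Fin.≟ p)
      ; fresh    = λ j le → convolved-fresh fetched-rp< fetched-rc< conv j (subst (_≤ j) free₃ le)
      }
      where
      open Partial conv
      σ₃ : State
      σ₃ = run storeRow σ₂
      table-p : Table (comp p) p tp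
      table-p = subst (λ x → Table (comp p) p (λ k → mem σ₁ Cell (x + k))) (sym rowP≡) (table (ready p))
      table-c : Table (comp c) c tc
      table-c = subst (λ x → Table (comp c) c (λ k → mem σ₁ Cell (x + k))) (sym rowC≡) (table (ready c))
      ∣merged∣ : ∣ comp p ∪ comp c ∣ ≡ dp + dc
      ∣merged∣ = trans (∣∪∣ (comp p) (comp c) (comps-disjoint grown stage)) (sym (cong₂ _+_ sizeP≡ sizeC≡))
      P₂ : val σ₂ P ≡ toℕ p
      P₂ = trans (cong (λ m → m 0) (unwritten P refl)) parent≡
      size₃ : val σ₂ SizeP + val σ₂ SizeC ≡ dp + dc
      size₃ = cong₂ _+_ sizeP sizeC
      free₃ : val σ₃ Free ≡ f + (1 + ((dp + dc) + (dp + dc)))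
      free₃ = cong₂ _+_ free (cong (λ x → 1 + (x + x)) size₃)
      ready-p : Ready (comp p ∪ comp c) p σ₃
      ready-p = record
        { size  = trans (cong (mem σ₂ Size [ val σ₂ P ↦ val σ₂ SizeP + val σ₂ SizeC ]) (sym P₂))
            (trans (upd-same (mem σ₂ Size) (val σ₂ P) (val σ₂ SizeP + val σ₂ SizeC))
              (trans size₃ (sym ∣merged∣)))
        ; bound = subst₂ _<_ (cong₂ _+_ (sym row≡) (cong (λ x → x + x) (sym ∣merged∣))) (sym free₃)
            (ℕ.+-monoʳ-< f ℕ.≤-refl)
        ; table = subst (λ x → Table (comp p ∪ comp c) p (λ k → mem σ₂ Cell (x + k))) (sym row≡)
            (table-merge grown stage table-p table-c
              (subst₂ (λ a b → Convolution a b tp tc (λ k → mem σ₂ Cell (f + k))) sizeP≡ sizeC≡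
                (convolved fetched-rp< fetched-rc< conv)))
        }
        where
        row≡ : mem σ₃ Row (toℕ p) ≡ f
        row≡ = trans (cong (mem σ₂ Row [ val σ₂ P ↦ val σ₂ Free ]) (sym P₂))
          (trans (upd-same (mem σ₂ Row) (val σ₂ P) (val σ₂ Free)) free)
      ready-other : ∀ v → v ≢ p → Ready (comp v) v σ₃
      ready-other v v≢p = ready-preserved {σ = σ₁} {σ₃}
        (trans (upd-other (mem σ₂ Size) (val σ₂ SizeP + val σ₂ SizeC) P≢v)
          (cong (λ m → m (toℕ v)) (unwritten Size refl)))
        (trans (upd-other (mem σ₂ Row) (val σ₂ Free) P≢v)
          (cong (λ m → m (toℕ v)) (unwritten Row refl)))
        (subst (f ≤_) (sym free₃) (ℕ.m≤m+n f (1 + ((dp + dc) + (dp + dc)))))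
        below (ready v)
        where
        P≢v : val σ₂ P ≢ toℕ v
        P≢v eq = v≢p (Fin.toℕ-injective (trans (sym eq) P₂))
      ready-by : ∀ v → Dec (v ≡ p) → Ready (merge c p comp v) v σ₃
      ready-by v (yes refl) = subst (λ D → Ready D p σ₃) (sym (merge-same c p comp)) ready-p
      ready-by v (no v≢p)   = subst (λ D → Ready D v σ₃) (sym (merge-other c p comp v≢p)) (ready-other v v≢p)

    convolve-store-correct : Ensures (convolve ⨾ storeRow) σ₁ (Contracted L (merge c p comp))
      (convolveCost fetched-rp< fetched-rc< + maxCost storeRow)
    convolve-store-correct =
      ensures-seq convolve storeRow {Q = Convolved} (convolve-correct fetched-rp< fetched-rc< fresh) λ conv →
        ensures-free storeRow refl (storeRow-correct (λ a eq → frame convolve a eq σ₁) conv)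

  module _ {c p L comp σ₁} (fetched : Fetched c p L comp σ₁) where
    open Fetched fetched
    open Convolving r G χ σ₁

    private
      rp<′ : rp + (dp + dp) < f
      rp<′ = fetched-rp< fetched
      rc<′ : rc + (dc + dc) < f
      rc<′ = fetched-rc< fetched

    convolve-cost : 1 ≤ dp → 1 ≤ dc → convolveCost rp<′ rc<′ ≤ dp * dc * pairFactor
    convolve-cost 1≤dp 1≤dc = begin
      convolveCost rp<′ rc<′              ≤⟨ affine-bound a (stepCost rp<′ rc<′ + 3) 1≤dp ⟩
      dp * (a + 3 * (stepCost rp<′ rc<′ + 3)) ≤⟨ ℕ.*-monoʳ-≤ dp (ℕ.+-mono-≤
                                           (ℕ.≤-trans (ℕ.≤-reflexive (sym (ℕ.*-identityˡ a))) (ℕ.*-monoˡ-≤ a 1≤dc))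
                                           (ℕ.*-monoʳ-≤ 3 step-cost)) ⟩
      dp * (dc * a + 3 * (dc * stepFactor)) ≡⟨ collect dp dc a stepFactor ⟩
      dp * dc * pairFactor                ∎
      where
      open ℕ.≤-Reasoning
      a b : ℕ
      a = 10 + (costᴱ (# 1 ⊕ ($ SizeP ⊕ $ SizeP)) + 5)
      b = costᴱ (Cell ‹ $ RowP ⊕ $ K₁ ›) + (3 + (10 + (costᴱ (# 1 ⊕ ($ SizeC ⊕ $ SizeC)) + 5))) +
        maxCost (increment K₁) + 3
      collect : ∀ x y a b → x * (y * a + 3 * (y * b)) ≡ x * y * (a + 3 * b)
      collect = solve 4 (λ x y a b → x :* (y :* a :+ con 3 :* (y :* b)) := x :* y :* (a :+ con 3 :* b)) refl
        where open +-*-Solver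
      regroup : ∀ u v w x y → u + (v + y) + w + x ≡ u + v + w + x + y
      regroup = solve 5 (λ u v w x y → u :+ (v :+ y) :+ w :+ x := u :+ v :+ w :+ x :+ y) refl
        where open +-*-Solver
      step-cost : stepCost rp<′ rc<′ + 3 ≤ dc * stepFactor
      step-cost = begin
        stepCost rp<′ rc<′ + 3
          ≡⟨ regroup (costᴱ (Cell ‹ $ RowP ⊕ $ K₁ ›)) (3 + (10 + (costᴱ (# 1 ⊕ ($ SizeC ⊕ $ SizeC)) + 5)))
               (maxCost (increment K₁)) 3 ((1 + (dc + dc)) * (maxCost relaxStep + 3)) ⟩
        b + (1 + (dc + dc)) * (maxCost relaxStep + 3)
          ≤⟨ affine-bound b (maxCost relaxStep + 3) 1≤dc ⟩
        dc * stepFactor ∎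

  -- Contracting c into p costs O(∣comp p∣ ∣comp c∣), and raises the potential by at least that product.
  potential : Pairs → (Fin n → Subset n) → ℕ
  potential L comp = sumOver (λ v → square ∣ comp v ∣) (active L)

  -- The square of the part of `c` leaves the sum together with `c`; the term of `p` makes up for it
  -- by `square-+`, and no other term decreases.
  potential-merge : ∀ {c p L comp} → Grown ((c , p) ∷ L) → Stage ((c , p) ∷ L) comp →
    ∣ comp p ∣ * ∣ comp c ∣ + potential ((c , p) ∷ L) comp ≤ potential L (merge c p comp)
  potential-merge {c} {p} {L} {comp} grown stage =
    subst (_≤ potential L (merge c p comp)) (ℕ.+-assoc (∣ comp p ∣ * ∣ comp c ∣) (square ∣ comp c ∣) _)
      (sumOver-gain (∣ comp p ∣ * ∣ comp c ∣ + square ∣ comp c ∣) (proj₁ (proj₂ (grown-head grown)))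
        (λ v → square-mono (Sub.p⊆q⇒∣p∣≤∣q∣ (merge-⊇ grown stage v)))
        (subst (λ x → ∣ comp p ∣ * ∣ comp c ∣ + square ∣ comp c ∣ + square ∣ comp p ∣ ≤ square x)
          (sym (trans (cong ∣_∣ (merge-same c p comp)) (∣∪∣ (comp p) (comp c) (comps-disjoint grown stage))))
          (square-+ ∣ comp p ∣ ∣ comp c ∣)))

  ∣comp∣≥1 : ∀ {L comp} → Stage L comp → ∀ v → 1 ≤ ∣ comp v ∣
  ∣comp∣≥1 {comp = comp} stage v = subst (_≤ ∣ comp v ∣) (Sub.∣⁅x⁆∣≡1 v)
    (Sub.p⊆q⇒∣p∣≤∣q∣ λ x∈ → subst (_∈ comp v) (sym (Sub.x∈⁅y⁆⇒x≡y v x∈)) (Stage.self stage v))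

  pairCost : Fin n → Fin n → (Fin n → Subset n) → ℕ
  pairCost c p comp = ∣ comp p ∣ * ∣ comp c ∣ * pairFactor

  convolve-store-bounded : ∀ {c p L comp σ₁} → Fetched c p L comp σ₁ →
    Ensures (convolve ⨾ storeRow) σ₁ (Contracted L (merge c p comp)) (pairCost c p comp + maxCost storeRow)
  convolve-store-bounded {c} {p} {comp = comp} fetched =
    ensures-weaken (ℕ.+-monoˡ-≤ (maxCost storeRow)
      (ℕ.≤-trans
        (convolve-cost fetched (subst (1 ≤_) (sym sizeP≡) (∣comp∣≥1 stage p))
          (subst (1 ≤_) (sym sizeC≡) (∣comp∣≥1 stage c)))
        (ℕ.≤-reflexive (cong₂ (λ a b → a * b * pairFactor) sizeP≡ sizeC≡))))
      (convolve-store-correct fetched)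
    where open Fetched fetched

  contract-correct : ∀ {c p L comp σ} → Contracted ((c , p) ∷ L) comp σ →
    Ensures contract σ (Contracted L (merge c p comp))
      (maxCost fetchPair + (pairCost c p comp + maxCost storeRow))
  contract-correct {c} {p} {L} {comp} {σ} inv =
    ensures-seq fetchPair (convolve ⨾ storeRow) {σ} {Fetched c p L comp} {Contracted L (merge c p comp)}
      (ensures-free fetchPair {σ} {Fetched c p L comp} refl (fetchPair-correct inv)) convolve-store-bounded

  module _ (D : Cmd) (k b : ℕ)
    (D-ok : ∀ {c p L comp σ} → Contracted ((c , p) ∷ L) comp σ →
            Ensures D σ (Contracted L (merge c p comp)) (∣ comp p ∣ * ∣ comp c ∣ * k + b)) where

    -- Amortised analysis: the rise of the potential, times `k`, pays for the part of a step that
    -- depends on the sizes, and `b + 3` covers the rest. The potential on the left makes the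
    -- inequalities telescope.
    potential-loop : ∀ L {comp σ} → Contracted L comp σ →
      ∃[ comp′ ] Contracted [] comp′ (iter (length L) (run D) σ) ×
        iterCost (length L) (run D) (cost D) σ + potential L comp * k ≤
          potential [] comp′ * k + length L * (b + 3)
    potential-loop [] {comp} inv = comp , inv , ℕ.≤-reflexive (sym (ℕ.+-identityʳ _))
    potential-loop ((c , p) ∷ L) {comp} {σ} inv with D-ok inv
    ... | ensures inv′ c≤ with potential-loop L inv′
    ...   | comp′ , done , total = comp′ , done , (begin
      cost D σ + (3 + rest) + φ * k
        ≤⟨ ℕ.+-monoˡ-≤ (φ * k) (ℕ.+-monoˡ-≤ (3 + rest) c≤) ⟩
      q * k + b + (3 + rest) + φ * k
        ≡⟨ regroup q k b rest φ ⟩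
      (b + 3) + (rest + (q + φ) * k)
        ≤⟨ ℕ.+-monoʳ-≤ (b + 3) (ℕ.+-monoʳ-≤ rest (ℕ.*-monoˡ-≤ k (potential-merge grown stage))) ⟩
      (b + 3) + (rest + potential L (merge c p comp) * k)
        ≤⟨ ℕ.+-monoʳ-≤ (b + 3) total ⟩
      (b + 3) + (potential [] comp′ * k + length L * (b + 3))
        ≡⟨ x∙yz≈y∙xz (b + 3) (potential [] comp′ * k) _ ⟩
      potential [] comp′ * k + (b + 3 + length L * (b + 3)) ∎)
      where
      open Contracted inv
      open ℕ.≤-Reasoning
      q rest φ : ℕ
      q = ∣ comp p ∣ * ∣ comp c ∣
      rest = iterCost (length L) (run D) (cost D) (run D σ)
      φ = potential ((c , p) ∷ L) comp
      regroup : ∀ q k b i φ → q * k + b + (3 + i) + φ * k ≡ (b + 3) + (i + (q + φ) * k)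
      regroup = solve 5 (λ q k b i φ → q :* k :+ b :+ (con 3 :+ i) :+ φ :* k :=
        (b :+ con 3) :+ (i :+ (q :+ φ) :* k)) refl
        where open +-*-Solver

  contractAll-correct : ∀ {L comp σ} → Contracted L comp σ → length L ≤ n →
    Ensures contractAll σ (λ σ′ → ∃[ comp′ ] Contracted [] comp′ σ′)
      (9 + (5 + (n * n * pairFactor + n * (contractBase + 3))))
  contractAll-correct {L} {comp} {σ} inv len = loop (potential-loop contract pairFactor contractBase
    (λ {c} {p} {L} {comp} inv → ensures-weaken
      (ℕ.≤-reflexive (x∙yz≈y∙xz (maxCost fetchPair) (pairCost c p comp) (maxCost storeRow)))
      (contract-correct inv)) L inv)
    where
    loop : (∃[ comp′ ] Contracted [] comp′ (iter (length L) (run contract) σ) ×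
             iterCost (length L) (run contract) (cost contract) σ + potential L comp * pairFactor ≤
               potential [] comp′ * pairFactor + length L * (contractBase + 3)) →
      Ensures contractAll σ (λ σ′ → ∃[ comp′ ] Contracted [] comp′ σ′)
        (9 + (5 + (n * n * pairFactor + n * (contractBase + 3))))
    loop (comp′ , done , total) = ensures-repeat ($ Count) contract (length L) (Contracted.count inv)
      ((comp′ , done) , ℕ.≤-trans (ℕ.m+n≤o⇒m≤o (iterCost (length L) (run contract) (cost contract) σ) total)
        -- Only the root is still active, so the final potential is the square of the size of a
        -- single part.
        (ℕ.+-mono-≤ (ℕ.*-monoˡ-≤ pairFactor
            (ℕ.≤-trans (ℕ.≤-reflexive (ℕ.+-identityʳ (square ∣ comp′ r ∣))) (square-mono (Sub.∣p∣≤n (comp′ r)))))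
          (ℕ.*-monoˡ-≤ (contractBase + 3) len)))

-- Choosing and printing the solution

max-either : ∀ m x → m + (x ∸ m) ≡ m ⊎ m + (x ∸ m) ≡ x
max-either m x with ℕ.≤-total x m
... | inj₁ x≤m = inj₁ (trans (cong (m +_) (ℕ.m≤n⇒m∸n≡0 x≤m)) (ℕ.+-identityʳ m))
... | inj₂ m≤x = inj₂ (ℕ.m+[n∸m]≡n m≤x)

module Choosing {n : ℕ} (r : Fin n) (G : Graph n) (χ : Colouring n)
                (comp : Fin n → Subset n) (σ₀ : State) where
  open Growth r
  open Tree G
  open Tables χ
  open Initialising r G χ

  module _ (order : val σ₀ N ≡ n) (best₀ : val σ₀ Best ≡ 0) (ready : ∀ v → Ready (comp v) v σ₀) where

    t : Fin n → ℕ → ℕ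
    t v k = mem σ₀ Cell (mem σ₀ Row (toℕ v) + k)

    record Chosen (i : ℕ) (σ : State) : Set where
      field
        index    : val σ I ≡ i
        cells    : mem σ Cell ≡ mem σ₀ Cell
        rows     : mem σ Row ≡ mem σ₀ Row
        sizes    : mem σ Size ≡ mem σ₀ Size
        attained : val σ Best ≡ 0 ⊎ ∃[ v ] val σ Best ≡ t v ∣ comp v ∣
        above    : ∀ v → toℕ v < i → t v ∣ comp v ∣ ≤ val σ Best

    chooseVertex-correct : ∀ {i σ} → i < n → Chosen i σ → Chosen (suc i) (run chooseVertex σ)
    chooseVertex-correct {i} {σ} i<n chosen = record
      { index    = trans (ℕ.+-comm (val σ I) 1) (cong suc index)
      ; cells    = cells
      ; rows     = rows
      ; sizes    = sizes
      ; attained = attained′ (max-either b x)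
      ; above    = λ { w (s≤s w≤i) → above′ w (ℕ.m≤n⇒m<n∨m≡n w≤i) }
      }
      where
      open Chosen chosen
      b x : ℕ
      b = val σ Best
      x = mem σ Cell (mem σ Row (val σ I) + mem σ Size (val σ I))
      v : Fin n
      v = fromℕ< i<n
      I≡ : val σ I ≡ toℕ v
      I≡ = trans index (sym (Fin.toℕ-fromℕ< i<n))
      x≡ : x ≡ t v ∣ comp v ∣
      x≡ = trans (cong (λ m → m (mem σ Row (val σ I) + mem σ Size (val σ I))) cells)
        (cong (mem σ₀ Cell) (cong₂ _+_ (cong₂ (λ m i → m i) rows I≡)
          (trans (cong₂ (λ m i → m i) sizes I≡) (Ready.size (ready v)))))
      attained′ : b + (x ∸ b) ≡ b ⊎ b + (x ∸ b) ≡ x → b + (x ∸ b) ≡ 0 ⊎ ∃[ v ] b + (x ∸ b) ≡ t v ∣ comp v ∣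
      attained′ (inj₂ eq) = inj₂ (v , trans eq x≡)
      attained′ (inj₁ eq) with attained
      ... | inj₁ b≡0      = inj₁ (trans eq b≡0)
      ... | inj₂ (w , b≡) = inj₂ (w , trans eq b≡)
      above′ : ∀ w → toℕ w < i ⊎ toℕ w ≡ i → t w ∣ comp w ∣ ≤ b + (x ∸ b)
      above′ w (inj₁ lt) = ℕ.≤-trans (above w lt) (ℕ.m≤m+n b (x ∸ b))
      above′ w (inj₂ eq) with refl ← Fin.toℕ-injective {i = w} {v} (trans eq (sym (Fin.toℕ-fromℕ< i<n))) =
        subst (_≤ b + (x ∸ b)) x≡ (ℕ.m≤n+m∸n x b)

    choose-correct : Ensures choose σ₀ (λ σ → Optimum comp t (val σ Best))
      (10 + (9 + (5 + n * (maxCost chooseVertex + 3))))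
    choose-correct = ensures-map {Q = Chosen n}
      (λ chosen → record
        { attained = Chosen.attained chosen ; above = λ v → Chosen.above chosen v (Fin.toℕ<n v) })
      (ensures-first (I ≔ # 0) (repeat $ N times chooseVertex) refl
        (ensures-repeat ($ N) chooseVertex n order
          (loop-rule n (λ i σ i<n chosen → chooseVertex-correct i<n chosen , cost≤ chooseVertex refl σ)
            {run (I ≔ # 0) σ₀} (record
              { index = refl ; cells = refl ; rows = refl ; sizes = refl
              ; attained = inj₁ best₀ ; above = λ _ () }))))
      where open Loop chooseVertex Chosen (maxCost chooseVertex)

module Printing {n : ℕ} where

  Powered : State → Set
  Powered σ = ∀ {j} → j ≤ n → mem σ Pow j ≡ 2 ^ j

  module _ (s m : ℕ) (m< : m < 2 ^ n) where

    -- The truncated `s ∸ i` also describes the idle rounds after the cardinality is used up, when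
    -- `Best` stays at `m`.
    record Reduced (i : ℕ) (σ : State) : Set where
      field
        order   : val σ N ≡ n
        powered : Powered σ
        best    : val σ Best ≡ (s ∸ i) * 2 ^ n + m

    dropCardinality-correct : ∀ {i σ} → Reduced i σ →
      Ensures dropCardinality σ (Reduced (suc i)) (maxCost dropCardinality)
    dropCardinality-correct {i} {σ} reduced =
      ensures-when (($ Best ⊕ # 1) ⊖ Pow ‹ $ N ›) (Best ≔ $ Best ⊖ Pow ‹ $ N ›)
      (λ eq → record { order = order ; powered = powered ; best = skip (s ∸ i) refl eq })
      λ lt → ensures-free (Best ≔ $ Best ⊖ Pow ‹ $ N ›) refl
        record { order = order ; powered = powered ; best = reduce (s ∸ i) refl lt }
      where
      open Reduced reduced
      pow≡ : mem σ Pow (val σ N) ≡ 2 ^ n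
      pow≡ = trans (cong (mem σ Pow) order) (powered ℕ.≤-refl)
      pred≡ : ∀ x → s ∸ i ≡ x → s ∸ suc i ≡ x ∸ 1
      pred≡ x eq = trans (cong (s ∸_) (ℕ.+-comm 1 i)) (trans (sym (ℕ.∸-+-assoc s i 1)) (cong (_∸ 1) eq))
      guard≡ : ∀ x → s ∸ i ≡ x → val σ Best + 1 ∸ mem σ Pow (val σ N) ≡ x * 2 ^ n + m + 1 ∸ 2 ^ n
      guard≡ x eq = cong₂ _∸_ (cong (_+ 1) (trans best (cong (λ y → y * 2 ^ n + m) eq))) pow≡
      skip : ∀ x → s ∸ i ≡ x → val σ Best + 1 ∸ mem σ Pow (val σ N) ≡ 0 →
        val σ Best ≡ (s ∸ suc i) * 2 ^ n + m
      skip zero    eq _ = trans best (cong (λ y → y * 2 ^ n + m) (trans eq (sym (pred≡ 0 eq))))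
      skip (suc x) eq z = contradiction (ℕ.m∸n≡0⇒m≤n (trans (sym (guard≡ (suc x) eq)) z))
        (ℕ.<⇒≱ (subst (2 ^ n <_) (ℕ.+-comm 1 _) (s≤s
          (ℕ.≤-trans (ℕ.m≤m+n (2 ^ n) (x * 2 ^ n)) (ℕ.m≤m+n (2 ^ n + x * 2 ^ n) m)))))
      reduce : ∀ x → s ∸ i ≡ x → 0 < val σ Best + 1 ∸ mem σ Pow (val σ N) →
        val σ Best ∸ mem σ Pow (val σ N) ≡ (s ∸ suc i) * 2 ^ n + m
      reduce zero    eq lt = contradiction
        (trans (guard≡ 0 eq) (ℕ.m≤n⇒m∸n≡0 (subst (_≤ 2 ^ n) (ℕ.+-comm 1 m) m<))) (ℕ.<⇒≢ lt ∘ sym)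
      reduce (suc x) eq _  = trans (cong₂ _∸_ (trans best (cong (λ y → y * 2 ^ n + m) eq)) pow≡)
        (trans (cong (_∸ 2 ^ n) (ℕ.+-assoc (2 ^ n) (x * 2 ^ n) m))
          (trans (ℕ.m+n∸m≡n (2 ^ n) (x * 2 ^ n + m)) (cong (λ y → y * 2 ^ n + m) (sym (pred≡ (suc x) eq)))))

    dropCardinality-loop : ∀ {σ} → s ≤ n → Reduced 0 σ →
      Ensures (repeat $ N times dropCardinality) σ (λ σ → val σ Best ≡ m)
        (9 + (5 + n * (maxCost dropCardinality + 3)))
    dropCardinality-loop {σ} s≤n reduced = ensures-map {Q = Reduced n}
      (λ reduced → trans (Reduced.best reduced) (cong (λ y → y * 2 ^ n + m) (ℕ.m≤n⇒m∸n≡0 s≤n)))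
      (ensures-repeat ($ N) dropCardinality n (Reduced.order reduced)
        (loop-rule n (λ i σ _ reduced → let ensures q c = dropCardinality-correct reduced in q , c) {σ} reduced))
      where open Loop dropCardinality Reduced (maxCost dropCardinality)

  -- Here S is the unprinted tail of the solution and `Best` its binary number. By `wt-bit<` the
  -- digits after the first stay below the leading power, so comparing with that power reveals the
  -- first digit.
  printDigits-loop : ∀ {k} (S : Subset k) {σ} → k ≤ n → val σ I ≡ k → val σ Best ≡ wt bit S → Powered σ →
    out (iter k (run printDigit) σ) ≡ out σ ++ encodeSubset S ×
    iterCost k (run printDigit) (cost printDigit) σ ≤ k * (maxCost printDigit + 3)
  printDigits-loop [] {σ} _ _ _ _ = sym (List.++-identityʳ (out σ)) , z≤n
  printDigits-loop {suc k} (b ∷ S) {σ} k<n I≡ best powered =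
    let out≡ , c = printDigits-loop S {run printDigit σ} (ℕ.<⇒≤ k<n)
          (trans (frame-at last I refl σ₁ 0) i≡) (best₂ b refl)
          (λ {j} j≤ → trans (frame-at printDigit Pow refl σ j) (powered j≤))
    in trans out≡ (trans (cong (_++ encodeSubset S) out₂)
         (List.∷ʳ-++ (out σ) (sideCode b) (encodeSubset S))) ,
       ℕ.+-mono-≤ (cost≤ printDigit refl σ) (ℕ.+-monoʳ-≤ 3 c)
    where
    last : Cmd
    last = when $ B then Best ≔ $ Best ⊖ Pow ‹ $ I ›
    σ₁ : State
    σ₁ = run (print ($ B)) (run (B ≔ # 1 ⊖ (Pow ‹ $ I › ⊖ $ Best)) (run (I ≔ $ I ⊖ # 1) σ))
    i d : ℕ
    i = val σ I ∸ 1
    d = 1 ∸ (mem σ Pow i ∸ val σ Best)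
    i≡ : i ≡ k
    i≡ = cong (_∸ 1) I≡
    pow≡ : mem σ Pow i ≡ 2 ^ k
    pow≡ = trans (cong (mem σ Pow) i≡) (powered (ℕ.<⇒≤ k<n))
    d≡ : ∀ b′ → b ≡ b′ → d ≡ sideCode b′
    d≡ true  refl = cong (1 ∸_) (trans (cong₂ _∸_ pow≡ best) (ℕ.m≤n⇒m∸n≡0 (ℕ.m≤m+n (2 ^ k) (wt bit S))))
    d≡ false refl = ℕ.m≤n⇒m∸n≡0 (subst (1 ≤_) (sym (cong₂ _∸_ pow≡ best)) (ℕ.m<n⇒0<n∸m (wt-bit< S)))
    out₂ : out (run printDigit σ) ≡ out σ ∷ʳ sideCode b
    out₂ = trans (frame-out last refl σ₁) (cong (out σ ∷ʳ_) (d≡ b refl))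
    best₂ : ∀ b′ → b ≡ b′ → val (run last σ₁) Best ≡ wt bit S
    best₂ true refl = trans
      (cong (λ τ → val τ Best) (pick-positive {x = val σ₁ B} {σ₁} {run (Best ≔ $ Best ⊖ Pow ‹ $ I ›) σ₁}
        (subst (0 <_) (sym (d≡ true refl)) (s≤s z≤n))))
      (trans (cong₂ _∸_ best pow≡) (ℕ.m+n∸m≡n (2 ^ k) (wt bit S)))
    best₂ false refl = trans
      (cong (λ τ → val τ Best) (pick-zero {x = val σ₁ B} {σ₁} {run (Best ≔ $ Best ⊖ Pow ‹ $ I ›) σ₁}
        (d≡ false refl)))
      best

  printSet-correct : ∀ (S : Subset n) {σ} → val σ N ≡ n → Powered σ → val σ Best ≡ wt code S → out σ ≡ [] →
    Ensures printSet σ (λ σ → out σ ≡ encodeSubset S)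
      ((9 + (5 + n * (maxCost dropCardinality + 3))) + (18 + (9 + (5 + n * (maxCost printDigit + 3)))))
  printSet-correct S {σ} order powered best out≡ =
    ensures-seq (repeat $ N times dropCardinality) printDigits {Q = λ σ → val σ Best ≡ wt bit S}
      (dropCardinality-loop ∣ S ∣ (wt bit S) (wt-bit< S) (Sub.∣p∣≤n S)
        record { order = order ; powered = powered ; best = trans best (wt-code S) })
      λ best₁ → print-rest best₁
        (trans (frame-at dropping N refl σ 0) order)
        (λ {j} j≤ → trans (frame-at dropping Pow refl σ j) (powered j≤))
        (trans (frame-out dropping refl σ) out≡)
    where
    dropping : Cmd
    dropping = repeat $ N times dropCardinality
    print-rest : ∀ {σ} → val σ Best ≡ wt bit S → val σ N ≡ n → Powered σ → out σ ≡ [] →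
      Ensures printDigits σ (λ σ → out σ ≡ encodeSubset S) (18 + (9 + (5 + n * (maxCost printDigit + 3))))
    print-rest {σ} best order powered out≡ =
      ensures-first (I ≔ $ N) (repeat $ N times printDigit) refl
        (ensures-repeat ($ N) printDigit n order
          (let out₁ , c = printDigits-loop S {run (I ≔ $ N) σ} ℕ.≤-refl order best powered
           in trans out₁ (cong (_++ encodeSubset S) out≡) , c))

-- Reading the input and tabulating the powers of two

readColours-correct : ∀ xs {σ k rest} → inp σ ≡ k ∷ xs ++ rest → length xs ≡ k →
  Ensures readColours σ (λ σ′ → val σ′ N ≡ k × inp σ′ ≡ rest × Stored (mem σ′ Col) 0 xs)
    (10 + (10 + (9 + (5 + length xs * (maxCost readColour + 3)))))
readColours-correct xs {σ} {k} {rest} inp≡ len =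
  ensures-map {Q = λ σ′ → inp σ′ ≡ rest × Stored (mem σ′ Col) 0 xs}
    (λ (inp≡′ , stored) → trans (frame-at readLoop N refl σ₁ 0) (cong hd inp≡) , inp≡′ , stored)
    (ensures-first (read N (# 0)) (I ≔ # 0 ⨾ readLoop) refl
      (ensures-first (I ≔ # 0) readLoop refl (ensures-repeat ($ N) readColour (length xs)
          (trans (cong hd inp≡) (sym len))
          (let inp≡′ , stored , _ , c = readColours-loop xs {rest} {σ₁} (cong tl inp≡) refl
           in (inp≡′ , stored) , c))))
  where
  readLoop : Cmd
  readLoop = repeat $ N times readColour
  σ₁ : State
  σ₁ = run (I ≔ # 0) (run (read N (# 0)) σ)

readEdges-correct : ∀ {n} (es : List (Fin n × Fin n)) {σ} → inp σ ≡ length es ∷ endpoints es →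
  Ensures readEdges σ (λ σ′ → val σ′ M ≡ length es × StoredEdges (mem σ′ EdgeU) (mem σ′ EdgeV) 0 es)
    (10 + (10 + (9 + (5 + length es * (maxCost readEdge + 3)))))
readEdges-correct es {σ} inp≡ =
  ensures-map {Q = λ σ′ → StoredEdges (mem σ′ EdgeU) (mem σ′ EdgeV) 0 es}
    (λ stored → trans (frame-at readLoop M refl σ₁ 0) (cong hd inp≡) , stored)
    (ensures-first (read M (# 0)) (I ≔ # 0 ⨾ readLoop) refl
      (ensures-first (I ≔ # 0) readLoop refl (ensures-repeat ($ M) readEdge (length es) (cong hd inp≡)
          (let stored , _ , c = readEdges-loop es {σ₁} (cong tl inp≡) refl in stored , c))))
  where
  readLoop : Cmd
  readLoop = repeat $ M times readEdge
  σ₁ : State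
  σ₁ = run (I ≔ # 0) (run (read M (# 0)) σ)

powers-correct : ∀ {σ n} → val σ N ≡ n →
  Ensures powers σ (λ σ′ → ∀ {j} → j ≤ n → mem σ′ Pow j ≡ 2 ^ j)
    (10 + (10 + (9 + (5 + n * (maxCost nextPower + 3)))))
powers-correct {σ} {n} N≡ =
  ensures-first (Pow ‹ # 0 ›≔ # 1) (I ≔ # 0 ⨾ repeat $ N times nextPower) refl
    (ensures-first (I ≔ # 0) (repeat $ N times nextPower) refl
      (ensures-repeat ($ N) nextPower n N≡
        (let (_ , powered) , c = powers-loop n {run (I ≔ # 0) (run (Pow ‹ # 0 ›≔ # 1) σ)} refl refl
         in (λ {j} → powered {j}) , c)))

-- Quadratic time bounds

-- At n = 0 a positive constant is not bounded by a multiple of n², hence the restriction to n ≥ 1,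
-- which becomes the threshold in `quadratic-∈O`.
record Quadratic (f : ℕ → ℕ) : Set where
  constructor quadratic
  field
    factor  : ℕ
    bounded : ∀ n → 1 ≤ n → f n ≤ factor * (n * n)

n≤n*n : ∀ {n} → 1 ≤ n → n ≤ n * n
n≤n*n {n} 1≤n = subst (_≤ n * n) (ℕ.*-identityʳ n) (ℕ.*-monoʳ-≤ n 1≤n)

quadratic-const : ∀ c → Quadratic (λ _ → c)
quadratic-const c = quadratic c λ n 1≤n →
  subst (_≤ c * (n * n)) (ℕ.*-identityʳ c) (ℕ.*-monoʳ-≤ c (ℕ.≤-trans 1≤n (n≤n*n 1≤n)))

quadratic-linear : ∀ c → Quadratic (λ n → n * c)
quadratic-linear c = quadratic c λ n 1≤n →
  subst (_≤ c * (n * n)) (ℕ.*-comm c n) (ℕ.*-monoʳ-≤ c (n≤n*n 1≤n))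

quadratic-square : ∀ c → Quadratic (λ n → n * n * c)
quadratic-square c = quadratic c λ n _ → ℕ.≤-reflexive (ℕ.*-comm (n * n) c)

quadratic-nested : ∀ a b c → Quadratic (λ n → n * (a + n * c + b))
quadratic-nested a b c = quadratic (a + b + c) λ n 1≤n → begin
  n * (a + n * c + b)                   ≡⟨ expand n a b c ⟩
  n * (a + b) + n * n * c               ≤⟨ ℕ.+-monoˡ-≤ (n * n * c) (ℕ.*-monoˡ-≤ (a + b) (n≤n*n 1≤n)) ⟩
  n * n * (a + b) + n * n * c           ≡⟨ ℕ.*-distribˡ-+ (n * n) (a + b) c ⟨
  n * n * (a + b + c)                   ≡⟨ ℕ.*-comm (n * n) (a + b + c) ⟩
  (a + b + c) * (n * n)                 ∎
  where
  open ℕ.≤-Reasoning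
  expand : ∀ n a b c → n * (a + n * c + b) ≡ n * (a + b) + n * n * c
  expand = solve 4 (λ n a b c → n :* (a :+ n :* c :+ b) := n :* (a :+ b) :+ n :* n :* c) refl
    where open +-*-Solver

quadratic-+ : ∀ {f g} → Quadratic f → Quadratic g → Quadratic (λ n → f n + g n)
quadratic-+ (quadratic a f≤) (quadratic b g≤) = quadratic (a + b) λ n 1≤n →
  ℕ.≤-trans (ℕ.+-mono-≤ (f≤ n 1≤n) (g≤ n 1≤n)) (ℕ.≤-reflexive (sym (ℕ.*-distribʳ-+ (n * n) a b)))

quadratic-∈O : ∀ {f} → Quadratic f → f ∈O (λ n → n ^ 2)
quadratic-∈O {f} (quadratic a f≤) = a , 1 , λ n 1≤n →
  subst (λ x → f n ≤ a * (n * x)) (sym (ℕ.*-identityʳ n)) (f≤ n 1≤n)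

-- The bounds of the phases, with the number of edges replaced by n, as `few-edges` allows; the time
-- must depend on n alone.
readColoursTime readEdgesTime powersTime growTime initTime contractTime chooseTime printTime time : ℕ → ℕ
readColoursTime n = 10 + (10 + (9 + (5 + n * (maxCost readColour + 3))))
readEdgesTime n = 10 + (10 + (9 + (5 + n * (maxCost readEdge + 3))))
powersTime n = 10 + (10 + (9 + (5 + n * (maxCost nextPower + 3))))
growTime n = 10 + (9 + (5 + n * (10 + (9 + (5 + n * (maxCost growEdge + 3))) + 3)))
initTime n = 10 + (9 + (5 + n * (maxCost initVertex + 3)))
contractTime n = 9 + (5 + (n * n * pairFactor + n * (contractBase + 3)))
chooseTime n = 10 + (9 + (5 + n * (maxCost chooseVertex + 3)))
printTime n =
  (9 + (5 + n * (maxCost dropCardinality + 3))) + (18 + (9 + (5 + n * (maxCost printDigit + 3))))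
time n = readColoursTime n + (readEdgesTime n + (powersTime n + (growTime n +
  (initTime n + (contractTime n + (chooseTime n + printTime n))))))

time-quadratic : Quadratic time
time-quadratic =
  quadratic-+ (affine 34 (maxCost readColour + 3)) (quadratic-+ (affine 34 (maxCost readEdge + 3))
    (quadratic-+ (affine 34 (maxCost nextPower + 3)) (quadratic-+
      (quadratic-+ (quadratic-const 24) (quadratic-nested 24 3 (maxCost growEdge + 3)))
      (quadratic-+ (affine 24 (maxCost initVertex + 3)) (quadratic-+
        (quadratic-+ (quadratic-const 14)
          (quadratic-+ (quadratic-square pairFactor) (quadratic-linear (contractBase + 3))))
        (quadratic-+ (affine 24 (maxCost chooseVertex + 3))
          (quadratic-+ (affine 14 (maxCost dropCardinality + 3)) (affine 32 (maxCost printDigit + 3)))))))))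
  where
  affine : ∀ a b → Quadratic (λ n → a + n * b)
  affine a b = quadratic-+ (quadratic-const a) (quadratic-linear b)

-- Composition of the phases

-- The algorithm never clears memory: these are the zeros of the initial configuration, and the
-- empty output, on which the later phases rely.
record Blank (σ : State) : Set where
  field
    visited : ∀ j → mem σ Visited j ≡ 0
    count   : val σ Count ≡ 0
    free    : val σ Free ≡ 0
    table    : ∀ j → mem σ Cell j ≡ 0
    best    : val σ Best ≡ 0
    silent  : out σ ≡ []

blank-after : ∀ D {σ} → writes D Visited ≡ false → writes D Count ≡ false → writes D Free ≡ false →
  writes D Cell ≡ false → writes D Best ≡ false → prints D ≡ false → Blank σ → Blank (run D σ)
blank-after D {σ} v c f e b p blank = record
  { visited = λ j → trans (frame-at D Visited v σ j) (visited j)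
  ; count   = trans (frame-at D Count c σ 0) count
  ; free    = trans (frame-at D Free f σ 0) free
  ; table    = λ j → trans (frame-at D Cell e σ j) (table j)
  ; best    = trans (frame-at D Best b σ 0) best
  ; silent  = trans (frame-out D p σ) silent
  }
  where open Blank blank

module Solving {m : ℕ} (G : Graph (suc m)) (tree : IsTree G) (χ : Colouring (suc m))
               (es : List (Fin (suc m) × Fin (suc m))) (edges : IsEdgeList G es) where

  n : ℕ
  n = suc m

  open Growth {n} zero
  open Tree G
  open Tables χ
  open Growing {n} zero
  open Initialising zero G χ
  open Contracting zero G χ

  L : Pairs
  L = passes n es

  Solved : State → Set
  Solved σ = ∃[ S ] (IsBCS G χ S × out σ ≡ encodeSubset S)

  Powered : State → Set
  Powered σ = ∀ {j} → j ≤ n → mem σ Pow j ≡ 2 ^ j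

  choose-stage : ∀ {comp σ} → Contracted [] comp σ → val σ N ≡ n → Powered σ → val σ Best ≡ 0 → out σ ≡ [] →
    Ensures (choose ⨾ printSet) σ Solved (chooseTime n + printTime n)
  choose-stage {comp} {σ} inv order powered best silent =
    ensures-seq choose printSet {Q = λ σ′ → Optimum comp entry (val σ′ Best)}
      (choose-correct order best ready) λ optimum →
      let S , bcs , code≡ = best⇒BCS (IsTree.connected tree) stage (λ v → Ready.table (ready v)) optimum
      in ensures-map {Q = λ σ′ → out σ′ ≡ encodeSubset S} (λ out≡ → S , bcs , out≡)
        (Printing.printSet-correct S (trans (frame-at choose N refl σ 0) order)
          (λ {j} j≤ → trans (frame-at choose Pow refl σ j) (powered j≤))
          (sym code≡) (trans (frame-out choose refl σ) silent))
    where
    open Contracted inv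
    open Choosing zero G χ comp σ
    entry : Fin n → ℕ → ℕ
    entry v k = mem σ Cell (mem σ Row (toℕ v) + k)

  contract-stage : ∀ {comp σ} → Contracted L comp σ → val σ N ≡ n → Powered σ → val σ Best ≡ 0 → out σ ≡ [] →
    Ensures (contractAll ⨾ choose ⨾ printSet) σ Solved (contractTime n + (chooseTime n + printTime n))
  contract-stage {comp} {σ} inv order powered best silent =
    ensures-seq contractAll (choose ⨾ printSet) {Q = λ σ′ → ∃[ comp′ ] Contracted [] comp′ σ′}
      (contractAll-correct inv (ℕ.<⇒≤ (grown-length (Contracted.grown inv)))) λ (comp′ , inv′) →
        choose-stage inv′ (trans (frame-at contractAll N refl σ 0) order)
          (λ {j} j≤ → trans (frame-at contractAll Pow refl σ j) (powered j≤))
          (trans (frame-at contractAll Best refl σ 0) best)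
          (trans (frame-out contractAll refl σ) silent)

  afterInit afterGrow afterPowers afterEdges : Cmd
  afterInit   = contractAll ⨾ choose ⨾ printSet
  afterGrow   = initTables ⨾ afterInit
  afterPowers = growTree ⨾ afterGrow
  afterEdges  = powers ⨾ afterPowers

  init-stage : ∀ {σ} → Holds L σ → Inputs σ → val σ Free ≡ 0 → (∀ j → mem σ Cell j ≡ 0) → val σ Best ≡ 0 →
    out σ ≡ [] → Ensures afterGrow σ Solved (initTime n + (contractTime n + (chooseTime n + printTime n)))
  init-stage {σ} h inputs free table best silent =
    ensures-seq initTables afterInit {Q = Initialised n} (initTables-correct inputs free table) λ init →
      let open Initialised init in
      contract-stage {⁅_⁆} (record
        { grown    = grown-passes tree edges n
        ; stage    = stage-initial (tree-edges tree edges)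
        ; count    = trans (frame-at initTables Count refl σ 0) (Holds.count h)
        ; recorded = subst₂ (λ f g → Recorded f g L) (sym (frame initTables Child refl σ))
            (sym (frame initTables Parent refl σ)) (Holds.recorded h)
        ; ready    = λ v → ready v (Fin.toℕ<n v)
        ; fresh    = fresh
        }) (Inputs.order inputs₁) (Inputs.powered inputs₁)
        (trans (frame-at initTables Best refl σ 0) best) (trans (frame-out initTables refl σ) silent)
    where
    inputs₁ : Inputs (run initTables σ)
    inputs₁ = record
      { order   = trans (frame-at initTables N refl σ 0) (Inputs.order inputs)
      ; powered = λ {j} j≤ → trans (frame-at initTables Pow refl σ j) (Inputs.powered inputs j≤)
      ; colours = λ v → trans (frame-at initTables Col refl σ (toℕ v)) (Inputs.colours inputs v)
      }

  Edges : State → Set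
  Edges σ = val σ M ≡ length es × StoredEdges (mem σ EdgeU) (mem σ EdgeV) 0 es

  grow-stage : ∀ {σ} → Inputs σ → Edges σ → Blank σ →
    Ensures afterPowers σ Solved (growTime n + (initTime n + (contractTime n + (chooseTime n + printTime n))))
  grow-stage {σ} inputs (M≡ , stored) blank =
    ensures-seq growTree afterGrow {Q = Holds L}
      (ensures-weaken growTree≤ (growTree-correct es order (started , stored , M≡))) λ h →
      init-stage h record
        { order   = trans (frame-at growTree N refl σ 0) order
        ; powered = λ {j} j≤ → trans (frame-at growTree Pow refl σ j) (powered j≤)
        ; colours = λ v → trans (frame-at growTree Col refl σ (toℕ v)) (colours v)
        }
        (trans (frame-at growTree Free refl σ 0) free)
        (λ j → trans (frame-at growTree Cell refl σ j) (table j))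
        (trans (frame-at growTree Best refl σ 0) best)
        (trans (frame-out growTree refl σ) silent)
    where
    open Inputs inputs
    open Blank blank
    growTree≤ : 10 + (9 + (5 + n * (passCost (length es) + 3))) ≤ growTime n
    growTree≤ = ℕ.+-monoʳ-≤ 24 (ℕ.*-monoʳ-≤ n (ℕ.+-monoˡ-≤ 3 (ℕ.+-monoʳ-≤ 24
      (ℕ.*-monoˡ-≤ (maxCost growEdge + 3) (few-edges tree edges)))))
    started : Holds [] (run (Visited ‹ # 0 ›≔ # 1) σ)
    started = record
      { visited   = λ { (here refl) → refl }
      ; unvisited = λ { {zero} v∉ → contradiction (here refl) v∉ ; {suc v} _ → visited (suc (toℕ v)) }
      ; count     = count
      ; recorded  = tt
      }

  powers-stage : ∀ {σ} → val σ N ≡ n → (∀ v → mem σ Col (toℕ v) ≡ colourCode (χ v)) → Edges σ → Blank σ →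
    Ensures afterEdges σ Solved
      (powersTime n + (growTime n + (initTime n + (contractTime n + (chooseTime n + printTime n)))))
  powers-stage {σ} order colours (M≡ , stored) blank =
    ensures-seq powers afterPowers {Q = Powered} (powers-correct order) λ powered →
      grow-stage record
        { order   = trans (frame-at powers N refl σ 0) order
        ; powered = λ {j} → powered {j}
        ; colours = λ v → trans (frame-at powers Col refl σ (toℕ v)) (colours v)
        }
        (trans (frame-at powers M refl σ 0) M≡ ,
         subst₂ (λ f g → StoredEdges f g 0 es) (sym (frame powers EdgeU refl σ))
           (sym (frame powers EdgeV refl σ)) stored)
        (blank-after powers {σ} refl refl refl refl refl refl blank)

  edges-stage : ∀ {σ} → val σ N ≡ n → (∀ v → mem σ Col (toℕ v) ≡ colourCode (χ v)) →
    inp σ ≡ length es ∷ endpoints es → Blank σ →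
    Ensures (readEdges ⨾ afterEdges) σ Solved (readEdgesTime n +
      (powersTime n + (growTime n + (initTime n + (contractTime n + (chooseTime n + printTime n))))))
  edges-stage {σ} order colours inp≡ blank =
    ensures-seq readEdges afterEdges {Q = Edges}
      (ensures-weaken readEdges≤ (readEdges-correct es inp≡)) λ stored →
      powers-stage (trans (frame-at readEdges N refl σ 0) order)
        (λ v → trans (frame-at readEdges Col refl σ (toℕ v)) (colours v))
        stored (blank-after readEdges {σ} refl refl refl refl refl refl blank)
    where
    readEdges≤ : 10 + (10 + (9 + (5 + length es * (maxCost readEdge + 3)))) ≤ readEdgesTime n
    readEdges≤ = ℕ.+-monoʳ-≤ 34 (ℕ.*-monoˡ-≤ (maxCost readEdge + 3) (few-edges tree edges))

  algorithm-correct : Ensures algorithm (start (encodeInput χ es)) Solved (time n)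
  algorithm-correct =
    ensures-seq readColours (readEdges ⨾ afterEdges) {σ₀}
      {Colours} (subst (λ k → Ensures readColours σ₀ Colours (10 + (10 + (9 + (5 + k * (maxCost readColour + 3))))))
        len (readColours-correct xs {σ₀} {n} {length es ∷ endpoints es} refl len))
      λ (order , inp≡ , stored) →
      edges-stage order (λ v → trans (cong (mem (run readColours σ₀) Col) (sym (ℕ.+-identityʳ (toℕ v))))
          (stored-tabulate (λ v → colourCode (χ v)) stored v))
        inp≡ (blank-after readColours {σ₀} refl refl refl refl refl refl record
          { visited = λ _ → refl ; count = refl ; free = refl ; table = λ _ → refl
          ; best = refl ; silent = refl })
    where
    xs : List ℕ
    xs = toList (tabulate λ v → colourCode (χ v))
    Colours : State → Set
    Colours σ = val σ N ≡ n × inp σ ≡ length es ∷ endpoints es × Stored (mem σ Col) 0 xs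
    σ₀ : State
    σ₀ = start (encodeInput χ es)
    len : length xs ≡ n
    len = Vec.length-toList (tabulate λ v → colourCode (χ v))

theorem1 :
  Σ[ P ∈ Program ] Σ[ T ∈ (ℕ → ℕ) ] (T ∈O (λ n → n ^ 2)) ×
    (∀ {n : ℕ} (G : Graph n) → IsTree G → (χ : Colouring n) →
     (es : List (Fin n × Fin n)) → IsEdgeList G es →
     ∃[ S ] (IsBCS G χ S × (P on encodeInput χ es outputs encodeSubset S within T n)))
theorem1 = program algorithm , time , quadratic-∈O time-quadratic , solve-BCS
  where
  solve-BCS : ∀ {n : ℕ} (G : Graph n) → IsTree G → (χ : Colouring n) →
    (es : List (Fin n × Fin n)) → IsEdgeList G es →
    ∃[ S ] (IsBCS G χ S × (program algorithm on encodeInput χ es outputs encodeSubset S within time n))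
  solve-BCS {zero}  G tree χ es edges with () ← NonZero.nonZero (IsTree.nonempty tree)
  solve-BCS {suc m} G tree χ es edges =
    let ensures (S , bcs , out≡) cost≤time = Solving.algorithm-correct G tree χ es edges
        σ₀ = start (encodeInput χ es)
    in S , bcs , cost algorithm σ₀ , cost≤time ,
       subst (λ os → program algorithm ⊢ initial (encodeInput χ es) ⇓[ cost algorithm σ₀ ] os) out≡
         (program-correct algorithm (encodeInput χ es))
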